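{- Let $(\mathbf A_n)_{n\in\mathbb N}$ be a sequence of finite graphs of uniformly bounded degree (i.e. there is $D$ such that every vertex of every $\mathbf A_n$ has degree at most $D$). Then the following conditions are equivalent: (1) the sequence $(\mathbf A_n)_{n\in\mathbb N}$ is strongly polynomial; (2) there is a finite set $\{\mathbf F_1,\dots,\mathbf F_k\}$ of graphs and polynomials $P_1,\dots,P_k$ such that for every $n\in\mathbb N$, $\mathbf A_n$ is (isomorphic to) the disjoint union $\sum_{i=1}^k P_i(n)\,\mathbf F_i$, where $P_i(n)\,\mathbf F_i$ denotes the disjoint union of $P_i(n)$ copies of $\mathbf F_i$; (3) the sequence $(\mathbf A_n)_{n\in\mathbb N}$ is a QF-interpretation of a basic sequence, i.e. there exist integers $k,\ell$, a basic sequence $(\mathbf B_n)_{n\in\mathbb N}$ of structures in $\mathcal B_{k,\ell}$ and a QF-interpretation scheme $I$ of graphs in $\beta_{k,\ell}$-structures such that $\mathbf A_n$ is isomorphic to $I(\mathbf B_n)$ for every $n\in\mathbb N$.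
   Context: Graphs are viewed as relational structures with a single symmetric irreflexive binary relation (adjacency). A signature $\lambda$ is a finite set of relation symbols, each with an arity; a $\lambda$-structure $\mathbf A$ consists of a finite domain $A$ and, for each $R\in\lambda$ of arity $r$, a relation $R^{\mathbf A}\subseteq A^r$. For a first-order formula $\phi$ over $\lambda$ (first-order logic with equality) with exactly $p$ free variables $x_1,\dots,x_p$, let $\phi(\mathbf A)=\{(v_1,\dots,v_p)\in A^p:\mathbf A\models\phi(v_1,\dots,v_p)\}$. A sequence $(\mathbf A_n)_{n\in\mathbb N}$ of $\lambda$-structures is strongly polynomial if for every quantifier-free formula $\phi$ there is a polynomial $P_\phi$ with $|\phi(\mathbf A_n)|=P_\phi(n)$ for all $n\in\mathbb N$. Interpretation scheme: if $\lambda$ has relation symbols $R_1,\dots,R_q$ of arities $r_1,\dots,r_q$, an interpretation scheme of $\lambda$-structures in $\kappa$-structures with exponent $p$ is a tuple $I=(p,\rho_0,\dots,\rho_q)$ where $\rho_0$ is a first-order $\kappa$-formula with $p$ free variables and $\rho_i$ a first-order $\kappa$-formula with $pr_i$ free variables; $I(\mathbf A)$ is the $\lambda$-structure with domain $\rho_0(\mathbf A)\subseteq A^p$ in which $R_i(\mathbf v_1,\dots,\mathbf v_{r_i})$ holds iff $\mathbf A\models\rho_i(\mathbf v_1,\dots,\mathbf v_{r_i})$. It is a QF-interpretation scheme if all $\rho_i$ are quantifier-free. Strong sum: for a $\kappa$-structure $\mathbf A$ and $\lambda$-structure $\mathbf B$, $\mathbf A\oplus\mathbf B$ is the structure with signature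 the disjoint union $\kappa\sqcup\lambda$, domain the disjoint union $A\sqcup B$, in which each $R\in\kappa$ holds exactly on the tuples of $A$ on which it holds in $\mathbf A$, and each $S\in\lambda$ holds exactly on the tuples of $B$ on which it holds in $\mathbf B$. Basic structures: $\mathbf E$ is the structure with a one-element domain and one unary relation $U$ true on that element. $\mathbf T_N$ has domain $\{1,\dots,N\}$, a binary relation $S$ with $S(i,j)\iff i<j$, and a unary relation $U$ true on all elements. A basic structure with parameters $(k,\ell)$ is $\mathbf E\oplus\dots\oplus\mathbf E\oplus\mathbf T_{N_1}\oplus\dots\oplus\mathbf T_{N_k}$ ($\ell$ copies of $\mathbf E$) for some $N_1,\dots,N_k$; $\mathcal B_{k,\ell}$ is the class of these, and $\beta_{k,\ell}$ their signature, with relations $U^E_1,\dots,U^E_\ell$ (marking the copies of $\mathbf E$), $U^T_1,\dots,U^T_k$ (marking the tournaments) and $S_1,\dots,S_k$ (the orders on the tournaments). A basic sequence is a sequence $(\mathbf B_n)$ of structures in $\mathcal B_{k,\ell}$ (fixed $k,\ell$) for which there are non-constant polynomials $Q_1,\dots,Q_k$ with $N_i(\mathbf B_n)=Q_i(n)$ for all $i$ and $n$. -}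

module Defs where

open import Data.Nat using (ℕ; zero; suc; _+_; _*_; _≤_; _<ᵇ_)
open import Data.Bool using (Bool; true; false; _∧_; _∨_; not; if_then_else_)
open import Data.Fin using (Fin; toℕ; splitAt; _≟_)
open import Data.Unit using (⊤; tt)
open import Data.Empty using (⊥)
open import Data.Sum using (_⊎_; inj₁; inj₂)
open import Data.Maybe using (Maybe; just; nothing)
open import Data.Product using (Σ; ∃; _×_; _,_)
open import Data.List as L using (List; []; _∷_; length; concatMap)
open import Data.Bool.ListAction using (any)
open import Data.List.Relation.Unary.Any using (Any)
open import Data.Vec as V using (Vec; []; _∷_; lookup)
open import Data.Integer using (+_)
open import Data.Rational using (ℚ; 0ℚ; _/_)
import Data.Rational as Q
open import Relation.Binary.PropositionalEquality using (_≡_; _≢_)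
open import Relation.Nullary.Decidable using (⌊_⌋)
open import Function.Bundles using (_↔_; Inverse)

record Signature : Set₁ where
  field
    Sym : Set
    ar  : Sym → ℕ
open Signature public

_⊕ˢ_ : Signature → Signature → Signature
σ ⊕ˢ τ = record { Sym = Sym σ ⊎ Sym τ ; ar = ar' }
  where
  ar' : Sym σ ⊎ Sym τ → ℕ
  ar' (inj₁ s) = ar σ s
  ar' (inj₂ s) = ar τ s

record Structure (σ : Signature) : Set where
  field
    size : ℕ
    rel  : (s : Sym σ) → Vec (Fin size) (ar σ s) → Bool
open Structure public

Iso : {σ : Signature} → Structure σ → Structure σ → Set
Iso {σ} A B =
  Σ (Fin (size A) ↔ Fin (size B)) λ f →
    (s : Sym σ) (v : Vec (Fin (size A)) (ar σ s)) →
      rel A s v ≡ rel B s (V.map (Inverse.to f) v)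

-- First-order formulas (with equality); variables x₁…x_m are Fin m,
-- the ∃ binds a new variable at index 0.

data Formula (σ : Signature) : ℕ → Set where
  tru  : ∀ {m} → Formula σ m
  eq   : ∀ {m} → Fin m → Fin m → Formula σ m
  R    : ∀ {m} (s : Sym σ) → Vec (Fin m) (ar σ s) → Formula σ m
  neg  : ∀ {m} → Formula σ m → Formula σ m
  conj : ∀ {m} → Formula σ m → Formula σ m → Formula σ m
  ex   : ∀ {m} → Formula σ (suc m) → Formula σ m

data IsQF {σ : Signature} : ∀ {m} → Formula σ m → Set where
  tru  : ∀ {m} → IsQF (tru {m = m})
  eq   : ∀ {m} (i j : Fin m) → IsQF (eq i j)
  R    : ∀ {m} (s : Sym σ) (v : Vec (Fin m) (ar σ s)) → IsQF (R s v)
  neg  : ∀ {m} {φ : Formula σ m} → IsQF φ → IsQF (neg φ)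
  conj : ∀ {m} {φ ψ : Formula σ m} → IsQF φ → IsQF ψ → IsQF (conj φ ψ)

sat : ∀ {σ m} (A : Structure σ) → Formula σ m → Vec (Fin (size A)) m → Bool
sat A tru        ρ = true
sat A (eq i j)   ρ = ⌊ lookup ρ i ≟ lookup ρ j ⌋
sat A (R s v)    ρ = rel A s (V.map (lookup ρ) v)
sat A (neg φ)    ρ = not (sat A φ ρ)
sat A (conj φ ψ) ρ = sat A φ ρ ∧ sat A ψ ρ
sat A (ex φ)     ρ = any (λ a → sat A φ (a ∷ ρ)) (L.allFin (size A))

tuples : (N p : ℕ) → List (Vec (Fin N) p)
tuples N zero    = [] ∷ []
tuples N (suc p) = concatMap (λ a → L.map (a ∷_) (tuples N p)) (L.allFin N)

filterᵇ : {X : Set} → (X → Bool) → List X → List X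
filterᵇ f []       = []
filterᵇ f (x ∷ xs) = if f x then x ∷ filterᵇ f xs else filterᵇ f xs

solutions : ∀ {σ p} → Formula σ p → (A : Structure σ) → List (Vec (Fin (size A)) p)
solutions {p = p} φ A = filterᵇ (sat A φ) (tuples (size A) p)

count : ∀ {σ p} → Formula σ p → Structure σ → ℕ
count φ A = length (solutions φ A)

-- Polynomials with rational coefficients (coefficient list, constant
-- term first), evaluated at natural numbers.

Poly : Set
Poly = List ℚ

ℕ→ℚ : ℕ → ℚ
ℕ→ℚ n = (+ n) / 1

evalPoly : Poly → ℕ → ℚ
evalPoly P n = L.foldr (λ c acc → c Q.+ ℕ→ℚ n Q.* acc) 0ℚ P

NonConstant : Poly → Set
NonConstant []       = ⊥
NonConstant (_ ∷ cs) = Any (λ c → c ≢ 0ℚ) cs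

IsPolynomial : (ℕ → ℕ) → Set
IsPolynomial f = ∃ λ P → (n : ℕ) → ℕ→ℚ (f n) ≡ evalPoly P n

StronglyPolynomial : {σ : Signature} → (ℕ → Structure σ) → Set
StronglyPolynomial {σ} A =
  (p : ℕ) (φ : Formula σ p) → IsQF φ →
    ∃ λ P → (n : ℕ) → ℕ→ℚ (count φ (A n)) ≡ evalPoly P n

GraphSig : Signature
GraphSig = record { Sym = ⊤ ; ar = λ _ → 2 }

adj : (G : Structure GraphSig) → Fin (size G) → Fin (size G) → Bool
adj G x y = rel G tt (x ∷ y ∷ [])

record Graph : Set where
  field
    str     : Structure GraphSig
    symm    : ∀ x y → adj str x y ≡ adj str y x
    irrefl  : ∀ x → adj str x x ≡ false
open Graph public

degree : (G : Graph) → Fin (size (str G)) → ℕ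
degree G v = length (filterᵇ (adj (str G) v) (L.allFin (size (str G))))

BoundedDegree : (ℕ → Graph) → Set
BoundedDegree A = ∃ λ D → (n : ℕ) (v : Fin (size (str (A n)))) → degree (A n) v ≤ D

_⊎ᴳ_ : Graph → Graph → Graph
G ⊎ᴳ H = record { str = S ; symm = sy ; irrefl = ir }
  where
  m = size (str G)
  k = size (str H)
  a : Fin (m + k) → Fin (m + k) → Bool
  a x y with splitAt m x | splitAt m y
  ... | inj₁ x' | inj₁ y' = adj (str G) x' y'
  ... | inj₂ x' | inj₂ y' = adj (str H) x' y'
  ... | inj₁ _  | inj₂ _  = false
  ... | inj₂ _  | inj₁ _  = false
  S : Structure GraphSig
  S = record { size = m + k ; rel = λ { tt (x ∷ y ∷ []) → a x y } }
  sy : ∀ x y → adj S x y ≡ adj S y x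
  sy x y with splitAt m x | splitAt m y
  ... | inj₁ x' | inj₁ y' = symm G x' y'
  ... | inj₂ x' | inj₂ y' = symm H x' y'
  ... | inj₁ _  | inj₂ _  = Relation.Binary.PropositionalEquality.refl
  ... | inj₂ _  | inj₁ _  = Relation.Binary.PropositionalEquality.refl
  ir : ∀ x → adj S x x ≡ false
  ir x with splitAt m x
  ... | inj₁ x' = irrefl G x'
  ... | inj₂ x' = irrefl H x'

emptyGraph : Graph
emptyGraph = record
  { str = record { size = 0 ; rel = λ { tt (() ∷ _) } }
  ; symm = λ ()
  ; irrefl = λ () }

copies : ℕ → Graph → Graph
copies zero    F = emptyGraph
copies (suc m) F = F ⊎ᴳ copies m F

bigUnion : (k : ℕ) → (Fin k → Graph) → Graph
bigUnion zero    G = emptyGraph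
bigUnion (suc k) G = G Fin.zero ⊎ᴳ bigUnion k (λ i → G (Fin.suc i))
  where import Data.Fin as Fin

_⊕_ : {σ τ : Signature} → Structure σ → Structure τ → Structure (σ ⊕ˢ τ)
_⊕_ {σ} {τ} A B = record { size = size A + size B ; rel = r }
  where
  left : ∀ {r} → Vec (Fin (size A + size B)) r → Maybe (Vec (Fin (size A)) r)
  left [] = just []
  left (x ∷ xs) with splitAt (size A) x | left xs
  ... | inj₁ x' | just xs' = just (x' ∷ xs')
  ... | _       | _        = nothing
  right : ∀ {r} → Vec (Fin (size A + size B)) r → Maybe (Vec (Fin (size B)) r)
  right [] = just []
  right (x ∷ xs) with splitAt (size A) x | right xs
  ... | inj₂ x' | just xs' = just (x' ∷ xs')
  ... | _       | _        = nothing
  r : (s : Sym (σ ⊕ˢ τ)) → Vec (Fin (size A + size B)) (ar (σ ⊕ˢ τ) s) → Bool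
  r (inj₁ s) v with left v
  ... | just v' = rel A s v'
  ... | nothing = false
  r (inj₂ s) v with right v
  ... | just v' = rel B s v'
  ... | nothing = false

-- empty signature / empty structure (unit for ⊕, used to end the iterated sums)
∅Sig : Signature
∅Sig = record { Sym = ⊥ ; ar = λ () }

∅Str : Structure ∅Sig
∅Str = record { size = 0 ; rel = λ () }

ESig : Signature
ESig = record { Sym = ⊤ ; ar = λ _ → 1 }

E : Structure ESig
E = record { size = 1 ; rel = λ _ _ → true }

data TSym : Set where
  U S : TSym

TSig : Signature
TSig = record { Sym = TSym ; ar = λ { U → 1 ; S → 2 } }

T : ℕ → Structure TSig
T N = record { size = N ; rel = r }
  where
  r : (s : TSym) → Vec (Fin N) (ar TSig s) → Bool
  r U _ = true
  r S (i ∷ j ∷ []) = toℕ i <ᵇ toℕ j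

βT : ℕ → Signature
βT zero    = ∅Sig
βT (suc k) = TSig ⊕ˢ βT k

β : ℕ → ℕ → Signature
β k zero    = βT k
β k (suc ℓ) = ESig ⊕ˢ β k ℓ

basicT : (k : ℕ) → (Fin k → ℕ) → Structure (βT k)
basicT zero    N = ∅Str
basicT (suc k) N = T (N Fin.zero) ⊕ basicT k (λ i → N (Fin.suc i))
  where import Data.Fin as Fin

basic : (k ℓ : ℕ) → (Fin k → ℕ) → Structure (β k ℓ)
basic k zero    N = basicT k N
basic k (suc ℓ) N = E ⊕ basic k ℓ N

-- a basic sequence in B_{k,ℓ}: the n-th structure is basic k ℓ (λ i → N i n)
-- where each N i is a non-constant polynomial
IsBasicSizes : (k : ℕ) → (Fin k → ℕ → ℕ) → Set
IsBasicSizes k N =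
  (i : Fin k) → ∃ λ Q → NonConstant Q × ((n : ℕ) → ℕ→ℚ (N i n) ≡ evalPoly Q n)

record InterpretationScheme (κ λ' : Signature) (p : ℕ) : Set where
  field
    ρ₀ : Formula κ p
    ρ  : (s : Sym λ') → Formula κ (ar λ' s * p)
open InterpretationScheme public

IsQFScheme : ∀ {κ λ' p} → InterpretationScheme κ λ' p → Set
IsQFScheme {λ' = λ'} I = IsQF (ρ₀ I) × ((s : Sym λ') → IsQF (ρ I s))

-- I(A): domain ρ₀(A) ⊆ A^p (enumerated in lexicographic order)
interpret : ∀ {κ λ' p} → InterpretationScheme κ λ' p → Structure κ → Structure λ'
interpret {κ} {λ'} {p} I A = record { size = length D ; rel = r }
  where
  D = solutions (ρ₀ I) A
  r : (s : Sym λ') → Vec (Fin (length D)) (ar λ' s) → Bool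
  r s v = sat A (ρ I s) (V.concat (V.map (L.lookup D) v))

Condition2 : (ℕ → Graph) → Set
Condition2 A =
  ∃ λ k → Σ (Fin k → Graph) λ F → Σ (Fin k → ℕ → ℕ) λ c →
    ((i : Fin k) → IsPolynomial (c i)) ×
    ((n : ℕ) → Iso (str (A n)) (str (bigUnion k (λ i → copies (c i n) (F i)))))

Condition3 : (ℕ → Graph) → Set
Condition3 A =
  ∃ λ k → ∃ λ ℓ → Σ (Fin k → ℕ → ℕ) λ N → IsBasicSizes k N ×
    (∃ λ p → Σ (InterpretationScheme (β k ℓ) GraphSig p) λ I → IsQFScheme I ×
      ((n : ℕ) → Iso (str (A n)) (interpret I (basic k ℓ (λ i → N i n)))))

{-# OPTIONS --safe #-}
module Submission where

-- (1)⇒(2).  In a graph of degree at most D a connected pattern has O(|A|) embeddings, so the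
-- number of its embeddings in Aₙ is a polynomial in n of degree at most that of |Aₙ|; if it
-- vanishes for the first few n, it vanishes identically.  Hence all connected induced
-- subgraphs of all the Aₙ already occur in finitely many of them, so there are only finitely
-- many types of components.  The embedding numbers of these types determine their
-- multiplicities by a linear system which is triangular with respect to size.
--
-- (2)⇒(3).  The vertex v of the t-th copy of Fᵢ is coded by a triple (eᵢ , t , eᵥ), where eᵢ and
-- eᵥ are copies of E and t lies in the i-th tournament, or again among the copies of E when the
-- multiplicity of Fᵢ is constant.
--
-- (3)⇒(1).  Quantifier-free interpretations pull quantifier-free formulas back.  On a strong sum
-- one sums over the sets of coordinates lying in the left summand.  On T N, splitting off the
-- least element expresses the increment in N by formulas with fewer variables, so that counts
-- are combinations of binomial coefficients in N.

open import Defs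
import Data.Nat as ℕ
open import Data.Nat using (ℕ; zero; suc; _+_; _*_; _∸_; _^_; _≤_; _<_; z≤n; s≤s)
import Data.Nat.Properties as ℕₚ
open import Data.Integer as ℤ using (ℤ)
import Data.Integer.Properties as ℤₚ
open import Data.Rational as ℚ using (ℚ; 0ℚ; 1ℚ; _/_; toℚᵘ)
import Data.Rational.Properties as ℚₚ
open import Data.Rational.Unnormalised as ℚᵘ using (mkℚᵘ; *≡*)
import Data.Rational.Unnormalised.Properties as ℚᵘₚ
open import Data.Rational.Solver using (module +-*-Solver)
open import Data.Bool using (Bool; true; false; _∧_; not; if_then_else_)
import Data.Bool.Properties as 𝔹
open import Data.List as L using (List; []; _∷_; length; concatMap)
open import Data.List.Relation.Unary.Any as Any using (Any; here; there)
import Data.List.Relation.Unary.Any.Properties as Anyₚ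
open import Data.List.Membership.Propositional.Properties using (∈-allFin; ∈-upTo⁺)
open import Data.Vec as V using (Vec; []; _∷_; lookup)
import Data.Vec.Properties as Vₚ
open import Data.Maybe as Maybe using (Maybe; just; nothing)
open import Data.Product using (∃; _×_; _,_; proj₁; proj₂; Σ-syntax)
open import Data.Sum as Sum using (_⊎_; inj₁; inj₂; [_,_])
open import Data.Unit using (⊤; tt)
open import Data.Empty using (⊥; ⊥-elim)
open import Data.Fin as Fin using (Fin; zero; suc; _↑ˡ_; _↑ʳ_; splitAt; join; combine; remQuot; toℕ)
import Data.Fin.Properties as Finₚ
open import Data.Fin.Permutation using (↔⇒≡)
open import Relation.Nullary using (¬_; Dec; yes; no; ¬?; contradiction)
open import Relation.Nullary.Decidable using (⌊_⌋; ⌊⌋-map′; _×-dec_)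
open import Relation.Binary.PropositionalEquality hiding ([_])
open import Function using (_∘_; _$_; id; case_of_)
open import Function.Bundles using (_↔_; _⇔_; Inverse; mk↔ₛ′; mk⇔)
open import Algebra.Properties.Semiring.Sum ℕₚ.+-*-semiring
  using (sum; sum-cong-≗; ∑-distrib-+; ∑-comm; sum-permute; *-distribˡ-sum; sum-replicate-zero)
open import Data.Nat.Tactic.RingSolver using (solve-∀)
open import Data.Integer.Tactic.RingSolver using () renaming (solve-∀ to ℤ-solve-∀)
open import Tactic.Cong using (cong!)
open ≡-Reasoning

-- Polynomial functions

-- Being a component is not a quantifier-free property of a tuple, whereas spanning an induced copy
-- of a fixed graph is; hence embeddings are counted, and components are reached only through them.
-- The finiteness argument needs a bound that is uniform over infinitely many patterns. The constant
-- in the estimate O(|Aₙ|) does depend on the pattern, but the number of zeros that force an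
-- embedding number to vanish identically depends only on the polynomial for |Aₙ|, so the same
-- initial segment of the sequence serves for all patterns. Connectedness enters twice: it keeps the
-- count linear in |Aₙ|, and it makes embedding numbers additive over disjoint unions, since a
-- connected pattern cannot meet both summands. The multiplicities found for each n separately are
-- thus tied to polynomials by linear equations; an embedding between graphs of the same size is an
-- isomorphism, which makes the system triangular with non-zero diagonal.

ℤ→ℚ : ℤ → ℚ
ℤ→ℚ i = i / 1

-- `_/_` divides by a gcd, which does not compute on variables. Identities are therefore checked on
-- unnormalised rationals, where they become integer arithmetic with denominator 1.
toℚᵘ-ℤ→ℚ : ∀ i → toℚᵘ (ℤ→ℚ i) ℚᵘ.≃ mkℚᵘ i 0
toℚᵘ-ℤ→ℚ i = ℚₚ.toℚᵘ-fromℚᵘ (mkℚᵘ i 0)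

ℤ→ℚ-+ : ∀ i j → ℤ→ℚ (i ℤ.+ j) ≡ ℤ→ℚ i ℚ.+ ℤ→ℚ j
ℤ→ℚ-+ i j = ℚₚ.toℚᵘ-injective (ℚᵘₚ.≃-trans (toℚᵘ-ℤ→ℚ (i ℤ.+ j)) (ℚᵘₚ.≃-trans
  (*≡* (cong (ℤ._* ℤ.+ 1) (sym (cong₂ ℤ._+_ (ℤₚ.*-identityʳ i) (ℤₚ.*-identityʳ j)))))
  (ℚᵘₚ.≃-sym (ℚᵘₚ.≃-trans (ℚₚ.toℚᵘ-homo-+ (ℤ→ℚ i) (ℤ→ℚ j))
    (ℚᵘₚ.+-cong (toℚᵘ-ℤ→ℚ i) (toℚᵘ-ℤ→ℚ j))))))

ℤ→ℚ-* : ∀ i j → ℤ→ℚ (i ℤ.* j) ≡ ℤ→ℚ i ℚ.* ℤ→ℚ j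
ℤ→ℚ-* i j = ℚₚ.toℚᵘ-injective (ℚᵘₚ.≃-trans (toℚᵘ-ℤ→ℚ (i ℤ.* j)) (ℚᵘₚ.≃-sym
  (ℚᵘₚ.≃-trans (ℚₚ.toℚᵘ-homo-* (ℤ→ℚ i) (ℤ→ℚ j)) (ℚᵘₚ.*-cong (toℚᵘ-ℤ→ℚ i) (toℚᵘ-ℤ→ℚ j)))))

ℤ→ℚ-injective : ∀ {i j} → ℤ→ℚ i ≡ ℤ→ℚ j → i ≡ j
ℤ→ℚ-injective {i} {j} e with ℚₚ.fromℚᵘ-injective {mkℚᵘ i 0} {mkℚᵘ j 0} e
... | *≡* p = ℤₚ.*-cancelʳ-≡ i j (ℤ.+ 1) p

ℕ→ℚ-+ : ∀ m n → ℕ→ℚ (m + n) ≡ ℕ→ℚ m ℚ.+ ℕ→ℚ n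
ℕ→ℚ-+ m n = ℤ→ℚ-+ (ℤ.+ m) (ℤ.+ n)

ℕ→ℚ-* : ∀ m n → ℕ→ℚ (m * n) ≡ ℕ→ℚ m ℚ.* ℕ→ℚ n
ℕ→ℚ-* m n = trans (cong ℤ→ℚ (ℤₚ.pos-* m n)) (ℤ→ℚ-* (ℤ.+ m) (ℤ.+ n))

ℕ→ℚ-injective : ∀ {m n} → ℕ→ℚ m ≡ ℕ→ℚ n → m ≡ n
ℕ→ℚ-injective e = ℤₚ.+-injective (ℤ→ℚ-injective e)

addPoly : Poly → Poly → Poly
addPoly []      Q       = Q
addPoly (a ∷ P) []      = a ∷ P
addPoly (a ∷ P) (b ∷ Q) = (a ℚ.+ b) ∷ addPoly P Q

scalePoly : ℚ → Poly → Poly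
scalePoly c = L.map (c ℚ.*_)

mulPoly : Poly → Poly → Poly
mulPoly []      Q = []
mulPoly (a ∷ P) Q = addPoly (scalePoly a Q) (0ℚ ∷ mulPoly P Q)

open +-*-Solver using (solve; con; _:=_; _:+_; _:*_)

evalPoly-add : ∀ P Q n → evalPoly (addPoly P Q) n ≡ evalPoly P n ℚ.+ evalPoly Q n
evalPoly-add []      Q       n = sym (ℚₚ.+-identityˡ _)
evalPoly-add (a ∷ P) []      n = sym (ℚₚ.+-identityʳ _)
evalPoly-add (a ∷ P) (b ∷ Q) n rewrite evalPoly-add P Q n =
  solve 5 (λ a b x p q → (a :+ b) :+ x :* (p :+ q) := (a :+ x :* p) :+ (b :+ x :* q)) refl
    a b (ℕ→ℚ n) (evalPoly P n) (evalPoly Q n)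

evalPoly-scale : ∀ c P n → evalPoly (scalePoly c P) n ≡ c ℚ.* evalPoly P n
evalPoly-scale c []      n = sym (ℚₚ.*-zeroʳ c)
evalPoly-scale c (a ∷ P) n rewrite evalPoly-scale c P n =
  solve 4 (λ c a x p → c :* a :+ x :* (c :* p) := c :* (a :+ x :* p)) refl c a (ℕ→ℚ n) (evalPoly P n)

evalPoly-mul : ∀ P Q n → evalPoly (mulPoly P Q) n ≡ evalPoly P n ℚ.* evalPoly Q n
evalPoly-mul []      Q n = sym (ℚₚ.*-zeroˡ (evalPoly Q n))
evalPoly-mul (a ∷ P) Q n
  rewrite evalPoly-add (scalePoly a Q) (0ℚ ∷ mulPoly P Q) n | evalPoly-scale a Q n | evalPoly-mul P Q n =
  solve 4 (λ a q x p → a :* q :+ (con 0ℚ :+ x :* (p :* q)) := (a :+ x :* p) :* q) refl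
    a (evalPoly Q n) (ℕ→ℚ n) (evalPoly P n)

-- Agda does not recover f from the unfolding of IsPolynomial f, hence the wrapper.
record Pol (f : ℕ → ℕ) : Set where
  constructor pol
  field isPolynomial : IsPolynomial f
open Pol public

poly-cong : ∀ {f g} → (∀ n → f n ≡ g n) → Pol f → Pol g
poly-cong f≗g (pol (P , e)) = pol $ P , λ n → trans (cong ℕ→ℚ (sym (f≗g n))) (e n)

poly-const : ∀ c → Pol (λ _ → c)
poly-const c = pol $ ℕ→ℚ c ∷ [] , λ n → solve 2 (λ c x → c := c :+ x :* con 0ℚ) refl (ℕ→ℚ c) (ℕ→ℚ n)

varPoly : Poly
varPoly = 0ℚ ∷ 1ℚ ∷ []

evalPoly-var : ∀ n → ℕ→ℚ n ≡ evalPoly varPoly n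
evalPoly-var n = solve 1 (λ x → x := con 0ℚ :+ x :* (con 1ℚ :+ x :* con 0ℚ)) refl (ℕ→ℚ n)

poly-+ : ∀ {f g} → Pol f → Pol g → Pol (λ n → f n + g n)
poly-+ {f} {g} (pol (P , p)) (pol (Q , q)) = pol $ addPoly P Q ,
  λ n → trans (ℕ→ℚ-+ (f n) (g n)) (trans (cong₂ ℚ._+_ (p n) (q n)) (sym (evalPoly-add P Q n)))

poly-* : ∀ {f g} → Pol f → Pol g → Pol (λ n → f n * g n)
poly-* {f} {g} (pol (P , p)) (pol (Q , q)) = pol $ mulPoly P Q ,
  λ n → trans (ℕ→ℚ-* (f n) (g n)) (trans (cong₂ ℚ._*_ (p n) (q n)) (sym (evalPoly-mul P Q n)))

-- Counts are natural numbers, so a difference is presented as the missing summand of a sum.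
poly-difference : ∀ {f g h} → (∀ n → f n ≡ g n + h n) → Pol f → Pol g → Pol h
poly-difference {f} {g} {h} e (pol (P , p)) (pol (Q , q)) = pol $ addPoly P (scalePoly (ℚ.- 1ℚ) Q) , λ n → begin
  ℕ→ℚ (h n)
    ≡⟨ solve 2 (λ g h → h := (g :+ h) :+ con (ℚ.- 1ℚ) :* g) refl (ℕ→ℚ (g n)) (ℕ→ℚ (h n)) ⟩
  (ℕ→ℚ (g n) ℚ.+ ℕ→ℚ (h n)) ℚ.+ ℚ.- 1ℚ ℚ.* ℕ→ℚ (g n)
    ≡⟨ cong₂ (λ a b → a ℚ.+ ℚ.- 1ℚ ℚ.* b)
         (trans (sym (ℕ→ℚ-+ (g n) (h n))) (trans (cong ℕ→ℚ (sym (e n))) (p n))) (q n) ⟩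
  evalPoly P n ℚ.+ ℚ.- 1ℚ ℚ.* evalPoly Q n
    ≡⟨ cong (evalPoly P n ℚ.+_) (sym (evalPoly-scale (ℚ.- 1ℚ) Q n)) ⟩
  evalPoly P n ℚ.+ evalPoly (scalePoly (ℚ.- 1ℚ) Q) n
    ≡⟨ sym (evalPoly-add P _ n) ⟩
  evalPoly (addPoly P (scalePoly (ℚ.- 1ℚ) Q)) n ∎

ℕ→ℚ-suc≢0 : ∀ k → ℕ→ℚ (suc k) ≢ 0ℚ
ℕ→ℚ-suc≢0 k e with ℕ→ℚ-injective {suc k} {0} e
... | ()

-- This is where rational coefficients arise: in binomial coefficients, and in solving for the
-- multiplicities of the components.
poly-÷ : ∀ {f} k → Pol (λ n → suc k * f n) → Pol f
poly-÷ {f} k (pol (P , p)) = pol $ scalePoly c P , λ n → begin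
  ℕ→ℚ (f n)                           ≡⟨ sym (ℚₚ.*-identityˡ _) ⟩
  1ℚ ℚ.* ℕ→ℚ (f n)                    ≡⟨ cong (ℚ._* ℕ→ℚ (f n)) (sym (ℚₚ.*-inverseˡ (ℕ→ℚ (suc k)))) ⟩
  (c ℚ.* ℕ→ℚ (suc k)) ℚ.* ℕ→ℚ (f n)   ≡⟨ ℚₚ.*-assoc c _ _ ⟩
  c ℚ.* (ℕ→ℚ (suc k) ℚ.* ℕ→ℚ (f n))   ≡⟨ cong (c ℚ.*_) (trans (sym (ℕ→ℚ-* (suc k) (f n))) (p n)) ⟩
  c ℚ.* evalPoly P n                  ≡⟨ sym (evalPoly-scale c P n) ⟩
  evalPoly (scalePoly c P) n          ∎
  where
  instance
    k≢0 : ℚ.NonZero (ℕ→ℚ (suc k))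
    k≢0 = ℚ.≢-nonZero (ℕ→ℚ-suc≢0 k)
  c = ℚ.1/ (ℕ→ℚ (suc k))

poly-sum : ∀ {k} (f : Fin k → ℕ → ℕ) → (∀ i → Pol (f i)) → Pol (λ n → sum (λ i → f i n))
poly-sum {zero}  f p = poly-const 0
poly-sum {suc k} f p = poly-+ (p zero) (poly-sum (f ∘ suc) (p ∘ suc))

evalPoly-zeros : ∀ P → ¬ Any (_≢ 0ℚ) P → ∀ n → evalPoly P n ≡ 0ℚ
evalPoly-zeros []      _ n = refl
evalPoly-zeros (a ∷ P) z n with a ℚ.≟ 0ℚ
... | no a≢0 with () ← z (here a≢0)
... | yes refl rewrite evalPoly-zeros P (z ∘ there) n =
  solve 1 (λ x → con 0ℚ :+ x :* con 0ℚ := con 0ℚ) refl (ℕ→ℚ n)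

-- Condition (2) admits constant multiplicities, but the tournaments of a basic sequence must have
-- non-constant sizes. If no higher coefficient is non-zero, the value is the constant term.
constant-or-nonconstant : ∀ {f} → Pol f →
  (Σ[ Q ∈ Poly ] NonConstant Q × (∀ n → ℕ→ℚ (f n) ≡ evalPoly Q n)) ⊎ (∀ n → f n ≡ f 0)
constant-or-nonconstant {f} (pol ([] , e)) = inj₂ λ n → ℕ→ℚ-injective {f n} {f 0} (trans (e n) (sym (e 0)))
constant-or-nonconstant {f} (pol (c ∷ P , e)) with Any.any? (λ a → ¬? (a ℚ.≟ 0ℚ)) P
... | yes nz = inj₁ (c ∷ P , nz , e)
... | no  z  = inj₂ λ n → ℕ→ℚ-injective {f n} {f 0} (trans (value n) (sym (value 0)))
  where
  value : ∀ n → ℕ→ℚ (f n) ≡ c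
  value n = trans (e n) (trans (cong (λ y → c ℚ.+ ℕ→ℚ n ℚ.* y) (evalPoly-zeros P z n))
    (solve 2 (λ c x → c :+ x :* con 0ℚ := c) refl c (ℕ→ℚ n)))

-- Counting by iterated sums

⟦_⟧ : Bool → ℕ
⟦ b ⟧ = if b then 1 else 0

⟦∧⟧ : ∀ a b → ⟦ a ∧ b ⟧ ≡ ⟦ a ⟧ * ⟦ b ⟧
⟦∧⟧ true  b = sym (ℕₚ.+-identityʳ ⟦ b ⟧)
⟦∧⟧ false b = refl

⟦true⟧ : ∀ {b} → b ≡ true → ⟦ b ⟧ ≡ 1
⟦true⟧ refl = refl

sum-zero : ∀ {n} (f : Fin n → ℕ) → (∀ i → f i ≡ 0) → sum f ≡ 0
sum-zero {n} f z = trans (sum-cong-≗ z) (sum-replicate-zero n)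

sum-mono : ∀ {n} {f g : Fin n → ℕ} → (∀ i → f i ≤ g i) → sum f ≤ sum g
sum-mono {zero}  f≤g = z≤n
sum-mono {suc n} f≤g = ℕₚ.+-mono-≤ (f≤g zero) (sum-mono (f≤g ∘ suc))

sum-const : ∀ n c → sum {n} (λ _ → c) ≡ n * c
sum-const zero    c = refl
sum-const (suc n) c = cong (c +_) (sum-const n c)

term≤sum : ∀ {n} (f : Fin n → ℕ) i → f i ≤ sum f
term≤sum f zero    = ℕₚ.m≤m+n _ _
term≤sum f (suc i) = ℕₚ.≤-trans (term≤sum (f ∘ suc) i) (ℕₚ.m≤n+m _ (f zero))

sum-positive : ∀ {n} (f : Fin n → ℕ) → sum f ≢ 0 → ∃ λ i → f i ≢ 0
sum-positive {zero}  f ≢0 = contradiction refl ≢0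
sum-positive {suc n} f ≢0 with f zero ℕ.≟ 0
... | no f₀≢0 = zero , f₀≢0
... | yes f₀≡0 with i , p ← sum-positive (f ∘ suc) (λ e → ≢0 (cong₂ _+_ f₀≡0 e)) = suc i , p

sum-split : ∀ m n (f : Fin (m + n) → ℕ) → sum f ≡ sum (λ i → f (i ↑ˡ n)) + sum (λ j → f (m ↑ʳ j))
sum-split zero    n f = refl
sum-split (suc m) n f = trans (cong (f zero +_) (sum-split m n (f ∘ suc))) (sym (ℕₚ.+-assoc (f zero) _ _))

sumᵛ : ∀ N p → (Vec (Fin N) p → ℕ) → ℕ
sumᵛ N zero    f = f []
sumᵛ N (suc p) f = sum {N} λ a → sumᵛ N p (f ∘ (a ∷_))

sumᵛ-cong : ∀ N p {f g : Vec (Fin N) p → ℕ} → (∀ v → f v ≡ g v) → sumᵛ N p f ≡ sumᵛ N p g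
sumᵛ-cong N zero    e = e []
sumᵛ-cong N (suc p) e = sum-cong-≗ λ a → sumᵛ-cong N p (e ∘ (a ∷_))

sumᵛ-mono : ∀ N p {f g : Vec (Fin N) p → ℕ} → (∀ v → f v ≤ g v) → sumᵛ N p f ≤ sumᵛ N p g
sumᵛ-mono N zero    e = e []
sumᵛ-mono N (suc p) e = sum-mono λ a → sumᵛ-mono N p (e ∘ (a ∷_))

sumᵛ-zero : ∀ N p (f : Vec (Fin N) p → ℕ) → (∀ v → f v ≡ 0) → sumᵛ N p f ≡ 0
sumᵛ-zero N zero    f z = z []
sumᵛ-zero N (suc p) f z = sum-zero _ λ a → sumᵛ-zero N p _ (z ∘ (a ∷_))

sumᵛ-+ : ∀ N p (f g : Vec (Fin N) p → ℕ) → sumᵛ N p (λ v → f v + g v) ≡ sumᵛ N p f + sumᵛ N p g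
sumᵛ-+ N zero    f g = refl
sumᵛ-+ N (suc p) f g = trans (sum-cong-≗ λ a → sumᵛ-+ N p (f ∘ (a ∷_)) (g ∘ (a ∷_))) (∑-distrib-+ {N} _ _)

sumᵛ-*ˡ : ∀ N p c (f : Vec (Fin N) p → ℕ) → sumᵛ N p (λ v → c * f v) ≡ c * sumᵛ N p f
sumᵛ-*ˡ N zero    c f = refl
sumᵛ-*ˡ N (suc p) c f = trans (sum-cong-≗ λ a → sumᵛ-*ˡ N p c (f ∘ (a ∷_))) (sym (*-distribˡ-sum {N} c _))

sumᵛ-*ʳ : ∀ N p c (f : Vec (Fin N) p → ℕ) → sumᵛ N p (λ v → f v * c) ≡ sumᵛ N p f * c
sumᵛ-*ʳ N p c f = trans (sumᵛ-cong N p (λ v → ℕₚ.*-comm (f v) c)) (trans (sumᵛ-*ˡ N p c f) (ℕₚ.*-comm c _))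

sumᵛ-∑ : ∀ {M} N p (f : Fin M → Vec (Fin N) p → ℕ) →
  sum (λ i → sumᵛ N p (f i)) ≡ sumᵛ N p (λ v → sum (λ i → f i v))
sumᵛ-∑         N zero    f = refl
sumᵛ-∑ {M} N (suc p) f = trans (∑-comm {M} {N} (λ i a → sumᵛ N p (f i ∘ (a ∷_))))
  (sum-cong-≗ λ a → sumᵛ-∑ N p (λ i → f i ∘ (a ∷_)))

sumᵛ-++ : ∀ N p q (f : Vec (Fin N) (p + q) → ℕ) →
  sumᵛ N (p + q) f ≡ sumᵛ N p (λ v → sumᵛ N q (λ w → f (v V.++ w)))
sumᵛ-++ N zero    q f = refl
sumᵛ-++ N (suc p) q f = sum-cong-≗ λ a → sumᵛ-++ N p q (f ∘ (a ∷_))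

term≤sumᵛ : ∀ N p (f : Vec (Fin N) p → ℕ) v → f v ≤ sumᵛ N p f
term≤sumᵛ N zero    f []      = ℕₚ.≤-refl
term≤sumᵛ N (suc p) f (a ∷ v) =
  ℕₚ.≤-trans (term≤sumᵛ N p (f ∘ (a ∷_)) v) (term≤sum (λ b → sumᵛ N p (f ∘ (b ∷_))) a)

sumᵛ-positive : ∀ N p (f : Vec (Fin N) p → ℕ) → sumᵛ N p f ≢ 0 → ∃ λ v → f v ≢ 0
sumᵛ-positive N zero    f ≢0 = [] , ≢0
sumᵛ-positive N (suc p) f ≢0 with a , ≢0′ ← sum-positive _ ≢0 with v , q ← sumᵛ-positive N p _ ≢0′ = a ∷ v , q

sumᵛ-permute : ∀ {M N} (π : Fin M ↔ Fin N) p (f : Vec (Fin N) p → ℕ) →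
  sumᵛ N p f ≡ sumᵛ M p (f ∘ V.map (Inverse.to π))
sumᵛ-permute π zero    f = refl
sumᵛ-permute π (suc p) f = trans (sum-permute _ π) (sum-cong-≗ λ a → sumᵛ-permute π p (f ∘ (Inverse.to π a ∷_)))

sumˡ : ∀ {X : Set} → (X → ℕ) → List X → ℕ
sumˡ f []       = 0
sumˡ f (x ∷ xs) = f x + sumˡ f xs

sumˡ-++ : ∀ {X : Set} (f : X → ℕ) xs ys → sumˡ f (xs L.++ ys) ≡ sumˡ f xs + sumˡ f ys
sumˡ-++ f []       ys = refl
sumˡ-++ f (x ∷ xs) ys = trans (cong (f x +_) (sumˡ-++ f xs ys)) (sym (ℕₚ.+-assoc (f x) _ _))

sumˡ-map : ∀ {X Y : Set} (f : Y → ℕ) (g : X → Y) xs → sumˡ f (L.map g xs) ≡ sumˡ (f ∘ g) xs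
sumˡ-map f g []       = refl
sumˡ-map f g (x ∷ xs) = cong (f (g x) +_) (sumˡ-map f g xs)

sumˡ-concatMap : ∀ {X Y : Set} (f : Y → ℕ) (g : X → List Y) xs →
  sumˡ f (concatMap g xs) ≡ sumˡ (sumˡ f ∘ g) xs
sumˡ-concatMap f g []       = refl
sumˡ-concatMap f g (x ∷ xs) =
  trans (sumˡ-++ f (g x) (concatMap g xs)) (cong (sumˡ f (g x) +_) (sumˡ-concatMap f g xs))

sumˡ-tabulate : ∀ {X : Set} (f : X → ℕ) n (g : Fin n → X) → sumˡ f (L.tabulate g) ≡ sum (f ∘ g)
sumˡ-tabulate f zero    g = refl
sumˡ-tabulate f (suc n) g = cong (f (g zero) +_) (sumˡ-tabulate f n (g ∘ suc))

sumˡ-filterᵇ : ∀ {X : Set} (f : X → ℕ) (b : X → Bool) xs →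
  sumˡ f (filterᵇ b xs) ≡ sumˡ (λ x → ⟦ b x ⟧ * f x) xs
sumˡ-filterᵇ f b []       = refl
sumˡ-filterᵇ f b (x ∷ xs) with b x
... | true  = cong₂ _+_ (sym (ℕₚ.*-identityˡ (f x))) (sumˡ-filterᵇ f b xs)
... | false = sumˡ-filterᵇ f b xs

sumˡ-lookup : ∀ {X : Set} (f : X → ℕ) xs → sum (λ i → f (L.lookup xs i)) ≡ sumˡ f xs
sumˡ-lookup f []       = refl
sumˡ-lookup f (x ∷ xs) = cong (f x +_) (sumˡ-lookup f xs)

sumˡ-tuples : ∀ N p (f : Vec (Fin N) p → ℕ) → sumˡ f (tuples N p) ≡ sumᵛ N p f
sumˡ-tuples N zero    f = ℕₚ.+-identityʳ (f [])
sumˡ-tuples N (suc p) f = begin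
  sumˡ f (concatMap (λ a → L.map (a ∷_) (tuples N p)) (L.allFin N))
    ≡⟨ sumˡ-concatMap f _ (L.allFin N) ⟩
  sumˡ (λ a → sumˡ f (L.map (a ∷_) (tuples N p))) (L.allFin N)
    ≡⟨ sumˡ-tabulate _ N id ⟩
  sum (λ a → sumˡ f (L.map (a ∷_) (tuples N p)))
    ≡⟨ sum-cong-≗ (λ a → trans (sumˡ-map f (a ∷_) (tuples N p)) (sumˡ-tuples N p (f ∘ (a ∷_)))) ⟩
  sumᵛ N (suc p) f ∎

sumˡ-length : ∀ {X : Set} (xs : List X) → length xs ≡ sumˡ (λ _ → 1) xs
sumˡ-length []       = refl
sumˡ-length (x ∷ xs) = cong suc (sumˡ-length xs)

#sat : ∀ {σ p} → Formula σ p → Structure σ → ℕ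
#sat {p = p} φ A = sumᵛ (size A) p (λ v → ⟦ sat A φ v ⟧)

sum-solutions : ∀ {σ p} (φ : Formula σ p) A (f : Vec (Fin (size A)) p → ℕ) →
  sum (λ i → f (L.lookup (solutions φ A) i)) ≡ sumᵛ (size A) p (λ v → ⟦ sat A φ v ⟧ * f v)
sum-solutions {p = p} φ A f = trans (sumˡ-lookup f (solutions φ A))
  (trans (sumˡ-filterᵇ f (sat A φ) (tuples (size A) p)) (sumˡ-tuples (size A) p _))

count≡#sat : ∀ {σ p} (φ : Formula σ p) A → count φ A ≡ #sat φ A
count≡#sat {p = p} φ A = begin
  length (solutions φ A)                             ≡⟨ sumˡ-length (solutions φ A) ⟩
  sumˡ (λ _ → 1) (solutions φ A)                     ≡⟨ sumˡ-filterᵇ (λ _ → 1) (sat A φ) (tuples (size A) p) ⟩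
  sumˡ (λ v → ⟦ sat A φ v ⟧ * 1) (tuples (size A) p) ≡⟨ sumˡ-tuples (size A) p _ ⟩
  sumᵛ (size A) p (λ v → ⟦ sat A φ v ⟧ * 1)          ≡⟨ sumᵛ-cong (size A) p (λ v → ℕₚ.*-identityʳ _) ⟩
  #sat φ A                                           ∎

-- Strong polynomiality in terms of iterated sums, which can be split, permuted and interchanged
-- more easily than filtered lists.
StrongPol : {σ : Signature} → (ℕ → Structure σ) → Set
StrongPol {σ} A = ∀ {p} {φ : Formula σ p} → IsQF φ → Pol (λ n → #sat φ (A n))

fromStrongPol : ∀ {σ} {A : ℕ → Structure σ} → StrongPol A → StronglyPolynomial A
fromStrongPol {A = A} P p φ q = isPolynomial (poly-cong (λ n → sym (count≡#sat φ (A n))) (P q))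

toStrongPol : ∀ {σ} {A : ℕ → Structure σ} → StronglyPolynomial A → StrongPol A
toStrongPol {A = A} P {p} {φ} q = poly-cong (λ n → count≡#sat φ (A n)) (pol (P p φ q))

↔-injective : ∀ {X Y : Set} (π : X ↔ Y) {x y} → Inverse.to π x ≡ Inverse.to π y → x ≡ y
↔-injective π {x} {y} e =
  trans (sym (Inverse.strictlyInverseʳ π x)) (trans (cong (Inverse.from π) e) (Inverse.strictlyInverseʳ π y))

-- A quantifier-free formula speaks only of the values of its variables, and injectivity preserves
-- equality in both directions. The lemma serves isomorphisms as well as inclusions of summands.
sat-embedding : ∀ {σ m} {φ : Formula σ m} (A B : Structure σ) (h : Fin (size A) → Fin (size B)) →
  (∀ {x y} → h x ≡ h y → x ≡ y) → (∀ s v → rel A s v ≡ rel B s (V.map h v)) →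
  IsQF φ → ∀ ρ → sat A φ ρ ≡ sat B φ (V.map h ρ)
sat-embedding A B h inj pres tru ρ = refl
sat-embedding A B h inj pres (eq i j) ρ
  rewrite Vₚ.lookup-map i h ρ | Vₚ.lookup-map j h ρ
  with lookup ρ i Fin.≟ lookup ρ j | h (lookup ρ i) Fin.≟ h (lookup ρ j)
... | yes p | yes q = refl
... | no ¬p | no ¬q = refl
... | yes p | no ¬q = contradiction (cong h p) ¬q
... | no ¬p | yes q = contradiction (inj q) ¬p
sat-embedding A B h inj pres (R s v) ρ = trans (pres s _) (cong (rel B s)
  (trans (sym (Vₚ.map-∘ _ _ v)) (Vₚ.map-cong (λ i → sym (Vₚ.lookup-map i h ρ)) v)))
sat-embedding A B h inj pres (neg q)    ρ = cong not (sat-embedding A B h inj pres q ρ)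
sat-embedding A B h inj pres (conj q r) ρ =
  cong₂ _∧_ (sat-embedding A B h inj pres q ρ) (sat-embedding A B h inj pres r ρ)

#sat-iso : ∀ {σ p} {φ : Formula σ p} (A B : Structure σ) → Iso A B → IsQF φ → #sat φ A ≡ #sat φ B
#sat-iso {p = p} A B (π , pres) q =
  trans (sumᵛ-cong (size A) p (λ v → cong ⟦_⟧ (sat-embedding A B (Inverse.to π) (↔-injective π) pres q v)))
    (sym (sumᵛ-permute π p _))

-- Relations of a strong sum

-- The function right local to _⊕_ has no name outside Defs, but properties of relations
-- whose arity is not a numeral can only be proved by induction on it.  It is recovered from terms
-- that Agda infers: cong! compares a relation atom on a variable tuple with one on a singleton,
-- and so produces the with-function of _⊕_ as a function of the value of right (for one
-- particular structure); with-abstraction removes the particular structure; and abstracting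
-- over the with-function leaves right applied to a variable, where unification can read it off.

data HEq {A : Set} (a : A) : {B : Set} → B → Set where
  hrefl : HEq a a

unarySig : Set → Signature
unarySig X = record { Sym = X ; ar = λ _ → 1 }

-- With a single point on the left, the tuple `zero ∷ []` lies in the left part, so on it `right`
-- computes to `nothing`.
pointStr : (σ : Signature) → Structure σ
pointStr σ = record { size = 1 ; rel = λ _ _ → true }

module _ (σ : Signature) (X : Set) (B : Structure (unarySig X)) (s : X) where

  data Found : (Vec (Fin (1 + size B)) 1 → Bool) → (Fin (1 + size B) → Bool) → Set where
    found : ∀ {P Q} → (Maybe (Vec (Fin (size B)) 1) → Bool) → Found P Q

  -- Checking `hrefl` as the second argument makes unification solve `F` by the function that
  -- `cong!` has found. The types of `h e` and `cong F e` agree only once `F` is known, hence `HEq`.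
  find : ∀ {P Q F} (h : nothing ≡ nothing → P (zero ∷ []) ≡ Q zero) →
    ((e : nothing ≡ nothing) → HEq (h e) (cong F e)) → Found P Q
  find {F = F} _ _ = found F

  -- The with only serves to normalise the goal.
  result : ⊤ → Found (rel (pointStr σ ⊕ B) (inj₂ s)) (λ x → rel (pointStr σ ⊕ B) (inj₂ s) (x ∷ []))
  result u with u
  ... | _ = find (λ e → cong! e) (λ e → hrefl)

  pointRel : Maybe (Vec (Fin (size B)) 1) → Bool
  pointRel with result tt
  ... | found F = F

mutual
  pointRel′ : ∀ σ X (B : Structure (unarySig X)) (s : X) →
    Vec (Fin (1 + size B)) 1 → Maybe (Vec (Fin (size B)) 1) → Bool
  pointRel′ σ X B s v m = _

  pointRel≡ : ∀ σ X B s m → pointRel σ X B s m ≡ pointRel′ σ X B s (zero ∷ []) m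
  pointRel≡ σ X B s m with V._∷_ {A = Fin (1 + size B)} zero V.[]
  ... | v = refl

RightAtom : {σ : Signature} → Structure σ → Signature → Set
RightAtom A τ = Σ[ B ∈ Structure τ ] Σ[ s ∈ Sym τ ]
  Vec (Fin (size A + size B)) (ar τ s) × Maybe (Vec (Fin (size B)) (ar τ s))

mutual
  -- The data of an atom have types depending on `A` and `τ`. Packed into the function `atom`, they
  -- let with-abstraction turn both into variables; `relʳ` then takes `P` to be equality with a
  -- given pair, so that `atom` can return any prescribed data there.
  atomRel : ∀ {σ} (P : Structure σ → Signature → Set₁) → (∀ A τ → P A τ → RightAtom A τ) →
    ∀ A τ → P A τ → Bool
  atomRel P atom A τ p = _

  atomRel≡ : ∀ {σ X} (P : Structure σ → Signature → Set₁) (atom : ∀ A τ → P A τ → RightAtom A τ)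
    (p : P (pointStr σ) (unarySig X)) →
    (let (B , s , v , m) = atom (pointStr σ) (unarySig X) p) →
    pointRel′ σ X B s v m ≡ atomRel P atom (pointStr σ) (unarySig X) p
  atomRel≡ {σ} {X} P atom p with pointStr σ | unarySig X | p
  ... | A | τ | p′ = refl

module _ {σ τ : Signature} (A : Structure σ) (B : Structure τ) where

  relʳ : (s : Sym τ) → Vec (Fin (size A + size B)) (ar τ s) → Maybe (Vec (Fin (size B)) (ar τ s)) → Bool
  relʳ s v m = atomRel (λ A′ τ′ → (A′ , τ′) ≡ (A , τ)) (λ { _ _ refl → B , s , v , m }) A τ refl

mutual
  rightₛ : ∀ {σ τ} (A : Structure σ) (B : Structure τ) (s : Sym τ) →
    Vec (Fin (size A + size B)) (ar τ s) → Maybe (Vec (Fin (size B)) (ar τ s))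
  rightₛ A B s v = _

  rightₛ≡ : ∀ {σ τ} (A : Structure σ) (B : Structure τ) (s : Sym τ) v →
    rel (A ⊕ B) (inj₂ s) v ≡ relʳ A B s v (rightₛ A B s v)
  rightₛ≡ A B s v with relʳ A B s v
  ... | g = refl

mutual
  -- In `right≡` the arity `ar τ s` is abstracted to a variable, which frees the function from the
  -- symbol `s` and makes induction on the tuple possible.
  right : ∀ {σ τ} (A : Structure σ) (B : Structure τ) {r} →
    Vec (Fin (size A + size B)) r → Maybe (Vec (Fin (size B)) r)
  right A B v = _

  right≡ : ∀ {σ τ} (A : Structure σ) (B : Structure τ) (s : Sym τ) v → rightₛ A B s v ≡ right A B v
  right≡ {τ = τ} A B s v with ar τ s | v
  ... | r | w = refl

module _ {X Y : Set} where

  lefts : ∀ {r} → Vec (X ⊎ Y) r → Maybe (Vec X r)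
  lefts []           = just []
  lefts (inj₁ x ∷ v) = Maybe.map (x ∷_) (lefts v)
  lefts (inj₂ _ ∷ v) = nothing

  rights : ∀ {r} → Vec (X ⊎ Y) r → Maybe (Vec Y r)
  rights []           = just []
  rights (inj₁ _ ∷ v) = nothing
  rights (inj₂ y ∷ v) = Maybe.map (y ∷_) (rights v)

lefts-map : ∀ {X Y X′ Y′ : Set} (f : X → X′) (g : Y → Y′) {r} (v : Vec (X ⊎ Y) r) →
  lefts (V.map (Sum.map f g) v) ≡ Maybe.map (V.map f) (lefts v)
lefts-map f g [] = refl
lefts-map f g (inj₁ x ∷ v) rewrite lefts-map f g v with lefts v
... | just _  = refl
... | nothing = refl
lefts-map f g (inj₂ y ∷ v) = refl

rights-map : ∀ {X Y X′ Y′ : Set} (f : X → X′) (g : Y → Y′) {r} (v : Vec (X ⊎ Y) r) →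
  rights (V.map (Sum.map f g) v) ≡ Maybe.map (V.map g) (rights v)
rights-map f g [] = refl
rights-map f g (inj₁ x ∷ v) = refl
rights-map f g (inj₂ y ∷ v) rewrite rights-map f g v with rights v
... | just _  = refl
... | nothing = refl

right-join : ∀ {σ τ} (A : Structure σ) (B : Structure τ) {r} (v : Vec (Fin (size A) ⊎ Fin (size B)) r) →
  right A B (V.map (join (size A) (size B)) v) ≡ rights v
right-join A B [] = refl
right-join A B (inj₁ x ∷ v) rewrite Finₚ.splitAt-↑ˡ (size A) x (size B) = refl
right-join A B (inj₂ y ∷ v) rewrite Finₚ.splitAt-↑ʳ (size A) (size B) y | right-join A B v with rights v
... | just _  = refl
... | nothing = refl

rel-⊕-inj₂ : ∀ {σ τ} (A : Structure σ) (B : Structure τ) s v →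
  rel (A ⊕ B) (inj₂ s) (V.map (join (size A) (size B)) v) ≡ Maybe.maybe′ (rel B s) false (rights v)
rel-⊕-inj₂ A B s v rewrite right-join A B v with rights v
... | just _  = refl
... | nothing = refl

-- The left summands of basic structures are `E` and `T N`. Their symbols have arities 1 and 2, so
-- there the function local to `_⊕_` can be evaluated by cases on the entries of the tuple.
record LeftSummand {σ : Signature} (A : Structure σ) : Set₁ where
  field
    rel-⊕-inj₁ : ∀ {τ} (B : Structure τ) s v →
      rel (A ⊕ B) (inj₁ s) (V.map (join (size A) (size B)) v) ≡ Maybe.maybe′ (rel A s) false (lefts v)
open LeftSummand public

E-leftSummand : LeftSummand E
E-leftSummand .rel-⊕-inj₁ B s (inj₁ x ∷ []) rewrite Finₚ.splitAt-↑ˡ 1 x (size B) = refl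
E-leftSummand .rel-⊕-inj₁ B s (inj₂ y ∷ []) rewrite Finₚ.splitAt-↑ʳ 1 (size B) y = refl

T-leftSummand : ∀ N → LeftSummand (T N)
T-leftSummand N .rel-⊕-inj₁ B U (inj₁ x ∷ []) rewrite Finₚ.splitAt-↑ˡ N x (size B) = refl
T-leftSummand N .rel-⊕-inj₁ B U (inj₂ y ∷ []) rewrite Finₚ.splitAt-↑ʳ N (size B) y = refl
T-leftSummand N .rel-⊕-inj₁ B S (inj₁ x ∷ inj₁ x′ ∷ [])
  rewrite Finₚ.splitAt-↑ˡ N x (size B) | Finₚ.splitAt-↑ˡ N x′ (size B) = refl
T-leftSummand N .rel-⊕-inj₁ B S (inj₁ x ∷ inj₂ y ∷ [])
  rewrite Finₚ.splitAt-↑ˡ N x (size B) | Finₚ.splitAt-↑ʳ N (size B) y = refl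
T-leftSummand N .rel-⊕-inj₁ B S (inj₂ y ∷ z ∷ []) rewrite Finₚ.splitAt-↑ʳ N (size B) y = refl

-- Quantifier-free formulas

⌊≟⌋⇒ : ∀ {N} {i j : Fin N} → ⌊ i Fin.≟ j ⌋ ≡ true → i ≡ j
⌊≟⌋⇒ {i = i} {j} e with i Fin.≟ j
... | yes p = p

⌊≟⌋⇐ : ∀ {N} {i j : Fin N} → i ≡ j → ⌊ i Fin.≟ j ⌋ ≡ true
⌊≟⌋⇐ {i = i} {j} p with i Fin.≟ j
... | yes _ = refl
... | no ¬p = contradiction p ¬p

module _ {σ : Signature} where

  rename : ∀ {m k} → (Fin m → Fin k) → Formula σ m → Formula σ k
  rename f tru        = tru
  rename f (eq i j)   = eq (f i) (f j)
  rename f (R s v)    = R s (V.map f v)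
  rename f (neg φ)    = neg (rename f φ)
  rename f (conj φ ψ) = conj (rename f φ) (rename f ψ)
  rename f (ex φ)     = ex (rename (Fin.lift 1 f) φ)

  rename-QF : ∀ {m k} (f : Fin m → Fin k) {φ : Formula σ m} → IsQF φ → IsQF (rename f φ)
  rename-QF f tru        = tru
  rename-QF f (eq i j)   = eq (f i) (f j)
  rename-QF f (R s v)    = R s (V.map f v)
  rename-QF f (neg p)    = neg (rename-QF f p)
  rename-QF f (conj p q) = conj (rename-QF f p) (rename-QF f q)

  sat-rename : ∀ {m k} (A : Structure σ) (f : Fin m → Fin k) {φ : Formula σ m} {ρ′ ρ} → IsQF φ →
    (∀ i → lookup ρ′ (f i) ≡ lookup ρ i) → sat A (rename f φ) ρ′ ≡ sat A φ ρ
  sat-rename A f tru        e = refl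
  sat-rename A f (eq i j)   e = cong₂ (λ x y → ⌊ x Fin.≟ y ⌋) (e i) (e j)
  sat-rename A f (R s v)    e = cong (rel A s) (trans (sym (Vₚ.map-∘ _ f v)) (Vₚ.map-cong e v))
  sat-rename A f (neg p)    e = cong not (sat-rename A f p e)
  sat-rename A f (conj p q) e = cong₂ _∧_ (sat-rename A f p e) (sat-rename A f q e)

  ⋀ : ∀ {m} n → (Fin n → Formula σ m) → Formula σ m
  ⋀ zero    φ = tru
  ⋀ (suc n) φ = conj (φ zero) (⋀ n (φ ∘ suc))

  ⋀-QF : ∀ {m} n {φ : Fin n → Formula σ m} → (∀ i → IsQF (φ i)) → IsQF (⋀ n φ)
  ⋀-QF zero    p = tru
  ⋀-QF (suc n) p = conj (p zero) (⋀-QF n (p ∘ suc))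

  ⋁ : ∀ {m} n → (Fin n → Formula σ m) → Formula σ m
  ⋁ n φ = neg (⋀ n (neg ∘ φ))

  ⋁-QF : ∀ {m} n {φ : Fin n → Formula σ m} → (∀ i → IsQF (φ i)) → IsQF (⋁ n φ)
  ⋁-QF n p = neg (⋀-QF n (neg ∘ p))

  infix 4 _⊨_[_]

  -- A record keeps `φ` and `ρ` inferable, whereas `sat A φ ρ ≡ true` unfolds as soon as `φ` is
  -- known.
  record _⊨_[_] {m} (A : Structure σ) (φ : Formula σ m) (ρ : Vec (Fin (size A)) m) : Set where
    constructor sat✓
    field sat≡true : sat A φ ρ ≡ true
  open _⊨_[_] public

  module _ {m} {A : Structure σ} {ρ : Vec (Fin (size A)) m} where

    ⊨-conj⇒ : ∀ {φ ψ} → A ⊨ conj φ ψ [ ρ ] → A ⊨ φ [ ρ ] × A ⊨ ψ [ ρ ]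
    ⊨-conj⇒ {φ} {ψ} (sat✓ e) with sat A φ ρ in p | sat A ψ ρ in q
    ... | true | true = sat✓ p , sat✓ q

    ⊨-conj⇐ : ∀ {φ ψ} → A ⊨ φ [ ρ ] → A ⊨ ψ [ ρ ] → A ⊨ conj φ ψ [ ρ ]
    ⊨-conj⇐ (sat✓ e) (sat✓ e′) = sat✓ (cong₂ _∧_ e e′)

    ⊨-neg⇒ : ∀ {φ} → A ⊨ neg φ [ ρ ] → ¬ A ⊨ φ [ ρ ]
    ⊨-neg⇒ {φ} (sat✓ e) (sat✓ e′) with () ← trans (sym e) (cong not e′)

    ⊨-neg⇐ : ∀ {φ} → ¬ A ⊨ φ [ ρ ] → A ⊨ neg φ [ ρ ]
    ⊨-neg⇐ {φ} ¬p with sat A φ ρ in e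
    ... | true  = contradiction (sat✓ e) ¬p
    ... | false = sat✓ (cong not e)

    ⊨-eq⇒ : ∀ {i j} → A ⊨ eq i j [ ρ ] → lookup ρ i ≡ lookup ρ j
    ⊨-eq⇒ (sat✓ e) = ⌊≟⌋⇒ e

    ⊨-eq⇐ : ∀ {i j} → lookup ρ i ≡ lookup ρ j → A ⊨ eq i j [ ρ ]
    ⊨-eq⇐ e = sat✓ (⌊≟⌋⇐ e)

    ⊨? : ∀ φ → Dec (A ⊨ φ [ ρ ])
    ⊨? φ with sat A φ ρ in e
    ... | true  = yes (sat✓ e)
    ... | false = no λ (sat✓ e′) → case trans (sym e) e′ of λ ()

    ⊨-⋀⇒ : ∀ n {φ : Fin n → Formula σ m} → A ⊨ ⋀ n φ [ ρ ] → ∀ i → A ⊨ φ i [ ρ ]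
    ⊨-⋀⇒ (suc n) e zero    = proj₁ (⊨-conj⇒ e)
    ⊨-⋀⇒ (suc n) e (suc i) = ⊨-⋀⇒ n (proj₂ (⊨-conj⇒ e)) i

    ⊨-⋀⇐ : ∀ n {φ : Fin n → Formula σ m} → (∀ i → A ⊨ φ i [ ρ ]) → A ⊨ ⋀ n φ [ ρ ]
    ⊨-⋀⇐ zero    p = sat✓ refl
    ⊨-⋀⇐ (suc n) p = ⊨-conj⇐ (p zero) (⊨-⋀⇐ n (p ∘ suc))

    ⊨-⋁⇐ : ∀ n {φ : Fin n → Formula σ m} i → A ⊨ φ i [ ρ ] → A ⊨ ⋁ n φ [ ρ ]
    ⊨-⋁⇐ n i p = ⊨-neg⇐ λ e → ⊨-neg⇒ (⊨-⋀⇒ n e i) p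

    ⊨-⋁⇒ : ∀ n {φ : Fin n → Formula σ m} → A ⊨ ⋁ n φ [ ρ ] → ∃ λ i → A ⊨ φ i [ ρ ]
    ⊨-⋁⇒ n {φ} e with Finₚ.any? (λ i → ⊨? (φ i))
    ... | yes p = p
    ... | no ¬p = contradiction (⊨-⋀⇐ n λ i → ⊨-neg⇐ λ q → ¬p (i , q)) (⊨-neg⇒ e)

true-iff : ∀ {a b} → (a ≡ true → b ≡ true) → (b ≡ true → a ≡ true) → a ≡ b
true-iff {true}  {b}     f g = sym (f refl)
true-iff {false} {true}  f g = g refl
true-iff {false} {false} f g = refl

lookup-ext : ∀ {X : Set} {n} (xs ys : Vec X n) → (∀ i → lookup xs i ≡ lookup ys i) → xs ≡ ys
lookup-ext []       []       e = refl
lookup-ext (x ∷ xs) (y ∷ ys) e = cong₂ _∷_ (e zero) (lookup-ext xs ys (e ∘ suc))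

-- Interpretations

sum-δ : ∀ {N} (x : Fin N) (f : Fin N → ℕ) → sum (λ a → ⟦ ⌊ x Fin.≟ a ⌋ ⟧ * f a) ≡ f x
sum-δ {suc N} zero    f = trans (cong (f zero + 0 +_) (sum-zero (λ a → ⟦ ⌊ zero Fin.≟ suc a ⌋ ⟧ * f (suc a)) (λ i → refl)))
  (trans (ℕₚ.+-identityʳ _) (ℕₚ.+-identityʳ _))
sum-δ {suc N} (suc x) f = trans
  (sum-cong-≗ {N} λ a → cong (λ b → ⟦ b ⟧ * f (suc a)) (⌊⌋-map′ (cong suc) Finₚ.suc-injective (x Fin.≟ a)))
  (sum-δ x (f ∘ suc))

sum≤1-injective : ∀ {n} (f : Fin n → ℕ) {i j} → sum f ≤ 1 → f i ≡ 1 → f j ≡ 1 → i ≡ j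
sum≤1-injective f {zero}  {zero}  ≤1 p q = refl
sum≤1-injective f {zero}  {suc j} ≤1 p q =
  contradiction (ℕₚ.≤-trans (ℕₚ.+-mono-≤ (ℕₚ.≤-reflexive (sym p))
    (ℕₚ.≤-trans (ℕₚ.≤-reflexive (sym q)) (term≤sum (f ∘ suc) j))) ≤1) λ { (s≤s ()) }
sum≤1-injective f {suc i} {zero}  ≤1 p q = sym (sum≤1-injective f ≤1 q p)
sum≤1-injective f {suc i} {suc j} ≤1 p q =
  cong suc (sum≤1-injective (f ∘ suc) (ℕₚ.≤-trans (ℕₚ.m≤n+m _ (f zero)) ≤1) p q)

eqᵛ : ∀ {N p} → Vec (Fin N) p → Vec (Fin N) p → Bool
eqᵛ []      []      = true
eqᵛ (x ∷ v) (y ∷ w) = ⌊ x Fin.≟ y ⌋ ∧ eqᵛ v w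

eqᵛ⇒≡ : ∀ {N p} (v w : Vec (Fin N) p) → eqᵛ v w ≡ true → v ≡ w
eqᵛ⇒≡ []      []      e = refl
eqᵛ⇒≡ (x ∷ v) (y ∷ w) e with x Fin.≟ y
... | yes refl = cong (x ∷_) (eqᵛ⇒≡ v w e)

eqᵛ-refl : ∀ {N p} (v : Vec (Fin N) p) → eqᵛ v v ≡ true
eqᵛ-refl []      = refl
eqᵛ-refl (x ∷ v) = cong₂ _∧_ (⌊≟⌋⇐ refl) (eqᵛ-refl v)

sumᵛ-δ : ∀ N p (v : Vec (Fin N) p) (f : Vec (Fin N) p → ℕ) → sumᵛ N p (λ w → ⟦ eqᵛ v w ⟧ * f w) ≡ f v
sumᵛ-δ N zero    []      f = ℕₚ.+-identityʳ (f [])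
sumᵛ-δ N (suc p) (x ∷ v) f = trans
  (sum-cong-≗ λ a → begin
    sumᵛ N p (λ w → ⟦ ⌊ x Fin.≟ a ⌋ ∧ eqᵛ v w ⟧ * f (a ∷ w))
      ≡⟨ sumᵛ-cong N p (λ w → trans (cong (_* f (a ∷ w)) (⟦∧⟧ ⌊ x Fin.≟ a ⌋ (eqᵛ v w)))
           (ℕₚ.*-assoc ⟦ ⌊ x Fin.≟ a ⌋ ⟧ _ _)) ⟩
    sumᵛ N p (λ w → ⟦ ⌊ x Fin.≟ a ⌋ ⟧ * (⟦ eqᵛ v w ⟧ * f (a ∷ w)))
      ≡⟨ sumᵛ-*ˡ N p ⟦ ⌊ x Fin.≟ a ⌋ ⟧ _ ⟩
    ⟦ ⌊ x Fin.≟ a ⌋ ⟧ * sumᵛ N p (λ w → ⟦ eqᵛ v w ⟧ * f (a ∷ w))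
      ≡⟨ cong (⟦ ⌊ x Fin.≟ a ⌋ ⟧ *_) (sumᵛ-δ N p v (f ∘ (a ∷_))) ⟩
    ⟦ ⌊ x Fin.≟ a ⌋ ⟧ * f (a ∷ v) ∎)
  (sum-δ x (λ a → f (a ∷ v)))

module _ {σ : Signature} {p : ℕ} (φ : Formula σ p) (A : Structure σ) where

  private D = solutions φ A

  -- The multiplicity of `v` in `D` is thereby 0 or 1. Absence of repetitions, soundness and
  -- completeness of the enumeration are all read off from this number.
  solutions-hits : ∀ v → sum (λ i → ⟦ eqᵛ v (L.lookup D i) ⟧) ≡ ⟦ sat A φ v ⟧
  solutions-hits v = trans (sum-solutions φ A (λ w → ⟦ eqᵛ v w ⟧))
    (trans (sumᵛ-cong (size A) p (λ w → ℕₚ.*-comm ⟦ sat A φ w ⟧ _)) (sumᵛ-δ (size A) p v _))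

  solutions-injective : ∀ {i j} → L.lookup D i ≡ L.lookup D j → i ≡ j
  solutions-injective {i} {j} e = sum≤1-injective (λ k → ⟦ eqᵛ (L.lookup D i) (L.lookup D k) ⟧)
    (ℕₚ.≤-trans (ℕₚ.≤-reflexive (solutions-hits (L.lookup D i))) (⟦⟧≤1 (sat A φ (L.lookup D i))))
    (⟦true⟧ (eqᵛ-refl (L.lookup D i))) (⟦true⟧ (subst (λ w → eqᵛ (L.lookup D i) w ≡ true) e (eqᵛ-refl (L.lookup D i))))
    where
    ⟦⟧≤1 : ∀ b → ⟦ b ⟧ ≤ 1
    ⟦⟧≤1 true  = ℕₚ.≤-refl
    ⟦⟧≤1 false = z≤n

  solutions-complete : ∀ v → A ⊨ φ [ v ] → ∃ λ i → L.lookup D i ≡ v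
  solutions-complete v (sat✓ e)
    with i , ≢0 ← sum-positive _ (λ z → case trans (sym z) (trans (solutions-hits v) (⟦true⟧ e)) of λ ())
    with eqᵛ v (L.lookup D i) in q
  ... | true  = i , sym (eqᵛ⇒≡ v (L.lookup D i) q)
  ... | false = contradiction refl ≢0

  solutions-sound : ∀ i → A ⊨ φ [ L.lookup D i ]
  solutions-sound i with sat A φ (L.lookup D i) in e
  ... | true  = sat✓ e
  ... | false = contradiction (ℕₚ.≤-trans (ℕₚ.≤-reflexive (sym (⟦true⟧ (eqᵛ-refl (L.lookup D i)))))
      (ℕₚ.≤-trans (term≤sum (λ k → ⟦ eqᵛ (L.lookup D i) (L.lookup D k) ⟧) i)
        (ℕₚ.≤-reflexive (trans (solutions-hits (L.lookup D i)) (cong ⟦_⟧ e))))) λ ()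

module _ {κ μ : Signature} {p : ℕ} (I : InterpretationScheme κ μ p) (qf : IsQFScheme I) where

  translate : ∀ {m} → Formula μ m → Formula κ (m * p)
  translate tru        = tru
  translate (eq i j)   = ⋀ p (λ t → eq (combine i t) (combine j t))
  translate (R s v)    = rename (λ k → combine (lookup v (proj₁ (remQuot p k))) (proj₂ (remQuot {ar μ s} p k))) (ρ I s)
  translate (neg φ)    = neg (translate φ)
  translate (conj φ ψ) = conj (translate φ) (translate ψ)
  -- A dummy value: the translation is used on quantifier-free formulas only.
  translate (ex φ)     = tru

  translate-QF : ∀ {m} {φ : Formula μ m} → IsQF φ → IsQF (translate φ)
  translate-QF tru        = tru
  translate-QF (eq i j)   = ⋀-QF p (λ t → eq _ _)
  translate-QF (R s v)    = rename-QF _ (proj₂ qf s)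
  translate-QF (neg q)    = neg (translate-QF q)
  translate-QF (conj q r) = conj (translate-QF q) (translate-QF r)

  inDomain : ∀ m → Formula κ (m * p)
  inDomain zero    = tru
  inDomain (suc m) = conj (rename (_↑ˡ (m * p)) (ρ₀ I)) (rename (p ↑ʳ_) (inDomain m))

  inDomain-QF : ∀ m → IsQF (inDomain m)
  inDomain-QF zero    = tru
  inDomain-QF (suc m) = conj (rename-QF _ (proj₁ qf)) (rename-QF _ (inDomain-QF m))

  module _ (A : Structure κ) where

    private
      N = size A
      D = solutions (ρ₀ I) A

    flatten : ∀ {m} → Vec (Fin (length D)) m → Vec (Fin N) (m * p)
    flatten ρ = V.concat (V.map (L.lookup D) ρ)

    lookup-flatten : ∀ {m} (ρ : Vec (Fin (length D)) m) i t →
      lookup (flatten ρ) (combine i t) ≡ lookup (L.lookup D (lookup ρ i)) t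
    lookup-flatten ρ i t = trans (Vₚ.lookup-concat (V.map (L.lookup D) ρ) i t)
      (cong (λ w → lookup w t) (Vₚ.lookup-map i (L.lookup D) ρ))

    sat-translate : ∀ {m} {φ : Formula μ m} → IsQF φ → ∀ ρ →
      sat A (translate φ) (flatten ρ) ≡ sat (interpret I A) φ ρ
    sat-translate tru ρ = refl
    sat-translate (eq i j) ρ = true-iff
      -- Elements of the interpreted structure are indices into `D`; equal coordinates give equal
      -- indices because `D` has no repetitions.
      (λ e → ⌊≟⌋⇐ (solutions-injective (ρ₀ I) A (lookup-ext _ _ λ t →
        trans (sym (lookup-flatten ρ i t))
          (trans (⊨-eq⇒ (⊨-⋀⇒ p {λ t → eq (combine i t) (combine j t)} (sat✓ e) t)) (lookup-flatten ρ j t)))))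
      (λ e → sat≡true (⊨-⋀⇐ {A = A} p λ t → ⊨-eq⇐ (trans (lookup-flatten ρ i t)
        (trans (cong (λ k → lookup (L.lookup D k) t) (⌊≟⌋⇒ e)) (sym (lookup-flatten ρ j t))))))
    sat-translate (R s v) ρ = sat-rename A _ (proj₂ qf s) λ k →
      let a = proj₁ (remQuot {ar μ s} p k); t = proj₂ (remQuot {ar μ s} p k) in begin
      lookup (flatten ρ) (combine (lookup v a) t)
        ≡⟨ lookup-flatten ρ (lookup v a) t ⟩
      lookup (L.lookup D (lookup ρ (lookup v a))) t
        ≡⟨ cong (λ i → lookup (L.lookup D i) t) (sym (Vₚ.lookup-map a (lookup ρ) v)) ⟩
      lookup (L.lookup D (lookup (V.map (lookup ρ) v) a)) t
        ≡⟨ sym (lookup-flatten (V.map (lookup ρ) v) a t) ⟩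
      lookup (flatten (V.map (lookup ρ) v)) (combine a t)
        ≡⟨ cong (lookup (flatten (V.map (lookup ρ) v))) (Finₚ.combine-remQuot {ar μ s} p k) ⟩
      lookup (flatten (V.map (lookup ρ) v)) k ∎
    sat-translate (neg q)    ρ = cong not (sat-translate q ρ)
    sat-translate (conj q r) ρ = cong₂ _∧_ (sat-translate q ρ) (sat-translate r ρ)

    -- Block by block, `sum-solutions` replaces the sum over the enumerated domain by a sum over all
    -- `p`-tuples weighted with the indicator of `ρ₀`.
    sum-flatten : ∀ m (f : Vec (Fin N) (m * p) → ℕ) →
      sumᵛ (length D) m (f ∘ flatten) ≡ sumᵛ N (m * p) (λ w → ⟦ sat A (inDomain m) w ⟧ * f w)
    sum-flatten zero    f = sym (ℕₚ.+-identityʳ (f []))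
    sum-flatten (suc m) f = begin
      sum (λ i → sumᵛ (length D) m (λ ρ → f (L.lookup D i V.++ flatten ρ)))
        ≡⟨ sum-cong-≗ (λ i → sum-flatten m (λ w → f (L.lookup D i V.++ w))) ⟩
      sum (λ i → sumᵛ N (m * p) (λ w → ⟦ sat A (inDomain m) w ⟧ * f (L.lookup D i V.++ w)))
        ≡⟨ sum-solutions (ρ₀ I) A (λ v → sumᵛ N (m * p) (λ w → ⟦ sat A (inDomain m) w ⟧ * f (v V.++ w))) ⟩
      sumᵛ N p (λ v → ⟦ sat A (ρ₀ I) v ⟧ * sumᵛ N (m * p) (λ w → ⟦ sat A (inDomain m) w ⟧ * f (v V.++ w)))
        ≡⟨ sumᵛ-cong N p (λ v → trans (sym (sumᵛ-*ˡ N (m * p) ⟦ sat A (ρ₀ I) v ⟧ _))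
             (sumᵛ-cong N (m * p) (λ w → step v w))) ⟩
      sumᵛ N p (λ v → sumᵛ N (m * p) (λ w → ⟦ sat A (inDomain (suc m)) (v V.++ w) ⟧ * f (v V.++ w)))
        ≡⟨ sym (sumᵛ-++ N p (m * p) _) ⟩
      sumᵛ N (p + m * p) (λ w → ⟦ sat A (inDomain (suc m)) w ⟧ * f w) ∎
      where
      step : ∀ v w → ⟦ sat A (ρ₀ I) v ⟧ * (⟦ sat A (inDomain m) w ⟧ * f (v V.++ w)) ≡
                     ⟦ sat A (inDomain (suc m)) (v V.++ w) ⟧ * f (v V.++ w)
      step v w = trans (sym (ℕₚ.*-assoc ⟦ sat A (ρ₀ I) v ⟧ _ _)) (cong (_* f (v V.++ w))
        (trans (sym (⟦∧⟧ (sat A (ρ₀ I) v) _)) (cong₂ (λ a b → ⟦ a ∧ b ⟧)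
          (sym (sat-rename A (_↑ˡ (m * p)) {ρ′ = v V.++ w} {v} (proj₁ qf) (Vₚ.lookup-++ˡ v w)))
          (sym (sat-rename A (p ↑ʳ_) {ρ′ = v V.++ w} {w} (inDomain-QF m) (Vₚ.lookup-++ʳ v w))))))

  interpret-strongPol : ∀ {A : ℕ → Structure κ} → StrongPol A → StrongPol (λ n → interpret I (A n))
  interpret-strongPol {A} P {m} {φ} q =
    poly-cong (λ n → begin
      sumᵛ (size (A n)) (m * p) (λ w → ⟦ sat (A n) (conj (inDomain m) (translate φ)) w ⟧)
        ≡⟨ sumᵛ-cong (size (A n)) (m * p) (λ w → ⟦∧⟧ (sat (A n) (inDomain m) w) _) ⟩
      sumᵛ (size (A n)) (m * p) (λ w → ⟦ sat (A n) (inDomain m) w ⟧ * ⟦ sat (A n) (translate φ) w ⟧)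
        ≡⟨ sym (sum-flatten (A n) m _) ⟩
      sumᵛ (size (interpret I (A n))) m (λ ρ → ⟦ sat (A n) (translate φ) (flatten (A n) ρ) ⟧)
        ≡⟨ sumᵛ-cong (size (interpret I (A n))) m (λ ρ → cong ⟦_⟧ (sat-translate (A n) q ρ)) ⟩
      #sat φ (interpret I (A n)) ∎)
    (P (conj (inDomain-QF m) (translate-QF q)))

-- Strong sums

-- Choice p a b: which of the p coordinates of a tuple over a disjoint union lie in
-- the left part (a of them) and which in the right part (b of them).
data Choice : ℕ → ℕ → ℕ → Set where
  done  : Choice 0 0 0
  goesˡ : ∀ {p a b} → Choice p a b → Choice (suc p) (suc a) b
  goesʳ : ∀ {p a b} → Choice p a b → Choice (suc p) a (suc b)

module _ {X Y : Set} where

  merge : ∀ {p a b} → Choice p a b → Vec X a → Vec Y b → Vec (X ⊎ Y) p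
  merge done      []      []      = []
  merge (goesˡ c) (x ∷ u) w       = inj₁ x ∷ merge c u w
  merge (goesʳ c) u       (y ∷ w) = inj₂ y ∷ merge c u w

place : ∀ {p a b} → Choice p a b → Fin p → Fin a ⊎ Fin b
place (goesˡ c) zero    = inj₁ zero
place (goesˡ c) (suc i) = Sum.map suc id (place c i)
place (goesʳ c) zero    = inj₂ zero
place (goesʳ c) (suc i) = Sum.map id suc (place c i)

lookup-merge : ∀ {X Y : Set} {p a b} (c : Choice p a b) (u : Vec X a) (w : Vec Y b) i →
  lookup (merge c u w) i ≡ Sum.map (lookup u) (lookup w) (place c i)
lookup-merge (goesˡ c) (x ∷ u) w       zero    = refl
lookup-merge (goesˡ c) (x ∷ u) w       (suc i) with place c i | lookup-merge c u w i
... | inj₁ _ | e = e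
... | inj₂ _ | e = e
lookup-merge (goesʳ c) u       (y ∷ w) zero    = refl
lookup-merge (goesʳ c) u       (y ∷ w) (suc i) with place c i | lookup-merge c u w i
... | inj₁ _ | e = e
... | inj₂ _ | e = e

sumᶜ : ∀ p → (∀ {a b} → Choice p a b → ℕ) → ℕ
sumᶜ zero    f = f done
sumᶜ (suc p) f = sumᶜ p (f ∘ goesˡ) + sumᶜ p (f ∘ goesʳ)

sumᶜ-cong : ∀ p {f g : ∀ {a b} → Choice p a b → ℕ} → (∀ {a b} (c : Choice p a b) → f c ≡ g c) →
  sumᶜ p f ≡ sumᶜ p g
sumᶜ-cong zero    e = e done
sumᶜ-cong (suc p) e = cong₂ _+_ (sumᶜ-cong p (e ∘ goesˡ)) (sumᶜ-cong p (e ∘ goesʳ))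

∑-sumᶜ : ∀ {n} p (f : ∀ {a b} → Fin n → Choice p a b → ℕ) →
  sum (λ i → sumᶜ p (f i)) ≡ sumᶜ p (λ c → sum (λ i → f i c))
∑-sumᶜ     zero    f = refl
∑-sumᶜ {n} (suc p) f = trans (∑-distrib-+ {n} _ _)
  (cong₂ _+_ (∑-sumᶜ p (λ i → f i ∘ goesˡ)) (∑-sumᶜ p (λ i → f i ∘ goesʳ)))

poly-sumᶜ : ∀ p (f : ∀ {a b} → Choice p a b → ℕ → ℕ) → (∀ {a b} (c : Choice p a b) → Pol (f c)) →
  Pol (λ n → sumᶜ p (λ c → f c n))
poly-sumᶜ zero    f P = P done
poly-sumᶜ (suc p) f P = poly-+ (poly-sumᶜ p (f ∘ goesˡ) (P ∘ goesˡ)) (poly-sumᶜ p (f ∘ goesʳ) (P ∘ goesʳ))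

sumᵛ-merge : ∀ M N p (f : Vec (Fin (M + N)) p → ℕ) →
  sumᵛ (M + N) p f ≡
  sumᶜ p (λ {a} {b} c → sumᵛ M a (λ u → sumᵛ N b (λ w → f (V.map (join M N) (merge c u w)))))
sumᵛ-merge M N zero    f = refl
sumᵛ-merge M N (suc p) f = trans (sum-split M N (λ x → sumᵛ (M + N) p (f ∘ (x ∷_)))) (cong₂ _+_
  (trans (sum-cong-≗ λ i → sumᵛ-merge M N p (f ∘ ((i ↑ˡ N) ∷_)))
    (∑-sumᶜ p (λ {a} {b} i c → sumᵛ M a λ u → sumᵛ N b λ w → f (V.map (join M N) (merge (goesˡ c) (i ∷ u) w)))))
  (trans (sum-cong-≗ λ j → sumᵛ-merge M N p (f ∘ ((M ↑ʳ j) ∷_)))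
    (trans (∑-sumᶜ p (λ {a} {b} j c → sumᵛ M a λ u → sumᵛ N b λ w → f (V.map (join M N) (merge (goesʳ c) u (j ∷ w)))))
      (sumᶜ-cong p (λ {a} {b} c →
        sumᵛ-∑ M a (λ j u → sumᵛ N b λ w → f (V.map (join M N) (merge (goesʳ c) u (j ∷ w)))))))))

≟-injection : ∀ {M N} (f : Fin M → Fin N) → (∀ {x y} → f x ≡ f y → x ≡ y) → ∀ x y →
  ⌊ x Fin.≟ y ⌋ ≡ ⌊ f x Fin.≟ f y ⌋
≟-injection f inj x y = true-iff (λ e → ⌊≟⌋⇐ (cong f (⌊≟⌋⇒ e))) (λ e → ⌊≟⌋⇐ (inj (⌊≟⌋⇒ e)))

≟-distinct : ∀ {N} (x y : Fin N) → x ≢ y → false ≡ ⌊ x Fin.≟ y ⌋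
≟-distinct x y x≢y = true-iff (λ ()) (λ e → contradiction (⌊≟⌋⇒ e) x≢y)

join-injective : ∀ M N {x y : Fin M ⊎ Fin N} → join M N x ≡ join M N y → x ≡ y
join-injective M N {x} {y} e =
  trans (sym (Finₚ.splitAt-join M N x)) (trans (cong (splitAt M) e) (Finₚ.splitAt-join M N y))

module _ {σ τ : Signature} (A : ℕ → Structure σ) (B : ℕ → Structure τ)
  (ls : ∀ n → LeftSummand (A n)) (PA : StrongPol A) (PB : StrongPol B) where

  private
    m : ℕ → ℕ
    m n = size (A n)
    k : ℕ → ℕ
    k n = size (B n)

  module _ {p a b : ℕ} (c : Choice p a b) where

    env : ∀ n → Vec (Fin (m n)) a → Vec (Fin (k n)) b → Vec (Fin (m n + k n)) p
    env n u w = V.map (join (m n) (k n)) (merge c u w)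

    lookup-env : ∀ n u w i → lookup (env n u w) i ≡ join (m n) (k n) (Sum.map (lookup u) (lookup w) (place c i))
    lookup-env n u w i = trans (Vₚ.lookup-map i (join (m n) (k n)) (merge c u w))
      (cong (join (m n) (k n)) (lookup-merge c u w i))

    Weight : Set
    Weight = ∀ n → Vec (Fin (m n)) a → Vec (Fin (k n)) b → ℕ

    weightedSum : Formula σ a → Formula τ b → Weight → ℕ → ℕ
    weightedSum α β g n = sumᵛ (m n) a λ u → sumᵛ (k n) b λ w → ⟦ sat (A n) α u ⟧ * ⟦ sat (B n) β w ⟧ * g n u w

    weightedSum-cong : ∀ α β g α′ β′ g′ → (∀ n u w →
      ⟦ sat (A n) α u ⟧ * ⟦ sat (B n) β w ⟧ * g n u w ≡ ⟦ sat (A n) α′ u ⟧ * ⟦ sat (B n) β′ w ⟧ * g′ n u w) →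
      ∀ n → weightedSum α β g n ≡ weightedSum α′ β′ g′ n
    weightedSum-cong α β g α′ β′ g′ e n = sumᵛ-cong (m n) a λ u → sumᵛ-cong (k n) b λ w → e n u w

    -- Asking for arbitrary quantifier-free factors α and β makes the property stable under
    -- multiplication by the indicator of any quantifier-free formula, by induction on it.
    Good : Weight → Set
    Good g = ∀ {α β} → IsQF α → IsQF β → Pol (weightedSum α β g)

    good-cong : ∀ {g h} → (∀ n u w → g n u w ≡ h n u w) → Good g → Good h
    good-cong {g} {h} e G {α} {β} qα qβ =
      poly-cong (weightedSum-cong α β g α β h (λ n u w → cong (⟦ sat (A n) α u ⟧ * ⟦ sat (B n) β w ⟧ *_) (e n u w))) (G qα qβ)

    good-one : Good (λ _ _ _ → 1)
    good-one {α} {β} qα qβ = poly-cong (λ n → sym (begin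
      weightedSum α β (λ _ _ _ → 1) n
        ≡⟨ sumᵛ-cong (m n) a (λ u → trans (sumᵛ-cong (k n) b (λ w → ℕₚ.*-identityʳ _))
             (sumᵛ-*ˡ (k n) b ⟦ sat (A n) α u ⟧ _)) ⟩
      sumᵛ (m n) a (λ u → ⟦ sat (A n) α u ⟧ * #sat β (B n))
        ≡⟨ sumᵛ-*ʳ (m n) a (#sat β (B n)) _ ⟩
      #sat α (A n) * #sat β (B n) ∎)) (poly-* (PA qα) (PB qβ))

    good-zero : Good (λ _ _ _ → 0)
    good-zero {α} {β} qα qβ = poly-cong
      (λ n → sym (sumᵛ-zero (m n) a _ λ u → sumᵛ-zero (k n) b _ λ w →
        ℕₚ.*-zeroʳ (⟦ sat (A n) α u ⟧ * ⟦ sat (B n) β w ⟧))) (poly-const 0)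

    good-left : ∀ {γ g} → IsQF γ → Good g → Good (λ n u w → ⟦ sat (A n) γ u ⟧ * g n u w)
    good-left {γ} {g} qγ G {α} {β} qα qβ = poly-cong (weightedSum-cong (conj α γ) β g α β _ λ n u w → begin
      ⟦ sat (A n) α u ∧ sat (A n) γ u ⟧ * ⟦ sat (B n) β w ⟧ * g n u w
        ≡⟨ cong (λ x → x * ⟦ sat (B n) β w ⟧ * g n u w) (⟦∧⟧ (sat (A n) α u) _) ⟩
      ⟦ sat (A n) α u ⟧ * ⟦ sat (A n) γ u ⟧ * ⟦ sat (B n) β w ⟧ * g n u w
        ≡⟨ swap ⟦ sat (A n) α u ⟧ ⟦ sat (A n) γ u ⟧ ⟦ sat (B n) β w ⟧ (g n u w) ⟩
      ⟦ sat (A n) α u ⟧ * ⟦ sat (B n) β w ⟧ * (⟦ sat (A n) γ u ⟧ * g n u w) ∎) (G (conj qα qγ) qβ)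
      where
      swap : ∀ x y z t → x * y * z * t ≡ x * z * (y * t)
      swap = solve-∀

    good-right : ∀ {γ g} → IsQF γ → Good g → Good (λ n u w → ⟦ sat (B n) γ w ⟧ * g n u w)
    good-right {γ} {g} qγ G {α} {β} qα qβ = poly-cong (weightedSum-cong α (conj β γ) g α β _ λ n u w → begin
      ⟦ sat (A n) α u ⟧ * ⟦ sat (B n) β w ∧ sat (B n) γ w ⟧ * g n u w
        ≡⟨ cong (λ x → ⟦ sat (A n) α u ⟧ * x * g n u w) (⟦∧⟧ (sat (B n) β w) _) ⟩
      ⟦ sat (A n) α u ⟧ * (⟦ sat (B n) β w ⟧ * ⟦ sat (B n) γ w ⟧) * g n u w
        ≡⟨ assoc ⟦ sat (A n) α u ⟧ ⟦ sat (B n) β w ⟧ ⟦ sat (B n) γ w ⟧ (g n u w) ⟩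
      ⟦ sat (A n) α u ⟧ * ⟦ sat (B n) β w ⟧ * (⟦ sat (B n) γ w ⟧ * g n u w) ∎) (G qα (conj qβ qγ))
      where
      assoc : ∀ x y z t → x * (y * z) * t ≡ x * y * (z * t)
      assoc = solve-∀

    -- The parts of the sum where `s` holds and where it fails add up to the whole, so a negation
    -- costs one difference of polynomials.
    good-not : ∀ (s : ∀ n → Vec (Fin (m n)) a → Vec (Fin (k n)) b → Bool) {g} → Good g →
      Good (λ n u w → ⟦ s n u w ⟧ * g n u w) → Good (λ n u w → ⟦ not (s n u w) ⟧ * g n u w)
    good-not s {g} G G′ {α} {β} qα qβ = poly-difference (λ n → begin
      weightedSum α β g n
        ≡⟨ sumᵛ-cong (m n) a (λ u → trans (sumᵛ-cong (k n) b (λ w → halves (⟦ sat (A n) α u ⟧ * ⟦ sat (B n) β w ⟧) (s n u w) (g n u w)))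
             (sumᵛ-+ (k n) b (λ w → ⟦ sat (A n) α u ⟧ * ⟦ sat (B n) β w ⟧ * (⟦ s n u w ⟧ * g n u w)) _)) ⟩
      sumᵛ (m n) a (λ u →
        sumᵛ (k n) b (λ w → ⟦ sat (A n) α u ⟧ * ⟦ sat (B n) β w ⟧ * (⟦ s n u w ⟧ * g n u w)) +
        sumᵛ (k n) b (λ w → ⟦ sat (A n) α u ⟧ * ⟦ sat (B n) β w ⟧ * (⟦ not (s n u w) ⟧ * g n u w)))
        ≡⟨ sumᵛ-+ (m n) a _ _ ⟩
      weightedSum α β (λ n u w → ⟦ s n u w ⟧ * g n u w) n + weightedSum α β (λ n u w → ⟦ not (s n u w) ⟧ * g n u w) n ∎)
      (G qα qβ) (G′ qα qβ)
      where
      halves : ∀ c b x → c * x ≡ c * (⟦ b ⟧ * x) + c * (⟦ not b ⟧ * x)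
      halves c true  x = trans (cong (c *_) (sym (ℕₚ.*-identityˡ x)))
        (trans (sym (ℕₚ.+-identityʳ _)) (cong (c * (1 * x) +_) (sym (ℕₚ.*-zeroʳ c))))
      halves c false x = trans (cong (c *_) (sym (ℕₚ.*-identityˡ x))) (cong (_+ c * (1 * x)) (sym (ℕₚ.*-zeroʳ c)))

    -- Once `c` is fixed, it is known in which summand each variable lies; every atom turns into an
    -- atom of one summand or is constantly false. The arbitrary weight `g` lets a conjunction be
    -- absorbed one factor at a time.
    good-sat : ∀ {φ : Formula (σ ⊕ˢ τ) p} {g} → IsQF φ → Good g →
      Good (λ n u w → ⟦ sat (A n ⊕ B n) φ (env n u w) ⟧ * g n u w)
    good-sat tru G = good-cong (λ n u w → sym (ℕₚ.*-identityˡ _)) G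
    good-sat {g = g} (eq i j) G = good-cong (λ n u w → cong (λ b → ⟦ b ⟧ * g n u w) (sym
      (cong₂ (λ x y → ⌊ x Fin.≟ y ⌋) (lookup-env n u w i) (lookup-env n u w j)))) (at (place c i) (place c j))
      where
      at : ∀ x y → Good (λ n u w → ⟦ ⌊ join (m n) (k n) (Sum.map (lookup u) (lookup w) x) Fin.≟
                                      join (m n) (k n) (Sum.map (lookup u) (lookup w) y) ⌋ ⟧ * g n u w)
      at (inj₁ x) (inj₁ y) = good-cong (λ n u w → cong (λ b → ⟦ b ⟧ * g n u w)
        (≟-injection (_↑ˡ k n) (Finₚ.↑ˡ-injective (k n) _ _) (lookup u x) (lookup u y))) (good-left (eq x y) G)
      at (inj₂ x) (inj₂ y) = good-cong (λ n u w → cong (λ b → ⟦ b ⟧ * g n u w)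
        (≟-injection (m n ↑ʳ_) (Finₚ.↑ʳ-injective (m n) _ _) (lookup w x) (lookup w y))) (good-right (eq x y) G)
      at (inj₁ x) (inj₂ y) = good-cong (λ n u w → cong (λ b → ⟦ b ⟧ * g n u w) (≟-distinct _ _
        (λ e → case join-injective (m n) (k n) {inj₁ (lookup u x)} {inj₂ (lookup w y)} e of λ ()))) good-zero
      at (inj₂ x) (inj₁ y) = good-cong (λ n u w → cong (λ b → ⟦ b ⟧ * g n u w) (≟-distinct _ _
        (λ e → case join-injective (m n) (k n) {inj₂ (lookup w x)} {inj₁ (lookup u y)} e of λ ()))) good-zero
    good-sat {g = g} (R s v) G = good-cong (λ n u w → cong (λ b → ⟦ b ⟧ * g n u w) (sym (trans
      (cong (rel (A n ⊕ B n) s) (env-atom n u w v)) (split s v n u w)))) (at s v)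
      where
      env-atom : ∀ n u w {r} (v : Vec (Fin p) r) → V.map (lookup (env n u w)) v ≡
        V.map (join (m n) (k n)) (V.map (Sum.map (lookup u) (lookup w)) (V.map (place c) v))
      env-atom n u w v = trans (Vₚ.map-cong (lookup-env n u w) v)
        (trans (Vₚ.map-∘ (join (m n) (k n)) _ v) (cong (V.map (join (m n) (k n))) (Vₚ.map-∘ _ (place c) v)))

      value : ∀ s → Vec (Fin p) (ar (σ ⊕ˢ τ) s) → ∀ n → Vec (Fin (m n)) a → Vec (Fin (k n)) b → Bool
      value (inj₁ s) v n u w = Maybe.maybe′ (rel (A n) s) false (Maybe.map (V.map (lookup u)) (lefts (V.map (place c) v)))
      value (inj₂ s) v n u w = Maybe.maybe′ (rel (B n) s) false (Maybe.map (V.map (lookup w)) (rights (V.map (place c) v)))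

      split : ∀ s v n u w → rel (A n ⊕ B n) s
        (V.map (join (m n) (k n)) (V.map (Sum.map (lookup u) (lookup w)) (V.map (place c) v))) ≡ value s v n u w
      split (inj₁ s) v n u w = trans (rel-⊕-inj₁ (ls n) (B n) s (V.map (Sum.map (lookup u) (lookup w)) (V.map (place c) v)))
        (cong (Maybe.maybe′ (rel (A n) s) false) (lefts-map (lookup u) (lookup w) (V.map (place c) v)))
      split (inj₂ s) v n u w = trans (rel-⊕-inj₂ (A n) (B n) s (V.map (Sum.map (lookup u) (lookup w)) (V.map (place c) v)))
        (cong (Maybe.maybe′ (rel (B n) s) false) (rights-map (lookup u) (lookup w) (V.map (place c) v)))

      at : ∀ s v → Good (λ n u w → ⟦ value s v n u w ⟧ * g n u w)
      at (inj₁ s) v with lefts (V.map (place c) v)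
      ... | just v′ = good-left (R s v′) G
      ... | nothing = good-zero
      at (inj₂ s) v with rights (V.map (place c) v)
      ... | just v′ = good-right (R s v′) G
      ... | nothing = good-zero
    good-sat {φ = neg φ} (neg q) G = good-not (λ n u w → sat (A n ⊕ B n) φ (env n u w)) G (good-sat q G)
    good-sat {φ = conj φ ψ} {g} (conj q r) G = good-cong
      (λ n u w → trans (sym (ℕₚ.*-assoc ⟦ sat (A n ⊕ B n) φ (env n u w) ⟧ _ _))
        (cong (_* g n u w) (sym (⟦∧⟧ (sat (A n ⊕ B n) φ (env n u w)) _)))) (good-sat q (good-sat r G))

  ⊕-strongPol : StrongPol (λ n → A n ⊕ B n)
  ⊕-strongPol {p} {φ} q = poly-cong (λ n → sym (sumᵛ-merge (m n) (k n) p _))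
    (poly-sumᶜ p _ λ {a} {b} c → poly-cong
      (λ n → sumᵛ-cong (m n) a λ u → sumᵛ-cong (k n) b λ w → trans (ℕₚ.+-identityʳ _) (ℕₚ.*-identityʳ _))
      (good-sat c q (good-one c) tru tru))

-- Tournaments and basic structures

-- newton as N = Σₖ asₖ · (N choose k), defined through its difference equation.
newton : List ℕ → ℕ → ℕ
newton []       N       = 0
newton (a ∷ as) zero    = a
newton (a ∷ as) (suc N) = newton (a ∷ as) N + newton as N

addᴺ : List ℕ → List ℕ → List ℕ
addᴺ []       bs       = bs
addᴺ (a ∷ as) []       = a ∷ as
addᴺ (a ∷ as) (b ∷ bs) = a + b ∷ addᴺ as bs

newton-add : ∀ as bs N → newton (addᴺ as bs) N ≡ newton as N + newton bs N
newton-add []       bs       N       = refl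
newton-add (a ∷ as) []       N       = sym (ℕₚ.+-identityʳ _)
newton-add (a ∷ as) (b ∷ bs) zero    = refl
newton-add (a ∷ as) (b ∷ bs) (suc N) =
  trans (cong₂ _+_ (newton-add (a ∷ as) (b ∷ bs) N) (newton-add as bs N))
    (interchange (newton (a ∷ as) N) (newton (b ∷ bs) N) (newton as N) (newton bs N))
  where
  interchange : ∀ w x y z → w + x + (y + z) ≡ w + y + (x + z)
  interchange = solve-∀

binomial : ℕ → ℕ → ℕ
binomial zero    N       = 1
binomial (suc k) zero    = 0
binomial (suc k) (suc N) = binomial (suc k) N + binomial k N

-- The absorption identity (k+1)·C(N,k+1) = (N-k)·C(N,k), with the subtraction moved to the other
-- side. It reduces each binomial coefficient to the preceding one.
binomial-absorb : ∀ k N → suc k * binomial (suc k) N + k * binomial k N ≡ N * binomial k N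
binomial-absorb zero    zero    = refl
binomial-absorb (suc k) zero    = cong₂ _+_ (ℕₚ.*-zeroʳ (suc (suc k))) (ℕₚ.*-zeroʳ (suc k))
binomial-absorb zero    (suc N) = trans (rearrange (binomial 1 N)) (cong suc (binomial-absorb zero N))
  where
  rearrange : ∀ x → 1 * (x + 1) + 0 ≡ suc (1 * x + 0)
  rearrange = solve-∀
binomial-absorb (suc k) (suc N) = begin
  suc (suc k) * (c + b) + suc k * (b + a)
    ≡⟨ regroup k a b c ⟩
  (suc (suc k) * c + suc k * b) + (suc k * b + k * a) + (b + a)
    ≡⟨ cong₂ (λ x y → x + y + (b + a)) (binomial-absorb (suc k) N) (binomial-absorb k N) ⟩
  N * b + N * a + (b + a)
    ≡⟨ collect N a b ⟩
  suc N * (b + a) ∎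
  where
  a = binomial k N
  b = binomial (suc k) N
  c = binomial (suc (suc k)) N
  regroup : ∀ k a b c → suc (suc k) * (c + b) + suc k * (b + a) ≡
    (suc (suc k) * c + suc k * b) + (suc k * b + k * a) + (b + a)
  regroup = solve-∀
  collect : ∀ N a b → N * b + N * a + (b + a) ≡ suc N * (b + a)
  collect = solve-∀

poly-binomial : ∀ {h} → Pol h → ∀ k → Pol (λ n → binomial k (h n))
poly-binomial H zero    = poly-const 1
poly-binomial {h} H (suc k) = poly-÷ k (poly-difference
  (λ n → trans (sym (binomial-absorb k (h n))) (ℕₚ.+-comm (suc k * binomial (suc k) (h n)) _))
  (poly-* H (poly-binomial H k)) (poly-* (poly-const k) (poly-binomial H k)))

binomialSum : ℕ → List ℕ → ℕ → ℕ
binomialSum k []       N = 0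
binomialSum k (a ∷ as) N = a * binomial k N + binomialSum (suc k) as N

binomialSum-zero : ∀ k as → binomialSum (suc k) as 0 ≡ 0
binomialSum-zero k []       = refl
binomialSum-zero k (a ∷ as) = cong₂ _+_ (ℕₚ.*-zeroʳ a) (binomialSum-zero (suc k) as)

-- Pascal's rule in each term: taking differences lowers the offset `k` by one, which matches the
-- recursion of `newton`.
binomialSum-suc : ∀ k as N → binomialSum (suc k) as (suc N) ≡ binomialSum (suc k) as N + binomialSum k as N
binomialSum-suc k []       N = refl
binomialSum-suc k (a ∷ as) N = trans (cong (a * (binomial (suc k) N + binomial k N) +_) (binomialSum-suc (suc k) as N))
  (distribute a (binomial (suc k) N) (binomial k N) (binomialSum (suc (suc k)) as N) (binomialSum (suc k) as N))
  where
  distribute : ∀ a x y u v → a * (x + y) + (u + v) ≡ a * x + u + (a * y + v)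
  distribute = solve-∀

newton≡binomialSum : ∀ as N → newton as N ≡ binomialSum 0 as N
newton≡binomialSum []       N       = refl
newton≡binomialSum (a ∷ as) zero    =
  sym (trans (cong (a * 1 +_) (binomialSum-zero 0 as)) (trans (ℕₚ.+-identityʳ _) (ℕₚ.*-identityʳ a)))
newton≡binomialSum (a ∷ as) (suc N) = begin
  newton (a ∷ as) N + newton as N
    ≡⟨ cong₂ _+_ (newton≡binomialSum (a ∷ as) N) (newton≡binomialSum as N) ⟩
  a * 1 + binomialSum 1 as N + binomialSum 0 as N
    ≡⟨ ℕₚ.+-assoc (a * 1) _ _ ⟩
  a * 1 + (binomialSum 1 as N + binomialSum 0 as N)
    ≡⟨ cong (a * 1 +_) (sym (binomialSum-suc 0 as N)) ⟩
  a * 1 + binomialSum 1 as (suc N) ∎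

poly-binomialSum : ∀ {h} → Pol h → ∀ k as → Pol (λ n → binomialSum k as (h n))
poly-binomialSum H k []       = poly-const 0
poly-binomialSum H k (a ∷ as) = poly-+ (poly-* (poly-const a) (poly-binomial H k)) (poly-binomialSum H (suc k) as)

Newton : (ℕ → ℕ) → Set
Newton f = ∃ λ as → ∀ N → f N ≡ newton as N

newton-pol : ∀ {f h} → Newton f → Pol h → Pol (λ n → f (h n))
newton-pol {f} {h} (as , e) H =
  poly-cong (λ n → sym (trans (e (h n)) (newton≡binomialSum as (h n)))) (poly-binomialSum H 0 as)

newton-+ : ∀ {f g} → Newton f → Newton g → Newton (λ N → f N + g N)
newton-+ (as , e) (bs , e′) = addᴺ as bs , λ N → trans (cong₂ _+_ (e N) (e′ N)) (sym (newton-add as bs N))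

newton-zero : Newton (λ _ → 0)
newton-zero = [] , λ N → refl

-- Prepending the initial value inverts the difference operator on lists of Newton coefficients.
newton-difference : ∀ {f d} → (∀ N → f (suc N) ≡ f N + d N) → Newton d → Newton f
newton-difference {f} {d} e (as , e′) = f 0 ∷ as , go
  where
  go : ∀ N → f N ≡ newton (f 0 ∷ as) N
  go zero    = refl
  go (suc N) = trans (e N) (cong₂ _+_ (go N) (e′ N))

allʳ : ∀ p → Choice p 0 p
allʳ zero    = done
allʳ (suc p) = goesʳ (allʳ p)

place-allʳ : ∀ p i → place (allʳ p) i ≡ inj₂ i
place-allʳ (suc p) zero    = refl
place-allʳ (suc p) (suc i) = cong (Sum.map id suc) (place-allʳ p i)

choice-≤ : ∀ {p a b} → Choice p a b → b ≤ p
choice-≤ done      = z≤n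
choice-≤ (goesˡ c) = ℕₚ.m≤n⇒m≤1+n (choice-≤ c)
choice-≤ (goesʳ c) = s≤s (choice-≤ c)

-- The sum over all choices except `allʳ p`. In each of them some coordinate goes left, so fewer
-- than `p` remain on the right.
sumᶜ⁻ : ∀ p → (∀ {a b} → Choice p a b → ℕ) → ℕ
sumᶜ⁻ zero    f = 0
sumᶜ⁻ (suc p) f = sumᶜ p (f ∘ goesˡ) + sumᶜ⁻ p (f ∘ goesʳ)

sumᶜ-allʳ : ∀ p (f : ∀ {a b} → Choice p a b → ℕ) → sumᶜ p f ≡ f (allʳ p) + sumᶜ⁻ p f
sumᶜ-allʳ zero    f = sym (ℕₚ.+-identityʳ _)
sumᶜ-allʳ (suc p) f = trans (cong (sumᶜ p (f ∘ goesˡ) +_) (sumᶜ-allʳ p (f ∘ goesʳ)))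
  (shuffle (sumᶜ p (f ∘ goesˡ)) (f (goesʳ (allʳ p))) (sumᶜ⁻ p (f ∘ goesʳ)))
  where
  shuffle : ∀ x y z → x + (y + z) ≡ y + (x + z)
  shuffle = solve-∀

newton-sumᶜ : ∀ p (f : ∀ {a b} → Choice p a b → ℕ → ℕ) → (∀ {a b} (c : Choice p a b) → Newton (f c)) →
  Newton (λ N → sumᶜ p (λ c → f c N))
newton-sumᶜ zero    f P = P done
newton-sumᶜ (suc p) f P = newton-+ (newton-sumᶜ p (f ∘ goesˡ) (P ∘ goesˡ)) (newton-sumᶜ p (f ∘ goesʳ) (P ∘ goesʳ))

newton-sumᶜ⁻ : ∀ p (f : ∀ {a b} → Choice p a b → ℕ → ℕ) →
  (∀ {a b} (c : Choice p a b) → b < p → Newton (f c)) → Newton (λ N → sumᶜ⁻ p (λ c → f c N))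
newton-sumᶜ⁻ zero    f P = newton-zero
newton-sumᶜ⁻ (suc p) f P = newton-+ (newton-sumᶜ p (f ∘ goesˡ) λ c → P (goesˡ c) (s≤s (choice-≤ c)))
  (newton-sumᶜ⁻ p (f ∘ goesʳ) λ c b<p → P (goesʳ c) (s≤s b<p))

sumᵛ-1 : ∀ a (f : Vec (Fin 1) a → ℕ) → sumᵛ 1 a f ≡ f (V.replicate a zero)
sumᵛ-1 zero    f = refl
sumᵛ-1 (suc a) f = trans (ℕₚ.+-identityʳ _) (sumᵛ-1 a (f ∘ (zero ∷_)))

-- Formulas over T (suc N) in which the coordinates chosen by the left part of a choice
-- are the least element and the others range over the remaining copy of T N.
module _ {p a b : ℕ} (c : Choice p a b) where

  lowerEq : Fin a ⊎ Fin b → Fin a ⊎ Fin b → Formula TSig b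
  lowerEq (inj₁ _) (inj₁ _) = tru
  lowerEq (inj₂ x) (inj₂ y) = eq x y
  lowerEq _        _        = neg tru

  lowerS : Fin a ⊎ Fin b → Fin a ⊎ Fin b → Formula TSig b
  lowerS (inj₁ _) (inj₂ _) = tru
  lowerS (inj₂ x) (inj₂ y) = R S (x ∷ y ∷ [])
  lowerS _        _        = neg tru

  lower : Formula TSig p → Formula TSig b
  lower tru                  = tru
  lower (eq i j)             = lowerEq (place c i) (place c j)
  lower (R U v)              = tru
  lower (R S (i ∷ j ∷ []))   = lowerS (place c i) (place c j)
  lower (neg φ)              = neg (lower φ)
  lower (conj φ ψ)           = conj (lower φ) (lower ψ)
  lower (ex φ)               = tru

  lowerEq-QF : ∀ x y → IsQF (lowerEq x y)
  lowerEq-QF (inj₁ _) (inj₁ _) = tru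
  lowerEq-QF (inj₂ x) (inj₂ y) = eq x y
  lowerEq-QF (inj₁ _) (inj₂ _) = neg tru
  lowerEq-QF (inj₂ _) (inj₁ _) = neg tru

  lowerS-QF : ∀ x y → IsQF (lowerS x y)
  lowerS-QF (inj₁ _) (inj₂ _) = tru
  lowerS-QF (inj₂ x) (inj₂ y) = R S (x ∷ y ∷ [])
  lowerS-QF (inj₁ _) (inj₁ _) = neg tru
  lowerS-QF (inj₂ _) (inj₁ _) = neg tru

  lower-QF : ∀ {φ} → IsQF φ → IsQF (lower φ)
  lower-QF tru                = tru
  lower-QF (eq i j)           = lowerEq-QF (place c i) (place c j)
  lower-QF (R U v)            = tru
  lower-QF (R S (i ∷ j ∷ [])) = lowerS-QF (place c i) (place c j)
  lower-QF (neg q)            = neg (lower-QF q)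
  lower-QF (conj q r)         = conj (lower-QF q) (lower-QF r)

  module _ (N : ℕ) (w : Vec (Fin N) b) where

    lowEnv : Vec (Fin (suc N)) p
    lowEnv = V.map (join 1 N) (merge c (V.replicate a zero) w)

    position : Fin a ⊎ Fin b → Fin (suc N)
    position (inj₁ _) = zero
    position (inj₂ j) = suc (lookup w j)

    lookup-lowEnv : ∀ i → lookup lowEnv i ≡ position (place c i)
    lookup-lowEnv i = trans (Vₚ.lookup-map i (join 1 N) (merge c (V.replicate a zero) w))
      (trans (cong (join 1 N) (lookup-merge c (V.replicate a zero) w i)) (at (place c i)))
      where
      at : ∀ x → join 1 N (Sum.map (lookup (V.replicate a zero)) (lookup w) x) ≡ position x
      at (inj₁ x) rewrite Vₚ.lookup-replicate {A = Fin 1} x zero = refl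
      at (inj₂ y) = refl

    sat-lowerEq : ∀ x y → sat (T N) (lowerEq x y) w ≡ ⌊ position x Fin.≟ position y ⌋
    sat-lowerEq (inj₁ _) (inj₁ _) = refl
    sat-lowerEq (inj₁ _) (inj₂ _) = refl
    sat-lowerEq (inj₂ _) (inj₁ _) = refl
    sat-lowerEq (inj₂ x) (inj₂ y) = ≟-injection suc Finₚ.suc-injective (lookup w x) (lookup w y)

    sat-lowerS : ∀ x y → sat (T N) (lowerS x y) w ≡ rel (T (suc N)) S (position x ∷ position y ∷ [])
    sat-lowerS (inj₁ _) (inj₁ _) = refl
    sat-lowerS (inj₁ _) (inj₂ _) = refl
    sat-lowerS (inj₂ _) (inj₁ _) = refl
    sat-lowerS (inj₂ x) (inj₂ y) = refl

    sat-lower : ∀ {φ} → IsQF φ → sat (T N) (lower φ) w ≡ sat (T (suc N)) φ lowEnv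
    sat-lower tru                = refl
    sat-lower (eq i j)           = trans (sat-lowerEq (place c i) (place c j))
      (sym (cong₂ (λ x y → ⌊ x Fin.≟ y ⌋) (lookup-lowEnv i) (lookup-lowEnv j)))
    sat-lower (R U v)            = refl
    sat-lower (R S (i ∷ j ∷ [])) = trans (sat-lowerS (place c i) (place c j))
      (sym (cong₂ (λ x y → rel (T (suc N)) S (x ∷ y ∷ [])) (lookup-lowEnv i) (lookup-lowEnv j)))
    sat-lower (neg q)            = cong not (sat-lower q)
    sat-lower (conj q r)         = cong₂ _∧_ (sat-lower q) (sat-lower r)

sat-lower-allʳ : ∀ {p φ} N w → IsQF φ → sat (T N) (lower (allʳ p) φ) w ≡ sat (T N) φ w
sat-lower-allʳ {p} N w tru      = refl
sat-lower-allʳ {p} N w (eq i j) rewrite place-allʳ p i | place-allʳ p j = refl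
sat-lower-allʳ {p} N w (R U v)  = refl
sat-lower-allʳ {p} N w (R S (i ∷ j ∷ [])) rewrite place-allʳ p i | place-allʳ p j = refl
sat-lower-allʳ {p} N w (neg q)    = cong not (sat-lower-allʳ N w q)
sat-lower-allʳ {p} N w (conj q r) = cong₂ _∧_ (sat-lower-allʳ N w q) (sat-lower-allʳ N w r)

-- `T (suc N)` is its least element followed by a copy of `T N`. Tuples avoiding the least element
-- give back the count in `T N`; all the others contribute to the increment.
#sat-T-suc : ∀ {p} {φ : Formula TSig p} → IsQF φ → ∀ N →
  #sat φ (T (suc N)) ≡ #sat φ (T N) + sumᶜ⁻ p (λ c → #sat (lower c φ) (T N))
#sat-T-suc {p} {φ} q N = begin
  #sat φ (T (suc N))
    ≡⟨ sumᵛ-merge 1 N p _ ⟩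
  sumᶜ p (λ {a} {b} c → sumᵛ 1 a λ u → sumᵛ N b λ w → ⟦ sat (T (suc N)) φ (V.map (join 1 N) (merge c u w)) ⟧)
    ≡⟨ sumᶜ-cong p (λ {a} {b} c → trans (sumᵛ-1 a _)
         (sumᵛ-cong N b λ w → cong ⟦_⟧ (sym (sat-lower c N w q)))) ⟩
  sumᶜ p (λ c → #sat (lower c φ) (T N))
    ≡⟨ sumᶜ-allʳ p (λ c → #sat (lower c φ) (T N)) ⟩
  #sat (lower (allʳ p) φ) (T N) + sumᶜ⁻ p (λ c → #sat (lower c φ) (T N))
    ≡⟨ cong (_+ sumᶜ⁻ p (λ c → #sat (lower c φ) (T N))) (sumᵛ-cong N p λ w → cong ⟦_⟧ (sat-lower-allʳ N w q)) ⟩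
  #sat φ (T N) + sumᶜ⁻ p (λ c → #sat (lower c φ) (T N)) ∎

-- The recursion is on the bound `k` for the number of variables, since the formulas `lower c φ` are
-- not subformulas of `φ`. Without variables the increment is the empty sum.
#sat-T-newton : ∀ k {p} → p ≤ k → {φ : Formula TSig p} → IsQF φ → Newton (λ N → #sat φ (T N))
#sat-T-newton zero    {zero} p≤k q = newton-difference (#sat-T-suc q) newton-zero
#sat-T-newton (suc k) {p} p≤k q = newton-difference (#sat-T-suc q)
  (newton-sumᶜ⁻ p _ λ c b<p → #sat-T-newton k (ℕₚ.≤-pred (ℕₚ.≤-trans b<p p≤k)) (lower-QF c q))

T-strongPol : ∀ {h} → Pol h → StrongPol (λ n → T (h n))
T-strongPol H {p} q = newton-pol (#sat-T-newton p ℕₚ.≤-refl q) H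

const-strongPol : ∀ {σ} (A : Structure σ) → StrongPol (λ _ → A)
const-strongPol A {φ = φ} q = poly-const (#sat φ A)

basicT-strongPol : ∀ k (N : Fin k → ℕ → ℕ) → (∀ i → Pol (N i)) → StrongPol (λ n → basicT k (λ i → N i n))
basicT-strongPol zero    N P = const-strongPol ∅Str
basicT-strongPol (suc k) N P = ⊕-strongPol _ _ (λ n → T-leftSummand (N zero n))
  (T-strongPol (P zero)) (basicT-strongPol k (N ∘ suc) (P ∘ suc))

basic-strongPol : ∀ k ℓ (N : Fin k → ℕ → ℕ) → (∀ i → Pol (N i)) → StrongPol (λ n → basic k ℓ (λ i → N i n))
basic-strongPol k zero    N P = basicT-strongPol k N P
basic-strongPol k (suc ℓ) N P = ⊕-strongPol _ _ (λ n → E-leftSummand) (const-strongPol E) (basic-strongPol k ℓ N P)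

condition3⇒stronglyPolynomial : ∀ A → Condition3 A → StronglyPolynomial (λ n → str (A n))
condition3⇒stronglyPolynomial A (k , ℓ , N , sizes , p , I , qf , iso) = fromStrongPol λ {m} {φ} q →
  poly-cong (λ n → sym (#sat-iso (str (A n)) _ (iso n) q))
    (interpret-strongPol I qf (basic-strongPol k ℓ N λ i → pol (proj₁ (sizes i) , proj₂ (proj₂ (sizes i)))) q)

-- Disjoint unions up to isomorphism

-- With arbitrary vertex types, disjoint unions are sums and dependent sums of types, and no
-- arithmetic on indices is involved.
record Net : Set₁ where
  field
    Vertex : Set
    edge   : Vertex → Vertex → Bool
open Net public

infix 4 _≅_

record _≅_ (X Y : Net) : Set where
  field
    to      : Vertex X → Vertex Y
    from    : Vertex Y → Vertex X
    from-to : ∀ x → from (to x) ≡ x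
    to-from : ∀ y → to (from y) ≡ y
    to-edge : ∀ x y → edge X x y ≡ edge Y (to x) (to y)

≅-refl : ∀ {X} → X ≅ X
≅-refl = record
  { to = id ; from = id ; from-to = λ _ → refl ; to-from = λ _ → refl ; to-edge = λ _ _ → refl }

≅-sym : ∀ {X Y} → X ≅ Y → Y ≅ X
≅-sym {X} {Y} f = record
  { to = from ; from = to ; from-to = to-from ; to-from = from-to
  ; to-edge = λ x y → sym (trans (to-edge (from x) (from y)) (cong₂ (edge Y) (to-from x) (to-from y))) }
  where open _≅_ f

≅-trans : ∀ {X Y Z} → X ≅ Y → Y ≅ Z → X ≅ Z
≅-trans f g = record
  { to      = G.to ∘ F.to
  ; from    = F.from ∘ G.from
  ; from-to = λ x → trans (cong F.from (G.from-to (F.to x))) (F.from-to x)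
  ; to-from = λ z → trans (cong G.to (F.to-from (G.from z))) (G.to-from z)
  ; to-edge = λ x y → trans (F.to-edge x y) (G.to-edge (F.to x) (F.to y)) }
  where
  module F = _≅_ f
  module G = _≅_ g

⟨_⟩ : Structure GraphSig → Net
⟨ A ⟩ = record { Vertex = Fin (size A) ; edge = adj A }

≅⇒Iso : ∀ A B → ⟨ A ⟩ ≅ ⟨ B ⟩ → Iso A B
≅⇒Iso A B f = mk↔ₛ′ to from to-from from-to , λ { tt (x ∷ y ∷ []) → to-edge x y }
  where open _≅_ f

Iso⇒≅ : ∀ A B → Iso A B → ⟨ A ⟩ ≅ ⟨ B ⟩
Iso⇒≅ A B (π , h) = record
  { to = Inverse.to π ; from = Inverse.from π
  ; from-to = Inverse.strictlyInverseʳ π ; to-from = Inverse.strictlyInverseˡ π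
  ; to-edge = λ x y → h tt (x ∷ y ∷ []) }

∅ᴺ : Net
∅ᴺ = record { Vertex = ⊥ ; edge = λ () }

edge⊎ : ∀ X Y → Vertex X ⊎ Vertex Y → Vertex X ⊎ Vertex Y → Bool
edge⊎ X Y (inj₁ x) (inj₁ y) = edge X x y
edge⊎ X Y (inj₂ x) (inj₂ y) = edge Y x y
edge⊎ X Y (inj₁ _) (inj₂ _) = false
edge⊎ X Y (inj₂ _) (inj₁ _) = false

_⊎ᴺ_ : Net → Net → Net
X ⊎ᴺ Y = record { Vertex = Vertex X ⊎ Vertex Y ; edge = edge⊎ X Y }

⊎ᴺ-cong : ∀ {X X′ Y Y′} → X ≅ X′ → Y ≅ Y′ → X ⊎ᴺ Y ≅ X′ ⊎ᴺ Y′
⊎ᴺ-cong f g = record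
  { to      = Sum.map F.to G.to
  ; from    = Sum.map F.from G.from
  ; from-to = λ { (inj₁ x) → cong inj₁ (F.from-to x) ; (inj₂ y) → cong inj₂ (G.from-to y) }
  ; to-from = λ { (inj₁ x) → cong inj₁ (F.to-from x) ; (inj₂ y) → cong inj₂ (G.to-from y) }
  ; to-edge = λ { (inj₁ x) (inj₁ y) → F.to-edge x y ; (inj₂ x) (inj₂ y) → G.to-edge x y
                ; (inj₁ _) (inj₂ _) → refl ; (inj₂ _) (inj₁ _) → refl } }
  where
  module F = _≅_ f
  module G = _≅_ g

⊎ᴺ-assoc : ∀ X Y Z → X ⊎ᴺ (Y ⊎ᴺ Z) ≅ (X ⊎ᴺ Y) ⊎ᴺ Z
⊎ᴺ-assoc X Y Z = record
  { to = Sum.assocˡ ; from = Sum.assocʳ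
  ; from-to = λ { (inj₁ _) → refl ; (inj₂ (inj₁ _)) → refl ; (inj₂ (inj₂ _)) → refl }
  ; to-from = λ { (inj₁ (inj₁ _)) → refl ; (inj₁ (inj₂ _)) → refl ; (inj₂ _) → refl }
  ; to-edge = λ { (inj₁ _) (inj₁ _) → refl ; (inj₁ _) (inj₂ (inj₁ _)) → refl ; (inj₁ _) (inj₂ (inj₂ _)) → refl
                ; (inj₂ (inj₁ _)) (inj₁ _) → refl ; (inj₂ (inj₁ _)) (inj₂ (inj₁ _)) → refl
                ; (inj₂ (inj₁ _)) (inj₂ (inj₂ _)) → refl ; (inj₂ (inj₂ _)) (inj₁ _) → refl
                ; (inj₂ (inj₂ _)) (inj₂ (inj₁ _)) → refl ; (inj₂ (inj₂ _)) (inj₂ (inj₂ _)) → refl } }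

⊎ᴺ-comm : ∀ X Y → X ⊎ᴺ Y ≅ Y ⊎ᴺ X
⊎ᴺ-comm X Y = record
  { to = Sum.swap ; from = Sum.swap
  ; from-to = λ { (inj₁ _) → refl ; (inj₂ _) → refl }
  ; to-from = λ { (inj₁ _) → refl ; (inj₂ _) → refl }
  ; to-edge = λ { (inj₁ _) (inj₁ _) → refl ; (inj₁ _) (inj₂ _) → refl
                ; (inj₂ _) (inj₁ _) → refl ; (inj₂ _) (inj₂ _) → refl } }

⟨⊎ᴳ⟩ : ∀ G H → ⟨ str (G ⊎ᴳ H) ⟩ ≅ ⟨ str G ⟩ ⊎ᴺ ⟨ str H ⟩
⟨⊎ᴳ⟩ G H = record
  { to = splitAt m ; from = join m k
  ; from-to = Finₚ.join-splitAt m k ; to-from = Finₚ.splitAt-join m k ; to-edge = edges }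
  where
  m = size (str G)
  k = size (str H)
  edges : ∀ x y → adj (str (G ⊎ᴳ H)) x y ≡ edge⊎ ⟨ str G ⟩ ⟨ str H ⟩ (splitAt m x) (splitAt m y)
  edges x y with splitAt m x | splitAt m y
  ... | inj₁ _ | inj₁ _ = refl
  ... | inj₂ _ | inj₂ _ = refl
  ... | inj₁ _ | inj₂ _ = refl
  ... | inj₂ _ | inj₁ _ = refl

⟨emptyGraph⟩ : ⟨ str emptyGraph ⟩ ≅ ∅ᴺ
⟨emptyGraph⟩ = record
  { to = λ () ; from = λ () ; from-to = λ () ; to-from = λ () ; to-edge = λ () }

-- Recursion on both indices avoids transporting a vertex along a proof that they are equal.
edgeΣ : ∀ {k} (X : Fin k → Net) i → Vertex (X i) → ∀ j → Vertex (X j) → Bool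
edgeΣ X zero    x zero    y = edge (X zero) x y
edgeΣ X zero    x (suc j) y = false
edgeΣ X (suc i) x zero    y = false
edgeΣ X (suc i) x (suc j) y = edgeΣ (X ∘ suc) i x j y

edgeΣ-refl : ∀ {k} (X : Fin k → Net) i x y → edgeΣ X i x i y ≡ edge (X i) x y
edgeΣ-refl X zero    x y = refl
edgeΣ-refl X (suc i) x y = edgeΣ-refl (X ∘ suc) i x y

edgeΣ⇒≡ : ∀ {k} (X : Fin k → Net) i x j y → edgeΣ X i x j y ≡ true → i ≡ j
edgeΣ⇒≡ X zero    x zero    y e = refl
edgeΣ⇒≡ X (suc i) x (suc j) y e = cong suc (edgeΣ⇒≡ (X ∘ suc) i x j y e)

Σᴺ : ∀ {k} → (Fin k → Net) → Net
Σᴺ {k} X = record { Vertex = Σ[ i ∈ Fin k ] Vertex (X i) ; edge = λ (i , x) (j , y) → edgeΣ X i x j y }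

Σᴺ-zero : (X : Fin 0 → Net) → ∅ᴺ ≅ Σᴺ X
Σᴺ-zero X = record
  { to = λ () ; from = λ () ; from-to = λ () ; to-from = λ () ; to-edge = λ () }

Σᴺ-suc : ∀ {k} (X : Fin (suc k) → Net) → X zero ⊎ᴺ Σᴺ (X ∘ suc) ≅ Σᴺ X
Σᴺ-suc X = record
  { to      = λ { (inj₁ x) → zero , x ; (inj₂ (i , x)) → suc i , x }
  ; from    = λ { (zero , x) → inj₁ x ; (suc i , x) → inj₂ (i , x) }
  ; from-to = λ { (inj₁ x) → refl ; (inj₂ (i , x)) → refl }
  ; to-from = λ { (zero , x) → refl ; (suc i , x) → refl }
  ; to-edge = λ { (inj₁ _) (inj₁ _) → refl ; (inj₁ _) (inj₂ _) → refl
                ; (inj₂ _) (inj₁ _) → refl ; (inj₂ _) (inj₂ _) → refl } }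

copies≅Σ : ∀ c F → ⟨ str (copies c F) ⟩ ≅ Σᴺ {c} (λ _ → ⟨ str F ⟩)
copies≅Σ zero    F = ≅-trans ⟨emptyGraph⟩ (Σᴺ-zero _)
copies≅Σ (suc c) F = ≅-trans (⟨⊎ᴳ⟩ F (copies c F)) (≅-trans (⊎ᴺ-cong ≅-refl (copies≅Σ c F)) (Σᴺ-suc _))

bigUnion≅Σ : ∀ k (G : Fin k → Graph) (X : Fin k → Net) → (∀ i → ⟨ str (G i) ⟩ ≅ X i) →
  ⟨ str (bigUnion k G) ⟩ ≅ Σᴺ X
bigUnion≅Σ zero    G X f = ≅-trans ⟨emptyGraph⟩ (Σᴺ-zero X)
bigUnion≅Σ (suc k) G X f = ≅-trans (⟨⊎ᴳ⟩ (G zero) (bigUnion k (G ∘ suc)))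
  (≅-trans (⊎ᴺ-cong (f zero) (bigUnion≅Σ k (G ∘ suc) (X ∘ suc) (f ∘ suc))) (Σᴺ-suc X))

-- Graphs realised in basic structures

module _ {κ : Signature} {p : ℕ} (I : InterpretationScheme κ GraphSig p) (A : Structure κ) (X : Net)
  (code     : Vertex X → Vec (Fin (size A)) p)
  (code-inj : ∀ {x y} → code x ≡ code y → x ≡ y)
  (sound    : ∀ x → A ⊨ ρ₀ I [ code x ])
  (complete : ∀ v → A ⊨ ρ₀ I [ v ] → ∃ λ x → code x ≡ v)
  (edges    : ∀ x y → edge X x y ≡ sat A (ρ I tt) (V.concat (code x ∷ code y ∷ [])))
  where

  private
    D = solutions (ρ₀ I) A

    index : ∀ x → ∃ λ i → L.lookup D i ≡ code x
    index x = solutions-complete (ρ₀ I) A (code x) (sound x)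

    vertex : ∀ i → ∃ λ x → code x ≡ L.lookup D i
    vertex i = complete (L.lookup D i) (solutions-sound (ρ₀ I) A i)

  -- By `sound` and `complete` the codes are exactly the tuples satisfying `ρ₀`, so the enumeration
  -- of solutions is an enumeration of the vertices of `X`.
  interpret≅ : X ≅ ⟨ interpret I A ⟩
  interpret≅ = record
    { to      = proj₁ ∘ index
    ; from    = proj₁ ∘ vertex
    ; from-to = λ x → code-inj (trans (proj₂ (vertex (proj₁ (index x)))) (proj₂ (index x)))
    ; to-from = λ i → solutions-injective (ρ₀ I) A
        (trans (proj₂ (index (proj₁ (vertex i)))) (proj₂ (vertex i)))
    ; to-edge = λ x y → trans (edges x y) (cong₂ (λ v w → sat A (ρ I tt) (V.concat (v ∷ w ∷ [])))
        (sym (proj₂ (index x))) (sym (proj₂ (index y)))) }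

-- Symbols of β k ℓ only have their arity up to a propositional equality.
Unary : Signature → Set
Unary σ = Σ[ s ∈ Sym σ ] ar σ s ≡ 1

single : ∀ {X : Set} {n} → n ≡ 1 → X → Vec X n
single refl x = x ∷ []

map-single : ∀ {X Y : Set} (f : X → Y) {n} (e : n ≡ 1) x → V.map f (single e x) ≡ single e (f x)
map-single f refl x = refl

rights-single-inj₁ : ∀ {X Y : Set} {n} (e : n ≡ 1) (x : X) → rights {X} {Y} (single e (inj₁ x)) ≡ nothing
rights-single-inj₁ refl x = refl

rights-single-inj₂ : ∀ {X Y : Set} {n} (e : n ≡ 1) (y : Y) → rights {X} {Y} (single e (inj₂ y)) ≡ just (single e y)
rights-single-inj₂ refl y = refl

marked : ∀ {σ} (A : Structure σ) → Unary σ → Fin (size A) → Bool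
marked A (s , e) x = rel A s (single e x)

injʳ : ∀ {σ τ} → Unary τ → Unary (σ ⊕ˢ τ)
injʳ (s , e) = inj₂ s , e

module _ {σ τ : Signature} (A : Structure σ) (B : Structure τ) (u : Unary τ) where

  private
    s = proj₁ u
    e = proj₂ u

    marked-join : ∀ z → marked (A ⊕ B) (injʳ u) (join (size A) (size B) z) ≡
      Maybe.maybe′ (rel B s) false (rights (single e z))
    marked-join z = trans (cong (rel (A ⊕ B) (inj₂ s)) (sym (map-single (join (size A) (size B)) e z)))
      (rel-⊕-inj₂ A B s (single e z))

  marked-↑ʳ : ∀ y → marked (A ⊕ B) (injʳ u) (size A ↑ʳ y) ≡ marked B u y
  marked-↑ʳ y = trans (marked-join (inj₂ y)) (cong (Maybe.maybe′ (rel B s) false) (rights-single-inj₂ e y))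

  marked-↑ˡ : ∀ x → marked (A ⊕ B) (injʳ u) (x ↑ˡ size B) ≡ false
  marked-↑ˡ x = trans (marked-join (inj₁ x)) (cong (Maybe.maybe′ (rel B s) false) (rights-single-inj₁ e x))

markT : ∀ k → Fin k → Unary (βT k)
markT (suc k) zero    = inj₁ U , refl
markT (suc k) (suc i) = injʳ (markT k i)

mark-T : ∀ k ℓ → Fin k → Unary (β k ℓ)
mark-T k zero    i = markT k i
mark-T k (suc ℓ) i = injʳ (mark-T k ℓ i)

mark-E : ∀ k ℓ → Fin ℓ → Unary (β k ℓ)
mark-E k (suc ℓ) zero    = inj₁ tt , refl
mark-E k (suc ℓ) (suc j) = injʳ (mark-E k ℓ j)

elemT : ∀ k (N : Fin k → ℕ) i → Fin (N i) → Fin (size (basicT k N))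
elemT (suc k) N zero    t = t ↑ˡ _
elemT (suc k) N (suc i) t = N zero ↑ʳ elemT k (N ∘ suc) i t

elem-T : ∀ k ℓ (N : Fin k → ℕ) i → Fin (N i) → Fin (size (basic k ℓ N))
elem-T k zero    N i t = elemT k N i t
elem-T k (suc ℓ) N i t = suc (elem-T k ℓ N i t)

elem-E : ∀ k ℓ (N : Fin k → ℕ) → Fin ℓ → Fin (size (basic k ℓ N))
elem-E k (suc ℓ) N zero    = zero
elem-E k (suc ℓ) N (suc j) = suc (elem-E k ℓ N j)

elem-E-injective : ∀ k ℓ N {i j} → elem-E k ℓ N i ≡ elem-E k ℓ N j → i ≡ j
elem-E-injective k (suc ℓ) N {zero}  {zero}  e = refl
elem-E-injective k (suc ℓ) N {suc i} {suc j} e = cong suc (elem-E-injective k ℓ N (Finₚ.suc-injective e))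

elemT-injective : ∀ k N i {t t′} → elemT k N i t ≡ elemT k N i t′ → t ≡ t′
elemT-injective (suc k) N zero    e = Finₚ.↑ˡ-injective _ _ _ e
elemT-injective (suc k) N (suc i) e = elemT-injective k (N ∘ suc) i (Finₚ.↑ʳ-injective (N zero) _ _ e)

elem-T-injective : ∀ k ℓ N i {t t′} → elem-T k ℓ N i t ≡ elem-T k ℓ N i t′ → t ≡ t′
elem-T-injective k zero    N i e = elemT-injective k N i e
elem-T-injective k (suc ℓ) N i e = elem-T-injective k ℓ N i (Finₚ.suc-injective e)

marked-elem-E : ∀ k ℓ N j → marked (basic k ℓ N) (mark-E k ℓ j) (elem-E k ℓ N j) ≡ true
marked-elem-E k (suc ℓ) N zero    = refl
marked-elem-E k (suc ℓ) N (suc j) = trans (marked-↑ʳ E (basic k ℓ N) (mark-E k ℓ j) _) (marked-elem-E k ℓ N j)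

mark-E⇒elem-E : ∀ k ℓ N j y → marked (basic k ℓ N) (mark-E k ℓ j) y ≡ true → y ≡ elem-E k ℓ N j
mark-E⇒elem-E k (suc ℓ) N zero    zero    e = refl
mark-E⇒elem-E k (suc ℓ) N (suc j) zero    e =
  case trans (sym (marked-↑ˡ E (basic k ℓ N) (mark-E k ℓ j) zero)) e of λ ()
mark-E⇒elem-E k (suc ℓ) N (suc j) (suc y) e = cong suc (mark-E⇒elem-E k ℓ N j y
  (trans (sym (marked-↑ʳ E (basic k ℓ N) (mark-E k ℓ j) y)) e))

marked-elemT : ∀ k N i t → marked (basicT k N) (markT k i) (elemT k N i t) ≡ true
marked-elemT (suc k) N zero    t rewrite Finₚ.splitAt-↑ˡ (N zero) t (size (basicT k (N ∘ suc))) = refl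
marked-elemT (suc k) N (suc i) t =
  trans (marked-↑ʳ (T (N zero)) (basicT k (N ∘ suc)) (markT k i) _) (marked-elemT k (N ∘ suc) i t)

marked-elem-T : ∀ k ℓ N i t → marked (basic k ℓ N) (mark-T k ℓ i) (elem-T k ℓ N i t) ≡ true
marked-elem-T k zero    N i t = marked-elemT k N i t
marked-elem-T k (suc ℓ) N i t = trans (marked-↑ʳ E (basic k ℓ N) (mark-T k ℓ i) _) (marked-elem-T k ℓ N i t)

markT⇒elemT : ∀ k N i y → marked (basicT k N) (markT k i) y ≡ true → ∃ λ t → y ≡ elemT k N i t
markT⇒elemT (suc k) N i y e with splitAt (N zero) y in q | Finₚ.join-splitAt (N zero) (size (basicT k (N ∘ suc))) y
markT⇒elemT (suc k) N zero    _ e | inj₁ t | refl = t , refl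
markT⇒elemT (suc k) N zero    _ e | inj₂ z | refl
  rewrite Finₚ.splitAt-↑ʳ (N zero) (size (basicT k (N ∘ suc))) z with () ← e
markT⇒elemT (suc k) N (suc i) _ e | inj₁ t | refl =
  case trans (sym (marked-↑ˡ (T (N zero)) (basicT k (N ∘ suc)) (markT k i) t)) e of λ ()
markT⇒elemT (suc k) N (suc i) _ e | inj₂ z | refl
  with t , r ← markT⇒elemT k (N ∘ suc) i z
    (trans (sym (marked-↑ʳ (T (N zero)) (basicT k (N ∘ suc)) (markT k i) z)) e) = t , cong (N zero ↑ʳ_) r

mark-T⇒elem-T : ∀ k ℓ N i y → marked (basic k ℓ N) (mark-T k ℓ i) y ≡ true → ∃ λ t → y ≡ elem-T k ℓ N i t
mark-T⇒elem-T k zero    N i y       e = markT⇒elemT k N i y e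
mark-T⇒elem-T k (suc ℓ) N i zero    e =
  case trans (sym (marked-↑ˡ E (basic k ℓ N) (mark-T k ℓ i) zero)) e of λ ()
mark-T⇒elem-T k (suc ℓ) N i (suc y) e
  with t , r ← mark-T⇒elem-T k ℓ N i y (trans (sym (marked-↑ʳ E (basic k ℓ N) (mark-T k ℓ i) y)) e) = t , cong suc r

is : ∀ {σ m} → Unary σ → Fin m → Formula σ m
is (s , e) x = R s (single e x)

is-QF : ∀ {σ m} (u : Unary σ) (x : Fin m) → IsQF (is u x)
is-QF (s , e) x = R s (single e x)

⊨-is⇒ : ∀ {σ m} {A : Structure σ} {ρ : Vec _ m} (u : Unary σ) {x} → A ⊨ is u x [ ρ ] → marked A u (lookup ρ x) ≡ true
⊨-is⇒ {A = A} {ρ} (s , e) {x} (sat✓ h) = trans (cong (rel A s) (sym (map-single (lookup ρ) e x))) h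

⊨-is⇐ : ∀ {σ m} {A : Structure σ} {ρ : Vec _ m} (u : Unary σ) {x} → marked A u (lookup ρ x) ≡ true → A ⊨ is u x [ ρ ]
⊨-is⇐ {A = A} {ρ} (s , e) {x} h = sat✓ (trans (cong (rel A s) (map-single (lookup ρ) e x)) h)

false⇒ : ∀ {σ m} {A : Structure σ} {ρ : Vec _ m} {X : Set} → A ⊨ neg tru [ ρ ] → X
false⇒ (sat✓ ())

module Condition2⇒3 (k : ℕ) (F : Fin k → Graph) (c : Fin k → ℕ → ℕ) (cPol : ∀ i → Pol (c i)) where

  Kind : Fin k → Set
  Kind i = (Σ[ Q ∈ Poly ] NonConstant Q × (∀ n → ℕ→ℚ (c i n) ≡ evalPoly Q n)) ⊎ (∀ n → c i n ≡ c i 0)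

  kind : ∀ i → Kind i
  kind i = constant-or-nonconstant (cPol i)

  -- A constant multiplicity is realised by points of ℓ; its tournament gets a dummy size.
  tournament : ∀ {i} → Kind i → ℕ → ℕ
  tournament {i} (inj₁ _) n = c i n
  tournament     (inj₂ _) n = n

  N : Fin k → ℕ → ℕ
  N i = tournament (kind i)

  tournament-polynomial : ∀ {i} (κ : Kind i) →
    ∃ λ Q → NonConstant Q × (∀ n → ℕ→ℚ (tournament κ n) ≡ evalPoly Q n)
  tournament-polynomial (inj₁ q) = q
  tournament-polynomial (inj₂ _) = varPoly , here (λ ()) , evalPoly-var

  -- A common pool of points for the indices of the Fᵢ, for the copies in the case of constant
  -- multiplicity, and for the vertices of each Fᵢ. The three roles may share points, being told
  -- apart by their place in the triple; the sum is a convenient common upper bound.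
  ℓ : ℕ
  ℓ = k + (sum (λ i → c i 0) + sum (λ i → size (str (F i))))

  k≤ℓ : k ≤ ℓ
  k≤ℓ = ℕₚ.m≤m+n k _

  c≤ℓ : ∀ i → c i 0 ≤ ℓ
  c≤ℓ i = ℕₚ.≤-trans (term≤sum (λ i → c i 0) i) (ℕₚ.≤-trans (ℕₚ.m≤m+n _ _) (ℕₚ.m≤n+m _ k))

  F≤ℓ : ∀ i → size (str (F i)) ≤ ℓ
  F≤ℓ i = ℕₚ.≤-trans (term≤sum (λ i → size (str (F i))) i)
    (ℕₚ.≤-trans (ℕₚ.m≤n+m _ (sum (λ i → c i 0))) (ℕₚ.m≤n+m _ k))

  B : ℕ → Structure (β k ℓ)
  B n = basic k ℓ (λ i → N i n)

  point : ∀ n → Fin ℓ → Fin (size (B n))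
  point n = elem-E k ℓ (λ i → N i n)

  isPoint : ∀ {m} → Fin ℓ → Fin m → Formula (β k ℓ) m
  isPoint j = is (mark-E k ℓ j)

  isPoint⇒ : ∀ {n m j} {ρ : Vec (Fin (size (B n))) m} {x} → B n ⊨ isPoint j x [ ρ ] → lookup ρ x ≡ point n j
  isPoint⇒ {j = j} h = mark-E⇒elem-E k ℓ _ j _ (⊨-is⇒ (mark-E k ℓ j) h)

  isPoint⇐ : ∀ {n m j} {ρ : Vec (Fin (size (B n))) m} {x} → lookup ρ x ≡ point n j → B n ⊨ isPoint j x [ ρ ]
  isPoint⇐ {n} {j = j} e = ⊨-is⇐ (mark-E k ℓ j) (trans (cong (marked (B n) (mark-E k ℓ j)) e) (marked-elem-E k ℓ _ j))

  -- The interface common to the two ways of numbering the copies of Fᵢ, by a tournament or by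
  -- points. The formulas for domain and adjacency need only this much.
  record Slots (i : Fin k) : Set where
    field
      slot      : ∀ n → Fin (c i n) → Fin (size (B n))
      slot-inj  : ∀ n {t t′} → slot n t ≡ slot n t′ → t ≡ t′
      isSlot    : ∀ {m} → Fin m → Formula (β k ℓ) m
      isSlot-QF : ∀ {m} (x : Fin m) → IsQF (isSlot x)
      isSlot⇒   : ∀ {n m} {ρ : Vec (Fin (size (B n))) m} {x} → B n ⊨ isSlot x [ ρ ] → ∃ λ t → lookup ρ x ≡ slot n t
      isSlot⇐   : ∀ {n m} {ρ : Vec (Fin (size (B n))) m} {x t} → lookup ρ x ≡ slot n t → B n ⊨ isSlot x [ ρ ]

  -- The equation links the case distinction on `κ` to the tournament size `N i n`, which is defined
  -- through `kind i`.
  slots′ : ∀ i (κ : Kind i) → kind i ≡ κ → Slots i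
  slots′ i (inj₁ q) e = record
    { slot      = λ n t → elem-T k ℓ _ i (Fin.cast (c≡N n) t)
    ; slot-inj  = λ n {t} {t′} h → Finₚ.toℕ-injective (trans (sym (Finₚ.toℕ-cast (c≡N n) t))
        (trans (cong toℕ (elem-T-injective k ℓ _ i h)) (Finₚ.toℕ-cast (c≡N n) t′)))
    ; isSlot    = is (mark-T k ℓ i)
    ; isSlot-QF = is-QF (mark-T k ℓ i)
    ; isSlot⇒   = λ {n} h → let (t , r) = mark-T⇒elem-T k ℓ _ i _ (⊨-is⇒ (mark-T k ℓ i) h) in
        Fin.cast (sym (c≡N n)) t , trans r (cong (elem-T k ℓ _ i)
          (sym (trans (Finₚ.cast-trans (sym (c≡N n)) (c≡N n) t) (Finₚ.cast-is-id refl t))))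
    ; isSlot⇐   = λ {n} h → ⊨-is⇐ (mark-T k ℓ i)
        (trans (cong (marked (B n) (mark-T k ℓ i)) h) (marked-elem-T k ℓ _ i _)) }
    where
    c≡N : ∀ n → c i n ≡ N i n
    c≡N n = cong (λ κ → tournament κ n) (sym e)
  slots′ i (inj₂ const) _ = record
    { slot      = λ n t → point n (place′ n t)
    ; slot-inj  = λ n {t} {t′} h → Finₚ.toℕ-injective (trans (sym (toℕ-place′ n t))
        (trans (cong toℕ (elem-E-injective k ℓ _ h)) (toℕ-place′ n t′)))
    ; isSlot    = λ x → ⋁ (c i 0) λ t → isPoint (Fin.inject≤ t (c≤ℓ i)) x
    ; isSlot-QF = λ x → ⋁-QF (c i 0) λ t → is-QF _ x
    ; isSlot⇒   = λ {n} h → let (t , r) = ⊨-⋁⇒ (c i 0) h in Fin.cast (sym (const n)) t ,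
        trans (isPoint⇒ r) (cong (point n) (cong (λ t → Fin.inject≤ t (c≤ℓ i))
          (sym (trans (Finₚ.cast-trans (sym (const n)) (const n) t) (Finₚ.cast-is-id refl t)))))
    ; isSlot⇐   = λ {n} h → ⊨-⋁⇐ (c i 0) _ (isPoint⇐ h) }
    where
    place′ : ∀ n → Fin (c i n) → Fin ℓ
    place′ n t = Fin.inject≤ (Fin.cast (const n) t) (c≤ℓ i)
    toℕ-place′ : ∀ n t → toℕ (place′ n t) ≡ toℕ t
    toℕ-place′ n t = trans (Finₚ.toℕ-inject≤ _ (c≤ℓ i)) (Finₚ.toℕ-cast (const n) t)

  slots : ∀ i → Slots i
  slots i = slots′ i (kind i) refl

  module _ (i : Fin k) where
    open Slots (slots i) public

  indexPoint : Fin k → Fin ℓ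
  indexPoint i = Fin.inject≤ i k≤ℓ

  vertexPoint : ∀ i → Fin (size (str (F i))) → Fin ℓ
  vertexPoint i v = Fin.inject≤ v (F≤ℓ i)

  copy : ∀ n → Fin k → Net
  copy n i = Σᴺ {c i n} (λ _ → ⟨ str (F i) ⟩)

  code : ∀ n → Vertex (Σᴺ (copy n)) → Vec (Fin (size (B n))) 3
  code n (i , t , v) = point n (indexPoint i) ∷ slot i n t ∷ point n (vertexPoint i v) ∷ []

  inCopy : Fin k → Formula (β k ℓ) 3
  inCopy i = conj (isPoint (indexPoint i) zero) (conj (isSlot i (suc zero))
    (⋁ (size (str (F i))) λ v → isPoint (vertexPoint i v) (suc (suc zero))))

  pattern 3F = suc (suc (suc zero))
  pattern 4F = suc 3F
  pattern 5F = suc 4F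

  -- The adjacency of Fᵢ is not present in the basic structure; it is written into the formula as a
  -- finite table.
  adjacentAs : ∀ i → Fin (size (str (F i))) → Fin (size (str (F i))) → Formula (β k ℓ) 6
  adjacentAs i u v = if adj (str (F i)) u v
    then conj (isPoint (vertexPoint i u) (suc (suc zero))) (isPoint (vertexPoint i v) 5F) else neg tru

  -- Variables 0 to 2 code one vertex and variables 3 to 5 the other; the equation between variables
  -- 1 and 4 says that both lie in the same copy of Fᵢ.
  adjacentIn : Fin k → Formula (β k ℓ) 6
  adjacentIn i = conj (isPoint (indexPoint i) zero) (conj (isPoint (indexPoint i) 3F)
    (conj (eq (suc zero) 4F) (⋁ (size (str (F i))) λ u → ⋁ (size (str (F i))) λ v → adjacentAs i u v)))

  scheme : InterpretationScheme (β k ℓ) GraphSig 3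
  scheme = record { ρ₀ = ⋁ k inCopy ; ρ = λ _ → ⋁ k adjacentIn }

  adjacentAs-QF : ∀ i u v → IsQF (adjacentAs i u v)
  adjacentAs-QF i u v with adj (str (F i)) u v
  ... | true  = conj (is-QF _ _) (is-QF _ _)
  ... | false = neg tru

  scheme-QF : IsQFScheme scheme
  scheme-QF =
    ⋁-QF k (λ i → conj (is-QF _ _) (conj (isSlot-QF i _) (⋁-QF _ λ v → is-QF _ _))) ,
    λ _ → ⋁-QF k λ i → conj (is-QF _ _) (conj (is-QF _ _) (conj (eq _ _)
      (⋁-QF _ λ u → ⋁-QF _ λ v → adjacentAs-QF i u v)))

  indexPoint-inj : ∀ n {i j} → point n (indexPoint i) ≡ point n (indexPoint j) → i ≡ j
  indexPoint-inj n e = Finₚ.inject≤-injective k≤ℓ k≤ℓ _ _ (elem-E-injective k ℓ _ e)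

  vertexPoint-inj : ∀ n i {u v} → point n (vertexPoint i u) ≡ point n (vertexPoint i v) → u ≡ v
  vertexPoint-inj n i e = Finₚ.inject≤-injective (F≤ℓ i) (F≤ℓ i) _ _ (elem-E-injective k ℓ _ e)

  code-injective : ∀ n {x y} → code n x ≡ code n y → x ≡ y
  code-injective n {i , t , v} {j , t′ , v′} e with indexPoint-inj n (cong V.head e)
  ... | refl with slot-inj i n (cong (V.head ∘ V.tail) e)
               | vertexPoint-inj n i (cong (V.head ∘ V.tail ∘ V.tail) e)
  ... | refl | refl = refl

  code-sound : ∀ n x → B n ⊨ ⋁ k inCopy [ code n x ]
  code-sound n (i , t , v) = ⊨-⋁⇐ k i (⊨-conj⇐ (isPoint⇐ refl)
    (⊨-conj⇐ (isSlot⇐ i refl) (⊨-⋁⇐ _ v (isPoint⇐ refl))))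

  code-complete : ∀ n w → B n ⊨ ⋁ k inCopy [ w ] → ∃ λ x → code n x ≡ w
  code-complete n (x ∷ y ∷ z ∷ []) h
    with i , h₁ ← ⊨-⋁⇒ k h
    with p , h₂ ← ⊨-conj⇒ h₁
    with q , h₃ ← ⊨-conj⇒ h₂
    with t , r ← isSlot⇒ i q | v , s ← ⊨-⋁⇒ _ h₃ =
    (i , t , v) , sym (cong₂ _∷_ (isPoint⇒ p) (cong₂ _∷_ r (cong (_∷ []) (isPoint⇒ s))))

  edge⇒ : ∀ n x y → edge (Σᴺ (copy n)) x y ≡ true → B n ⊨ ⋁ k adjacentIn [ code n x V.++ code n y V.++ [] ]
  edge⇒ n (i , t , u) (j , t′ , v) e with edgeΣ⇒≡ (copy n) i (t , u) j (t′ , v) e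
  ... | refl
    with e′ ← trans (sym (edgeΣ-refl (copy n) i (t , u) (t′ , v))) e
    with edgeΣ⇒≡ {c i n} (λ _ → ⟨ str (F i) ⟩) t u t′ v e′
  ... | refl =
    ⊨-⋁⇐ k i (⊨-conj⇐ (isPoint⇐ refl) (⊨-conj⇐ (isPoint⇐ refl) (⊨-conj⇐ (⊨-eq⇐ refl)
      (⊨-⋁⇐ _ u (⊨-⋁⇐ _ v (adjacent refl refl (trans (sym (edgeΣ-refl {c i n} (λ _ → ⟨ str (F i) ⟩) t u v)) e′)))))))
    where
    adjacent : ∀ {ρ} → lookup ρ (suc (suc zero)) ≡ point n (vertexPoint i u) →
      lookup ρ 5F ≡ point n (vertexPoint i v) → adj (str (F i)) u v ≡ true → B n ⊨ adjacentAs i u v [ ρ ]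
    adjacent p q a rewrite a = ⊨-conj⇐ (isPoint⇐ p) (isPoint⇐ q)

  edge⇐ : ∀ n x y → B n ⊨ ⋁ k adjacentIn [ code n x V.++ code n y V.++ [] ] → edge (Σᴺ (copy n)) x y ≡ true
  edge⇐ n (i , t , u) (j , t′ , v) h
    with i₀ , h₁ ← ⊨-⋁⇒ k h
    with p , h₂ ← ⊨-conj⇒ h₁
    with q , h₃ ← ⊨-conj⇒ h₂
    with r , h₄ ← ⊨-conj⇒ h₃
    with refl ← indexPoint-inj n (isPoint⇒ p) | refl ← indexPoint-inj n (isPoint⇒ q)
    with refl ← slot-inj i n (⊨-eq⇒ r)
    with u₀ , h₅ ← ⊨-⋁⇒ _ h₄
    with v₀ , h₆ ← ⊨-⋁⇒ _ h₅
    with adj (str (F i)) u₀ v₀ in a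
  ... | false = false⇒ h₆
  ... | true with s , s′ ← ⊨-conj⇒ h₆
    with refl ← vertexPoint-inj n i (isPoint⇒ s) | refl ← vertexPoint-inj n i (isPoint⇒ s′) =
    trans (edgeΣ-refl (copy n) i (t , u) (t , v))
      (trans (edgeΣ-refl {c i n} (λ _ → ⟨ str (F i) ⟩) t u v) a)

  realise : ∀ n → Σᴺ (copy n) ≅ ⟨ interpret scheme (B n) ⟩
  realise n = interpret≅ scheme (B n) (Σᴺ (copy n)) (code n) (code-injective n) (code-sound n) (code-complete n)
    λ x y → true-iff (λ e → sat≡true (edge⇒ n x y e)) (λ e → edge⇐ n x y (sat✓ e))

condition2⇒condition3 : ∀ A → Condition2 A → Condition3 A
condition2⇒condition3 A (k , F , c , cPol , iso) =
  k , C.ℓ , C.N , (λ i → C.tournament-polynomial (C.kind i)) , 3 , C.scheme , C.scheme-QF , λ n →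
  ≅⇒Iso (str (A n)) (interpret C.scheme (C.B n)) (≅-trans
    (Iso⇒≅ (str (A n)) (str (bigUnion k (λ i → copies (c i n) (F i)))) (iso n))
    (≅-trans (bigUnion≅Σ k _ (C.copy n) (λ i → copies≅Σ (c i n) (F i))) (C.realise n)))
  where module C = Condition2⇒3 k F c (λ i → pol (cPol i))

-- Vanishing of slowly growing polynomials

-- Horner form with d integer coefficients.
IsZPoly : ℕ → (ℕ → ℤ) → Set
IsZPoly zero    f = ∀ x → f x ≡ ℤ.0ℤ
IsZPoly (suc d) f = Σ[ z ∈ ℤ ] Σ[ g ∈ (ℕ → ℤ) ] IsZPoly d g × (∀ x → f x ≡ z ℤ.+ ℤ.+ x ℤ.* g x)

zpoly-weaken : ∀ d {f} → IsZPoly d f → IsZPoly (suc d) f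
zpoly-weaken zero    F = ℤ.0ℤ , (λ _ → ℤ.0ℤ) , (λ _ → refl) ,
  λ x → trans (F x) (sym (trans (ℤₚ.+-identityˡ _) (ℤₚ.*-zeroʳ (ℤ.+ x))))
zpoly-weaken (suc d) (z , g , G , e) = z , g , zpoly-weaken d G , e

zpoly-+ : ∀ d {f g} → IsZPoly d f → IsZPoly d g → IsZPoly d (λ x → f x ℤ.+ g x)
zpoly-+ zero    F G = λ x → cong₂ ℤ._+_ (F x) (G x)
zpoly-+ (suc d) (z , f , F , e) (z′ , f′ , F′ , e′) = z ℤ.+ z′ , _ , zpoly-+ d F F′ ,
  λ x → trans (cong₂ ℤ._+_ (e x) (e′ x)) (collect z z′ (ℤ.+ x) (f x) (f′ x))
  where
  collect : ∀ z z′ x a b → z ℤ.+ x ℤ.* a ℤ.+ (z′ ℤ.+ x ℤ.* b) ≡ z ℤ.+ z′ ℤ.+ x ℤ.* (a ℤ.+ b)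
  collect = ℤ-solve-∀

zpoly-scale : ∀ d c {f} → IsZPoly d f → IsZPoly d (λ x → c ℤ.* f x)
zpoly-scale zero    c F = λ x → trans (cong (c ℤ.*_) (F x)) (ℤₚ.*-zeroʳ c)
zpoly-scale (suc d) c (z , f , F , e) = c ℤ.* z , _ , zpoly-scale d c F ,
  λ x → trans (cong (c ℤ.*_) (e x)) (distribute c z (ℤ.+ x) (f x))
  where
  distribute : ∀ c z x a → c ℤ.* (z ℤ.+ x ℤ.* a) ≡ c ℤ.* z ℤ.+ x ℤ.* (c ℤ.* a)
  distribute = ℤ-solve-∀

-- Synthetic division: if `k` is the quotient of `g`, then x·g(x) - r·g(r) = (x-r)·(g(x) + r·k(x)).
zpoly-quotient : ∀ d {f} → IsZPoly (suc d) f → ∀ r →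
  Σ[ h ∈ (ℕ → ℤ) ] IsZPoly d h × (∀ x → f x ≡ f r ℤ.+ (ℤ.+ x ℤ.- ℤ.+ r) ℤ.* h x)
zpoly-quotient zero {f} (z , g , G , e) r = (λ _ → ℤ.0ℤ) , (λ _ → refl) , λ x → trans (value x)
  (sym (trans (cong₂ ℤ._+_ (value r) (ℤₚ.*-zeroʳ (ℤ.+ x ℤ.- ℤ.+ r))) (ℤₚ.+-identityʳ z)))
  where
  value : ∀ x → f x ≡ z
  value x = trans (e x) (trans (cong (λ y → z ℤ.+ ℤ.+ x ℤ.* y) (G x))
    (trans (cong (ℤ._+_ z) (ℤₚ.*-zeroʳ (ℤ.+ x))) (ℤₚ.+-identityʳ z)))
zpoly-quotient (suc d) {f} (z , g , G , e) r with zpoly-quotient d G r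
... | k , K , e′ = (λ x → g x ℤ.+ ℤ.+ r ℤ.* k x) ,
  zpoly-+ (suc d) G (zpoly-weaken d (zpoly-scale d (ℤ.+ r) K)) , λ x → begin
  f x
    ≡⟨ trans (e x) (cong (λ y → z ℤ.+ ℤ.+ x ℤ.* y) (e′ x)) ⟩
  z ℤ.+ ℤ.+ x ℤ.* (g r ℤ.+ (ℤ.+ x ℤ.- ℤ.+ r) ℤ.* k x)
    ≡⟨ identity z (ℤ.+ x) (ℤ.+ r) (g r) (k x) ⟩
  z ℤ.+ ℤ.+ r ℤ.* g r ℤ.+ (ℤ.+ x ℤ.- ℤ.+ r) ℤ.* (g r ℤ.+ (ℤ.+ x ℤ.- ℤ.+ r) ℤ.* k x ℤ.+ ℤ.+ r ℤ.* k x)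
    ≡⟨ cong₂ (λ a b → a ℤ.+ (ℤ.+ x ℤ.- ℤ.+ r) ℤ.* (b ℤ.+ ℤ.+ r ℤ.* k x)) (sym (e r)) (sym (e′ x)) ⟩
  f r ℤ.+ (ℤ.+ x ℤ.- ℤ.+ r) ℤ.* (g x ℤ.+ ℤ.+ r ℤ.* k x) ∎
  where
  identity : ∀ z x r a k → z ℤ.+ x ℤ.* (a ℤ.+ (x ℤ.- r) ℤ.* k) ≡
    z ℤ.+ r ℤ.* a ℤ.+ (x ℤ.- r) ℤ.* (a ℤ.+ (x ℤ.- r) ℤ.* k ℤ.+ r ℤ.* k)
  identity = ℤ-solve-∀

-- The remaining roots pass to the quotient because ℤ has no zero divisors and x - r is non-zero
-- there.
zpoly-divide : ∀ d {f} → IsZPoly (suc d) f → ∀ r → f r ≡ ℤ.0ℤ → Σ[ h ∈ (ℕ → ℤ) ] IsZPoly d h ×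
  (∀ x → f x ≡ (ℤ.+ x ℤ.- ℤ.+ r) ℤ.* h x) × (∀ j → f (r + suc j) ≡ ℤ.0ℤ → h (suc r + j) ≡ ℤ.0ℤ)
zpoly-divide d {f} F r fr≡0 with zpoly-quotient d F r
... | h , H , e = h , H , e₀ , λ j z → root j (subst (λ x → f x ≡ ℤ.0ℤ) (ℕₚ.+-suc r j) z)
  where
  e₀ : ∀ x → f x ≡ (ℤ.+ x ℤ.- ℤ.+ r) ℤ.* h x
  e₀ x = trans (e x) (trans (cong (ℤ._+ (ℤ.+ x ℤ.- ℤ.+ r) ℤ.* h x) fr≡0) (ℤₚ.+-identityˡ _))
  root : ∀ j → f (suc r + j) ≡ ℤ.0ℤ → h (suc r + j) ≡ ℤ.0ℤ
  root j z with ℤₚ.i*j≡0⇒i≡0∨j≡0 (ℤ.+ (suc r + j) ℤ.- ℤ.+ r) (trans (sym (e₀ (suc r + j))) z)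
  ... | inj₂ h≡0 = h≡0
  ... | inj₁ x≡r = contradiction (ℤₚ.+-injective (ℤₚ.i-j≡0⇒i≡j _ _ x≡r))
                     (λ eq → ℕₚ.m≢1+m+n r (sym eq))

-- Each division removes one coefficient and keeps all later roots, so after `d` divisions only the
-- zero function is left.
zpoly-roots : ∀ d {f} → IsZPoly d f → ∀ r → (∀ j → f (r + j) ≡ ℤ.0ℤ) → ∀ x → f x ≡ ℤ.0ℤ
zpoly-roots zero    F r z = F
zpoly-roots (suc d) {f} F r z x
  with h , H , e , root ← zpoly-divide d F r (trans (cong f (sym (ℕₚ.+-identityʳ r))) (z 0)) =
  trans (e x) (trans (cong ((ℤ.+ x ℤ.- ℤ.+ r) ℤ.*_) (zpoly-roots d H (suc r) (λ j → root j (z (suc j))) x))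
    (ℤₚ.*-zeroʳ (ℤ.+ x ℤ.- ℤ.+ r)))

-- The product (x-r)(x-r-1)⋯(x-r-k+1).
falling : ℕ → ℕ → ℕ → ℤ
falling zero    r x = ℤ.1ℤ
falling (suc k) r x = (ℤ.+ x ℤ.- ℤ.+ r) ℤ.* falling k (suc r) x

zpoly-factor : ∀ k d {f} → IsZPoly d f → ∀ r → (∀ j → j < k → f (r + j) ≡ ℤ.0ℤ) →
  Σ[ q ∈ (ℕ → ℤ) ] (∀ x → f x ≡ falling k r x ℤ.* q x)
zpoly-factor zero    d {f} F r z = f , λ x → sym (ℤₚ.*-identityˡ (f x))
-- The prescribed roots may outnumber the coefficients; then the function is zero and so is its
-- quotient.
zpoly-factor (suc k) zero    F r z = (λ _ → ℤ.0ℤ) , λ x → trans (F x) (sym (ℤₚ.*-zeroʳ (falling (suc k) r x)))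
zpoly-factor (suc k) (suc d) {f} F r z
  with h , H , e , root ← zpoly-divide d F r (trans (cong f (sym (ℕₚ.+-identityʳ r))) (z 0 (s≤s z≤n)))
  with q , e′ ← zpoly-factor k d H (suc r) (λ j j<k → root j (z (suc j) (s≤s j<k))) =
  q , λ x → trans (e x) (trans (cong ((ℤ.+ x ℤ.- ℤ.+ r) ℤ.*_) (e′ x))
    (sym (ℤₚ.*-assoc (ℤ.+ x ℤ.- ℤ.+ r) (falling k (suc r) x) (q x))))

-- Each of the `k` factors is at least `t`.
falling-large : ∀ k r x t → r + k + t ≤ x → t ^ k ≤ ℤ.∣ falling k r x ∣
falling-large zero    r x t le = s≤s z≤n
falling-large (suc k) r x t le = ℕₚ.≤-trans (ℕₚ.*-mono-≤ first (falling-large k (suc r) x t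
    (subst (λ y → y + t ≤ x) (ℕₚ.+-suc r k) le)))
  (ℕₚ.≤-reflexive (sym (ℤₚ.abs-* (ℤ.+ x ℤ.- ℤ.+ r) (falling k (suc r) x))))
  where
  r+t≤x : r + t ≤ x
  r+t≤x = ℕₚ.≤-trans (ℕₚ.+-monoˡ-≤ t (ℕₚ.m≤m+n r (suc k))) le
  first : t ≤ ℤ.∣ ℤ.+ x ℤ.- ℤ.+ r ∣
  first = ℕₚ.≤-trans (ℕₚ.m+n≤o⇒m≤o∸n t (subst (_≤ x) (ℕₚ.+-comm r t) r+t≤x)) (ℕₚ.≤-reflexive (sym abs≡))
    where
    abs≡ : ℤ.∣ ℤ.+ x ℤ.- ℤ.+ r ∣ ≡ x ∸ r
    abs≡ = trans (cong ℤ.∣_∣ (ℤₚ.m-n≡m⊖n x r)) (cong ℤ.∣_∣ (ℤₚ.⊖-≥ (ℕₚ.≤-trans (ℕₚ.m≤m+n r t) r+t≤x)))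

-- `B` is the sum of the absolute values of the coefficients. Powers of `suc x` are positive even at
-- 0, so they also dominate the constant term.
zpoly-bound : ∀ d {f} → IsZPoly d f → ∃ λ B → ∀ x → ℤ.∣ f x ∣ ≤ B * suc x ^ d
zpoly-bound zero    F = 0 , λ x → ℕₚ.≤-reflexive (cong ℤ.∣_∣ (F x))
zpoly-bound (suc d) {f} (z , g , G , e) with zpoly-bound d G
... | B , b = ℤ.∣ z ∣ + B , λ x → ℕₚ.≤-trans (ℕₚ.≤-reflexive (cong ℤ.∣_∣ (e x)))
  (ℕₚ.≤-trans (ℤₚ.∣i+j∣≤∣i∣+∣j∣ z (ℤ.+ x ℤ.* g x))
    (ℕₚ.≤-trans (ℕₚ.+-mono-≤ (ℕₚ.m≤m*n ℤ.∣ z ∣ (suc x ^ suc d) {{ℕₚ.m^n≢0 (suc x) (suc d)}}) (second x))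
      (ℕₚ.≤-reflexive (sym (ℕₚ.*-distribʳ-+ (suc x ^ suc d) ℤ.∣ z ∣ B)))))
  where
  second : ∀ x → ℤ.∣ ℤ.+ x ℤ.* g x ∣ ≤ B * suc x ^ suc d
  second x = ℕₚ.≤-trans (ℕₚ.≤-reflexive (ℤₚ.abs-* (ℤ.+ x) (g x)))
    (ℕₚ.≤-trans (ℕₚ.*-mono-≤ (ℕₚ.n≤1+n x) (b x)) (ℕₚ.≤-reflexive (swap (suc x) B (suc x ^ d))))
    where
    swap : ∀ x B y → x * (B * y) ≡ B * (x * y)
    swap = solve-∀

numerator-* : ∀ c → c ℚ.* ℤ→ℚ (ℚ.↧ c) ≡ ℤ→ℚ (ℚ.↥ c)
numerator-* c@record{} = ℚₚ.toℚᵘ-injective (ℚᵘₚ.≃-trans (ℚₚ.toℚᵘ-homo-* c (ℤ→ℚ (ℚ.↧ c)))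
  (ℚᵘₚ.≃-trans (ℚᵘₚ.*-congˡ {toℚᵘ c} (toℚᵘ-ℤ→ℚ (ℚ.↧ c)))
    (ℚᵘₚ.≃-trans (*≡* (trans (ℤₚ.*-assoc (ℚ.↥ c) (ℚ.↧ c) ℤ.1ℤ)
      (cong (ℚ.↥ c ℤ.*_) (sym (ℤₚ.pos-* (ℚ.↧ₙ c) 1))))) (ℚᵘₚ.≃-sym (toℚᵘ-ℤ→ℚ (ℚ.↥ c))))))

-- The multiplier `suc L` is the product of the denominators of all coefficients; its form shows
-- that it is positive.
clearDenominators : ∀ P → Σ[ L ∈ ℕ ] Σ[ h ∈ (ℕ → ℤ) ] IsZPoly (length P) h ×
  (∀ n → ℤ→ℚ (ℤ.+ suc L) ℚ.* evalPoly P n ≡ ℤ→ℚ (h n))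
clearDenominators []      = 0 , (λ _ → ℤ.0ℤ) , (λ _ → refl) , λ n → ℚₚ.*-zeroʳ (ℤ→ℚ (ℤ.+ 1))
clearDenominators (c ∷ P) with clearDenominators P
... | L , h , H , e = ℚ.denominator-1 c * suc L + L , _ ,
  (ℚ.↥ c ℤ.* ℤ.+ suc L , (λ n → ℚ.↧ c ℤ.* h n) , zpoly-scale (length P) (ℚ.↧ c) H , λ _ → refl) , λ n → begin
  ℤ→ℚ (ℤ.+ suc (ℚ.denominator-1 c * suc L + L)) ℚ.* evalPoly (c ∷ P) n
    ≡⟨ cong (ℚ._* evalPoly (c ∷ P) n) (trans (cong (λ y → ℤ→ℚ (ℤ.+ y)) (common (ℚ.denominator-1 c) L))
         (trans (cong ℤ→ℚ (ℤₚ.pos-* (ℚ.↧ₙ c) (suc L))) (ℤ→ℚ-* (ℚ.↧ c) (ℤ.+ suc L)))) ⟩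
  (ℤ→ℚ (ℚ.↧ c) ℚ.* ℤ→ℚ (ℤ.+ suc L)) ℚ.* (c ℚ.+ ℕ→ℚ n ℚ.* evalPoly P n)
    ≡⟨ solve 5 (λ d l c x p → (d :* l) :* (c :+ x :* p) := (c :* d) :* l :+ x :* (d :* (l :* p))) refl
         (ℤ→ℚ (ℚ.↧ c)) (ℤ→ℚ (ℤ.+ suc L)) c (ℕ→ℚ n) (evalPoly P n) ⟩
  (c ℚ.* ℤ→ℚ (ℚ.↧ c)) ℚ.* ℤ→ℚ (ℤ.+ suc L) ℚ.+ ℕ→ℚ n ℚ.* (ℤ→ℚ (ℚ.↧ c) ℚ.* (ℤ→ℚ (ℤ.+ suc L) ℚ.* evalPoly P n))
    ≡⟨ cong₂ (λ a b → a ℚ.* ℤ→ℚ (ℤ.+ suc L) ℚ.+ ℕ→ℚ n ℚ.* (ℤ→ℚ (ℚ.↧ c) ℚ.* b)) (numerator-* c) (e n) ⟩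
  ℤ→ℚ (ℚ.↥ c) ℚ.* ℤ→ℚ (ℤ.+ suc L) ℚ.+ ℕ→ℚ n ℚ.* (ℤ→ℚ (ℚ.↧ c) ℚ.* ℤ→ℚ (h n))
    ≡⟨ sym (trans (ℤ→ℚ-+ (ℚ.↥ c ℤ.* ℤ.+ suc L) _) (cong₂ ℚ._+_ (ℤ→ℚ-* (ℚ.↥ c) (ℤ.+ suc L))
         (trans (ℤ→ℚ-* (ℤ.+ n) _) (cong (ℕ→ℚ n ℚ.*_) (ℤ→ℚ-* (ℚ.↧ c) (h n)))))) ⟩
  ℤ→ℚ (ℚ.↥ c ℤ.* ℤ.+ suc L ℤ.+ ℤ.+ n ℤ.* (ℚ.↧ c ℤ.* h n)) ∎
  where
  common : ∀ d L → suc (d * suc L + L) ≡ suc d * suc L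
  common = solve-∀

record Integral (f : ℕ → ℕ) (d : ℕ) : Set where
  field
    denom   : ℕ
    poly    : ℕ → ℤ
    isZPoly : IsZPoly d poly
    value   : ∀ n → ℤ.+ (suc denom * f n) ≡ poly n

integral : ∀ {f} (F : Pol f) → Integral f (length (proj₁ (isPolynomial F)))
integral {f} (pol (P , p)) with clearDenominators P
... | L , h , H , e = record { denom = L ; poly = h ; isZPoly = H ; value = λ n →
  ℤ→ℚ-injective (trans (ℕ→ℚ-* (suc L) (f n)) (trans (cong (ℤ→ℚ (ℤ.+ suc L) ℚ.*_) (p n)) (e n))) }

*-^ : ∀ x y d → (x * y) ^ d ≡ x ^ d * y ^ d
*-^ x y zero    = refl
*-^ x y (suc d) = trans (cong (x * y *_) (*-^ x y d)) (regroup x y (x ^ d) (y ^ d))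
  where
  regroup : ∀ x y u v → x * y * (u * v) ≡ x * u * (y * v)
  regroup = solve-∀

-- f vanishes at 0,…,d, so its integer multiple poly is a multiple of x(x-1)⋯(x-d); being
-- O(xᵈ) it must vanish for large x, hence everywhere.
bounded-vanishing : ∀ {f g} (F : Pol f) (G : Pol g) K → (∀ n → f n ≤ K * g n) →
  (∀ j → j ≤ length (proj₁ (isPolynomial G)) → f j ≡ 0) → ∀ n → f n ≡ 0
bounded-vanishing {f} {g} F G K f≤ zeros n =
  scaled-zero n (zpoly-roots _ F.isZPoly (m + t₀) (λ j → poly-zero (m + t₀ + j)
    (subst (λ x → f x ≡ 0) (sym (ℕₚ.+-assoc m t₀ j)) (large (t₀ + j) (ℕₚ.m≤m+n t₀ j)))) n)
  where
  module F = Integral (integral F)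
  module G = Integral (integral G)
  d = length (proj₁ (isPolynomial G))
  m = suc d
  Lf = suc F.denom
  B = proj₁ (zpoly-bound d G.isZPoly)
  C = Lf * K * B
  -- The second summand gives m+t+1 ≤ 2t for t ≥ t₀, and the first gives C·2ᵈ < t; together
  -- C·(m+t+1)ᵈ ≤ C·2ᵈ·tᵈ < tᵐ, as m = d+1.
  t₀ = suc (C * 2 ^ d) + suc m

  poly-zero : ∀ x → f x ≡ 0 → F.poly x ≡ ℤ.0ℤ
  poly-zero x e = trans (sym (F.value x)) (cong ℤ.+_ (trans (cong (Lf *_) e) (ℕₚ.*-zeroʳ Lf)))

  scaled-zero : ∀ x → F.poly x ≡ ℤ.0ℤ → f x ≡ 0
  scaled-zero x e with ℕₚ.m*n≡0⇒m≡0∨n≡0 Lf (ℤₚ.+-injective (trans (F.value x) e))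
  ... | inj₂ z = z

  upperBound : ∀ x → Lf * f x ≤ C * suc x ^ d
  upperBound x = ℕₚ.≤-trans (ℕₚ.*-monoʳ-≤ Lf (f≤ x)) (ℕₚ.≤-trans (ℕₚ.≤-reflexive (sym (ℕₚ.*-assoc Lf K (g x))))
    (ℕₚ.≤-trans (ℕₚ.*-monoʳ-≤ (Lf * K) (ℕₚ.≤-trans (ℕₚ.m≤n*m (g x) (suc G.denom))
        (ℕₚ.≤-trans (ℕₚ.≤-reflexive (cong ℤ.∣_∣ (G.value x))) (proj₂ (zpoly-bound d G.isZPoly) x))))
      (ℕₚ.≤-reflexive (sym (ℕₚ.*-assoc (Lf * K) B (suc x ^ d))))))

  large : ∀ t → t₀ ≤ t → f (m + t) ≡ 0
  large t t₀≤t with zpoly-factor m _ F.isZPoly 0 (λ j j<m → poly-zero j (zeros j (ℕₚ.≤-pred j<m)))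
  -- Integrality is decisive: a non-zero value of `q` has absolute value at least 1, so the multiple
  -- of `f` is at least as large as `falling`, that is, at least tᵐ.
  ... | q , e with q (m + t) ℤ.≟ ℤ.0ℤ
  ... | yes z = scaled-zero (m + t)
    (trans (e (m + t)) (trans (cong (falling m 0 (m + t) ℤ.*_) z) (ℤₚ.*-zeroʳ (falling m 0 (m + t)))))
  ... | no q≢0 = contradiction (ℕₚ.<-≤-trans (ℕₚ.≤-<-trans (upperBound (m + t)) small) lowerBound) (ℕₚ.<-irrefl refl)
    where
    instance
      q-nonZero : ℕ.NonZero ℤ.∣ q (m + t) ∣
      q-nonZero = ℕ.≢-nonZero (λ z → q≢0 (ℤₚ.∣i∣≡0⇒i≡0 z))
      t-nonZero : ℕ.NonZero t
      t-nonZero = ℕ.>-nonZero (ℕₚ.≤-trans (s≤s z≤n) t₀≤t)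
    1+m+t≤2t : suc (m + t) ≤ 2 * t
    1+m+t≤2t = ℕₚ.≤-trans (ℕₚ.+-monoˡ-≤ t (ℕₚ.≤-trans (ℕₚ.m≤n+m (suc m) (suc (C * 2 ^ d))) t₀≤t))
      (ℕₚ.≤-reflexive (cong (t +_) (sym (ℕₚ.+-identityʳ t))))
    small : C * suc (m + t) ^ d < t ^ m
    small = ℕₚ.≤-<-trans (ℕₚ.*-monoʳ-≤ C (ℕₚ.^-monoˡ-≤ d 1+m+t≤2t))
      (ℕₚ.≤-<-trans (ℕₚ.≤-reflexive (trans (cong (C *_) (*-^ 2 t d)) (sym (ℕₚ.*-assoc C (2 ^ d) (t ^ d)))))
        (ℕₚ.*-monoˡ-< (t ^ d) {{ℕₚ.m^n≢0 t d}} (ℕₚ.≤-trans (ℕₚ.m≤m+n (suc (C * 2 ^ d)) (suc m)) t₀≤t)))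
    lowerBound : t ^ m ≤ Lf * f (m + t)
    lowerBound = ℕₚ.≤-trans (falling-large m 0 (m + t) t ℕₚ.≤-refl)
      (ℕₚ.≤-trans (ℕₚ.m≤m*n ℤ.∣ falling m 0 (m + t) ∣ ℤ.∣ q (m + t) ∣) (ℕₚ.≤-reflexive
        (trans (sym (ℤₚ.abs-* (falling m 0 (m + t)) (q (m + t))))
          (cong ℤ.∣_∣ (trans (sym (e (m + t))) (sym (F.value (m + t))))))))

-- Embedding numbers

module _ (F : Structure GraphSig) where

  private s = size F

  adjacencyOf : Fin s → Fin s → Formula GraphSig s
  adjacencyOf i j = if adj F i j then R tt (i ∷ j ∷ []) else neg (R tt (i ∷ j ∷ []))

  distinct : Fin s → Fin s → Formula GraphSig s
  distinct i j = if ⌊ i Fin.≟ j ⌋ then tru else neg (eq i j)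

  embFormula : Formula GraphSig s
  embFormula = ⋀ s λ i → ⋀ s λ j → conj (adjacencyOf i j) (distinct i j)

  adjacencyOf-QF : ∀ i j → IsQF (adjacencyOf i j)
  adjacencyOf-QF i j with adj F i j
  ... | true  = R tt _
  ... | false = neg (R tt _)

  distinct-QF : ∀ i j → IsQF (distinct i j)
  distinct-QF i j with ⌊ i Fin.≟ j ⌋
  ... | true  = tru
  ... | false = neg (eq i j)

  embFormula-QF : IsQF embFormula
  embFormula-QF = ⋀-QF s λ i → ⋀-QF s λ j → conj (adjacencyOf-QF i j) (distinct-QF i j)

  record Emb (A : Structure GraphSig) (v : Vec (Fin (size A)) s) : Set where
    field
      emb-adj : ∀ i j → adj A (lookup v i) (lookup v j) ≡ adj F i j
      emb-inj : ∀ {i j} → lookup v i ≡ lookup v j → i ≡ j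
  open Emb public

  module _ {A : Structure GraphSig} {v : Vec (Fin (size A)) s} where

    ⊨-emb⇒ : A ⊨ embFormula [ v ] → Emb A v
    ⊨-emb⇒ h = record
      { emb-adj = λ i j → adjacency i j (proj₁ (⊨-conj⇒ (⊨-⋀⇒ s (⊨-⋀⇒ s h i) j)))
      ; emb-inj = λ {i} {j} e → injective i j (proj₂ (⊨-conj⇒ (⊨-⋀⇒ s (⊨-⋀⇒ s h i) j))) e }
      where
      adjacency : ∀ i j → A ⊨ adjacencyOf i j [ v ] → adj A (lookup v i) (lookup v j) ≡ adj F i j
      adjacency i j h with adj F i j
      adjacency i j (sat✓ e) | true  = e
      adjacency i j h | false = 𝔹.¬-not λ e → ⊨-neg⇒ h (sat✓ e)
      injective : ∀ i j → A ⊨ distinct i j [ v ] → lookup v i ≡ lookup v j → i ≡ j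
      injective i j h e with i Fin.≟ j
      ... | yes p = p
      ... | no ¬p = contradiction (⊨-eq⇐ e) (⊨-neg⇒ h)

    ⊨-emb⇐ : Emb A v → A ⊨ embFormula [ v ]
    ⊨-emb⇐ E = ⊨-⋀⇐ s λ i → ⊨-⋀⇐ s λ j → ⊨-conj⇐ (adjacency i j) (injective i j)
      where
      adjacency : ∀ i j → A ⊨ adjacencyOf i j [ v ]
      adjacency i j with adj F i j | emb-adj E i j
      ... | true  | e = sat✓ e
      ... | false | e = sat✓ (cong not e)
      injective : ∀ i j → A ⊨ distinct i j [ v ]
      injective i j with i Fin.≟ j
      ... | yes p = sat✓ refl
      ... | no ¬p = ⊨-neg⇐ λ h → ¬p (emb-inj E (⊨-eq⇒ h))

  #emb : Structure GraphSig → ℕ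
  #emb = #sat embFormula

  #emb-positive : ∀ A → #emb A ≢ 0 → ∃ λ v → Emb A v
  #emb-positive A ≢0 with v , p ← sumᵛ-positive (size A) s _ ≢0 with sat A embFormula v in e
  ... | true  = v , ⊨-emb⇒ (sat✓ e)
  ... | false = contradiction refl p

  #emb-nonzero : ∀ A v → Emb A v → #emb A ≢ 0
  #emb-nonzero A v E z = contradiction (ℕₚ.≤-trans (ℕₚ.≤-reflexive (sym (⟦true⟧ (sat≡true (⊨-emb⇐ E)))))
    (ℕₚ.≤-trans (term≤sumᵛ (size A) s _ v) (ℕₚ.≤-reflexive z))) λ ()

  #emb-self : #emb F ≢ 0
  #emb-self = #emb-nonzero F (V.allFin s) record
    { emb-adj = λ i j → cong₂ (adj F) (Vₚ.lookup-allFin i) (Vₚ.lookup-allFin j)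
    ; emb-inj = λ {i} {j} e → trans (sym (Vₚ.lookup-allFin i)) (trans e (Vₚ.lookup-allFin j)) }

  -- A two-colouring constant along edges is constant. In this form connectedness applies directly
  -- to the two sides of a disjoint union, without paths. The empty graph satisfies it too, whence
  -- the side conditions `size F ≢ 0`.
  Connected : Set
  Connected = ∀ (χ : Fin s → Bool) → (∀ i j → adj F i j ≡ true → χ i ≡ χ j) → ∀ i j → χ i ≡ χ j

module _ (M N : ℕ) where

  sumᵛ-left : ∀ p (f : Vec (Fin (M + N)) p → ℕ) → (∀ v j y → lookup v j ≡ M ↑ʳ y → f v ≡ 0) →
    sumᵛ (M + N) p f ≡ sumᵛ M p (f ∘ V.map (_↑ˡ N))
  sumᵛ-left zero    f z = refl
  sumᵛ-left (suc p) f z = trans (sum-split M N _) (trans (cong₂ _+_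
    (sum-cong-≗ λ i → sumᵛ-left p (f ∘ ((i ↑ˡ N) ∷_)) (λ v j → z ((i ↑ˡ N) ∷ v) (suc j)))
    (sum-zero {N} _ λ j → sumᵛ-zero (M + N) p _ λ v → z ((M ↑ʳ j) ∷ v) zero j refl)) (ℕₚ.+-identityʳ _))

  sumᵛ-right : ∀ p (f : Vec (Fin (M + N)) p → ℕ) → (∀ v j x → lookup v j ≡ x ↑ˡ N → f v ≡ 0) →
    sumᵛ (M + N) p f ≡ sumᵛ N p (f ∘ V.map (M ↑ʳ_))
  sumᵛ-right zero    f z = refl
  sumᵛ-right (suc p) f z = trans (sum-split M N _) (cong₂ _+_
    (sum-zero {M} _ λ i → sumᵛ-zero (M + N) p _ λ v → z ((i ↑ˡ N) ∷ v) zero i refl)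
    (sum-cong-≗ λ j → sumᵛ-right p (f ∘ ((M ↑ʳ j) ∷_)) (λ v i → z ((M ↑ʳ j) ∷ v) (suc i))))

  -- The first coordinate decides the side and the others must follow it. The empty tuple would be
  -- counted on both sides.
  sumᵛ-onesided : ∀ p → p ≢ 0 → (f : Vec (Fin (M + N)) p → ℕ) →
    (∀ v i j x y → lookup v i ≡ x ↑ˡ N → lookup v j ≡ M ↑ʳ y → f v ≡ 0) →
    sumᵛ (M + N) p f ≡ sumᵛ M p (f ∘ V.map (_↑ˡ N)) + sumᵛ N p (f ∘ V.map (M ↑ʳ_))
  sumᵛ-onesided zero    p≢0 f z = contradiction refl p≢0
  sumᵛ-onesided (suc p) _   f z = trans (sum-split M N _) (cong₂ _+_
    (sum-cong-≗ λ i → sumᵛ-left p (f ∘ ((i ↑ˡ N) ∷_)) λ v j y → z ((i ↑ˡ N) ∷ v) zero (suc j) i y refl)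
    (sum-cong-≗ λ j → sumᵛ-right p (f ∘ ((M ↑ʳ j) ∷_)) λ v i x e → z ((M ↑ʳ j) ∷ v) (suc i) zero x j e refl))

module _ (G H : Graph) where

  private
    m = size (str G)
    k = size (str H)

  adj-⊎ : ∀ x y → adj (str (G ⊎ᴳ H)) (join m k x) (join m k y) ≡ edge⊎ ⟨ str G ⟩ ⟨ str H ⟩ x y
  adj-⊎ x y = trans (_≅_.to-edge (⟨⊎ᴳ⟩ G H) (join m k x) (join m k y))
    (cong₂ (edge⊎ ⟨ str G ⟩ ⟨ str H ⟩) (Finₚ.splitAt-join m k x) (Finₚ.splitAt-join m k y))

  side : Fin (m + k) → Bool
  side x = [ (λ _ → true) , (λ _ → false) ] (splitAt m x)

  adj⇒side : ∀ x y → adj (str (G ⊎ᴳ H)) x y ≡ true → side x ≡ side y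
  adj⇒side x y e with splitAt m x | splitAt m y
  ... | inj₁ _ | inj₁ _ = refl
  ... | inj₂ _ | inj₂ _ = refl

  -- Colouring the vertices of `F` by the side of their images is constant along edges, so an
  -- embedding of a connected `F` stays in one summand.
  #emb-⊎ : ∀ F → Connected F → size F ≢ 0 → #emb F (str (G ⊎ᴳ H)) ≡ #emb F (str G) + #emb F (str H)
  #emb-⊎ F conn ≢0 = trans (sumᵛ-onesided m k (size F) ≢0 _ mixed) (cong₂ _+_
    (sumᵛ-cong m (size F) λ v → cong ⟦_⟧ (sym (sat-embedding (str G) (str (G ⊎ᴳ H)) (_↑ˡ k) (Finₚ.↑ˡ-injective k _ _)
      (λ { tt (x ∷ y ∷ []) → sym (adj-⊎ (inj₁ x) (inj₁ y)) }) (embFormula-QF F) v)))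
    (sumᵛ-cong k (size F) λ v → cong ⟦_⟧ (sym (sat-embedding (str H) (str (G ⊎ᴳ H)) (m ↑ʳ_) (Finₚ.↑ʳ-injective m _ _)
      (λ { tt (x ∷ y ∷ []) → sym (adj-⊎ (inj₂ x) (inj₂ y)) }) (embFormula-QF F) v))))
    where
    mixed : ∀ v i j x y → lookup v i ≡ x ↑ˡ k → lookup v j ≡ m ↑ʳ y → ⟦ sat (str (G ⊎ᴳ H)) (embFormula F) v ⟧ ≡ 0
    mixed v i j x y p q with sat (str (G ⊎ᴳ H)) (embFormula F) v in e
    ... | false = refl
    ... | true = contradiction (trans (sym onLeft) (trans (conn (side ∘ lookup v)
            (λ i j a → adj⇒side (lookup v i) (lookup v j) (trans (emb-adj em i j) a)) i j) onRight)) λ ()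
      where
      em = ⊨-emb⇒ F (sat✓ e)
      onLeft : side (lookup v i) ≡ true
      onLeft = trans (cong side p) (cong [ (λ _ → true) , (λ _ → false) ] (Finₚ.splitAt-↑ˡ m x k))
      onRight : side (lookup v j) ≡ false
      onRight = trans (cong side q) (cong [ (λ _ → true) , (λ _ → false) ] (Finₚ.splitAt-↑ʳ m k y))

#emb-empty : ∀ F → size F ≢ 0 → #emb F (str emptyGraph) ≡ 0
#emb-empty F ≢0 = go (size F) ≢0 _
  where
  go : ∀ p → p ≢ 0 → (f : Vec (Fin 0) p → ℕ) → sumᵛ 0 p f ≡ 0
  go zero    ≢0 f = contradiction refl ≢0
  go (suc p) ≢0 f = refl

module _ (F : Structure GraphSig) (conn : Connected F) (≢0 : size F ≢ 0) where

  #emb-copies : ∀ c H → #emb F (str (copies c H)) ≡ c * #emb F (str H)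
  #emb-copies zero    H = #emb-empty F ≢0
  #emb-copies (suc c) H = trans (#emb-⊎ H (copies c H) F conn ≢0) (cong (#emb F (str H) +_) (#emb-copies c H))

  #emb-bigUnion : ∀ k (G : Fin k → Graph) → #emb F (str (bigUnion k G)) ≡ sum (λ i → #emb F (str (G i)))
  #emb-bigUnion zero    G = #emb-empty F ≢0
  #emb-bigUnion (suc k) G = trans (#emb-⊎ (G zero) (bigUnion k (G ∘ suc)) F conn ≢0)
    (cong (#emb F (str (G zero)) +_) (#emb-bigUnion k (G ∘ suc)))

injective⇒surjective : ∀ {m n} → m ≡ n → (h : Fin m → Fin n) → (∀ {x y} → h x ≡ h y → x ≡ y) → ∀ y → ∃ λ x → h x ≡ y
injective⇒surjective {suc n} refl h inj y with Finₚ.any? (λ x → h x Fin.≟ y)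
... | yes p = p
... | no ¬p = contradiction (Finₚ.injective⇒≤ {f = λ x → Fin.punchOut (missed x)}
                λ {x} {x′} e → inj (Finₚ.punchOut-injective (missed x) (missed x′) e)) (ℕₚ.<⇒≱ (ℕₚ.n<1+n n))
  where
  missed : ∀ x → y ≢ h x
  missed x e = ¬p (x , sym e)

bijective⇒≅ : ∀ {X Y} (h : Vertex X → Vertex Y) → (∀ {x y} → h x ≡ h y → x ≡ y) → (∀ y → ∃ λ x → h x ≡ y) →
  (∀ x y → edge X x y ≡ edge Y (h x) (h y)) → X ≅ Y
bijective⇒≅ h inj surj edges = record
  { to = h ; from = proj₁ ∘ surj ; from-to = λ x → inj (proj₂ (surj (h x))) ; to-from = proj₂ ∘ surj ; to-edge = edges }

≅⇒size≡ : ∀ (A B : Structure GraphSig) → ⟨ A ⟩ ≅ ⟨ B ⟩ → size A ≡ size B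
≅⇒size≡ A B f = ↔⇒≡ (proj₁ (≅⇒Iso A B f))

#emb-≅ : ∀ F A B → ⟨ A ⟩ ≅ ⟨ B ⟩ → #emb F A ≡ #emb F B
#emb-≅ F A B f = #sat-iso A B (≅⇒Iso A B f) (embFormula-QF F)

emb⇒size≤ : ∀ F A {v} → Emb F A v → size F ≤ size A
emb⇒size≤ F A E = Finₚ.injective⇒≤ (emb-inj E)

emb⇒≅ : ∀ F A {v} → Emb F A v → size F ≡ size A → ⟨ F ⟩ ≅ ⟨ A ⟩
emb⇒≅ F A {v} E e = bijective⇒≅ (lookup v) (emb-inj E) (injective⇒surjective e (lookup v) (emb-inj E))
  (λ i j → sym (emb-adj E i j))

-- Embeddings between graphs of equal size are bijective, so comparing sizes and computing one
-- embedding number decides isomorphism.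
_≅?_ : ∀ F A → Dec (⟨ F ⟩ ≅ ⟨ A ⟩)
F ≅? A with size F ℕ.≟ size A | #emb F A ℕ.≟ 0
... | no ≢s | _      = no λ f → ≢s (≅⇒size≡ F A f)
... | yes _ | yes ≡0 = no λ f → #emb-self F (trans (#emb-≅ F F A f) ≡0)
... | yes e | no ≢0  = yes (emb⇒≅ F A (proj₂ (#emb-positive F A ≢0)) e)

-- Connected subgraphs and components

-- Enumerations, in reverse, of connected sets of vertices.
data Grown (A : Structure GraphSig) : ∀ {s} → Vec (Fin (size A)) s → Set where
  one  : ∀ x → Grown A (x ∷ [])
  grow : ∀ {s} {v : Vec (Fin (size A)) s} x i → Grown A v → adj A (lookup v i) x ≡ true →
         (∀ j → x ≢ lookup v j) → Grown A (x ∷ v)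

grown-nonempty : ∀ {A s} {v : Vec (Fin (size A)) s} → Grown A v → s ≢ 0
grown-nonempty (one x) ()
grown-nonempty (grow x i g a d) ()

grown-injective : ∀ {A s} {v : Vec (Fin (size A)) s} → Grown A v → ∀ {i j} → lookup v i ≡ lookup v j → i ≡ j
grown-injective (one x)          {zero}  {zero}  e = refl
grown-injective (grow x i g a d) {zero}  {zero}  e = refl
grown-injective (grow x i g a d) {zero}  {suc j} e = contradiction e (d j)
grown-injective (grow x i g a d) {suc k} {zero}  e = contradiction (sym e) (d k)
grown-injective (grow x i g a d) {suc k} {suc j} e = cong suc (grown-injective g e)

grown-transfer : ∀ {A B s} {v : Vec (Fin (size A)) s} (w : Vec (Fin (size B)) s) →
  (∀ i j → adj B (lookup w i) (lookup w j) ≡ adj A (lookup v i) (lookup v j)) →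
  (∀ {i j} → lookup w i ≡ lookup w j → i ≡ j) → Grown A v → Grown B w
grown-transfer (y ∷ [])    e inj (one x)          = one y
grown-transfer (y ∷ w)     e inj (grow x i g a d) = grow y i
  (grown-transfer w (λ i j → e (suc i) (suc j)) (λ h → Finₚ.suc-injective (inj h)) g)
  (trans (e (suc i) zero) a) (λ j h → case inj {zero} {suc j} h of λ ())

grown? : ∀ A {s} (v : Vec (Fin (size A)) s) → Dec (Grown A v)
grown? A []          = no λ ()
grown? A (x ∷ [])    = yes (one x)
grown? A (x ∷ v@(_ ∷ _)) with grown? A v
... | no ¬g = no λ { (grow _ _ g _ _) → ¬g g }
... | yes g with Finₚ.any? (λ i → adj A (lookup v i) x 𝔹.≟ true) | Finₚ.all? (λ j → ¬? (x Fin.≟ lookup v j))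
... | no ¬a       | _      = no λ { (grow _ i _ a _) → ¬a (i , a) }
... | yes _       | no ¬d  = no λ { (grow _ _ _ _ d) → ¬d d }
... | yes (i , a) | yes d  = yes (grow x i g a d)

induced : (G : Graph) {s : ℕ} → (Fin s → Fin (size (str G))) → Graph
induced G {s} f = record
  { str    = record { size = s ; rel = λ { tt (i ∷ j ∷ []) → adj (str G) (f i) (f j) } }
  ; symm   = λ i j → symm G (f i) (f j)
  ; irrefl = λ i → irrefl G (f i) }

grown-connected : ∀ G {s} {v : Vec (Fin (size (str G))) s} → Grown (str G) v → Connected (str (induced G (lookup v)))
grown-connected G (one x) χ pres zero zero = refl
grown-connected G (grow {v = v} x k g a d) χ pres = all
  where
  tail : ∀ i j → χ (suc i) ≡ χ (suc j)
  tail = grown-connected G g (χ ∘ suc) (λ i j → pres (suc i) (suc j))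
  head : χ (suc k) ≡ χ zero
  head = pres (suc k) zero a
  all : ∀ i j → χ i ≡ χ j
  all zero    zero    = refl
  all zero    (suc j) = trans (sym head) (tail k j)
  all (suc i) zero    = trans (tail i k) head
  all (suc i) (suc j) = tail i j

emb-induced : ∀ G {s} {v : Vec (Fin (size (str G))) s} → Grown (str G) v → Emb (str (induced G (lookup v))) (str G) v
emb-induced G g = record { emb-adj = λ i j → refl ; emb-inj = grown-injective g }

⟦⌊⌋⟧ : ∀ {P : Set} (P? : Dec P) → P → ⟦ ⌊ P? ⌋ ⟧ ≡ 1
⟦⌊⌋⟧ (yes _) p = refl
⟦⌊⌋⟧ (no ¬p) p = contradiction p ¬p

module _ (G : Graph) where

  private N = size (str G)

  degree≡sum : ∀ x → degree G x ≡ sum (λ y → ⟦ adj (str G) x y ⟧)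
  degree≡sum x = trans (sumˡ-length (filterᵇ (adj (str G) x) (L.allFin N)))
    (trans (sumˡ-filterᵇ (λ _ → 1) (adj (str G) x) (L.allFin N))
      (trans (sumˡ-tabulate (λ y → ⟦ adj (str G) x y ⟧ * 1) N id) (sum-cong-≗ {N} λ y → ℕₚ.*-identityʳ _)))

  #grown : ℕ → ℕ
  #grown s = sumᵛ N s (λ v → ⟦ ⌊ grown? (str G) v ⌋ ⟧)

  grown-extend : ∀ {s} x (v : Vec (Fin N) (suc s)) → ⟦ ⌊ grown? (str G) (x ∷ v) ⌋ ⟧ ≤
    ⟦ ⌊ grown? (str G) v ⌋ ⟧ * sum (λ i → ⟦ adj (str G) (lookup v i) x ⟧)
  grown-extend x v with grown? (str G) (x ∷ v)
  ... | no _ = z≤n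
  ... | yes (grow _ i g a d) = ℕₚ.≤-trans (ℕₚ.≤-reflexive (sym (⟦true⟧ a)))
    (ℕₚ.≤-trans (term≤sum (λ i → ⟦ adj (str G) (lookup v i) x ⟧) i)
      (ℕₚ.≤-reflexive (trans (sym (ℕₚ.*-identityˡ _))
        (cong (_* sum (λ i → ⟦ adj (str G) (lookup v i) x ⟧)) (sym (⟦⌊⌋⟧ (grown? (str G) v) g))))))

  module _ (D : ℕ) (bound : ∀ x → degree G x ≤ D) where

    -- A new vertex must be a neighbour of one of the `suc s` vertices already present, each of
    -- which has at most `D` neighbours.
    #grown-suc : ∀ s → #grown (suc (suc s)) ≤ #grown (suc s) * (suc s * D)
    #grown-suc s = ℕₚ.≤-trans (sum-mono λ x → sumᵛ-mono N (suc s) (grown-extend x))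
      (ℕₚ.≤-trans (ℕₚ.≤-reflexive (sumᵛ-∑ {N} N (suc s)
          (λ x v → ⟦ ⌊ grown? (str G) v ⌋ ⟧ * sum (λ i → ⟦ adj (str G) (lookup v i) x ⟧))))
        (ℕₚ.≤-trans (sumᵛ-mono N (suc s) extensions)
          (ℕₚ.≤-reflexive (sumᵛ-*ʳ N (suc s) (suc s * D) (λ v → ⟦ ⌊ grown? (str G) v ⌋ ⟧)))))
      where
      extensions : ∀ v → sum (λ x → ⟦ ⌊ grown? (str G) v ⌋ ⟧ * sum (λ i → ⟦ adj (str G) (lookup v i) x ⟧)) ≤
        ⟦ ⌊ grown? (str G) v ⌋ ⟧ * (suc s * D)
      extensions v = ℕₚ.≤-trans
        (ℕₚ.≤-reflexive (sym (*-distribˡ-sum {N} ⟦ ⌊ grown? (str G) v ⌋ ⟧ _)))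
        (ℕₚ.*-monoʳ-≤ ⟦ ⌊ grown? (str G) v ⌋ ⟧ (ℕₚ.≤-trans
          (ℕₚ.≤-reflexive (∑-comm {N} {suc s} (λ x i → ⟦ adj (str G) (lookup v i) x ⟧)))
          (ℕₚ.≤-trans (sum-mono {suc s} λ i →
              ℕₚ.≤-trans (ℕₚ.≤-reflexive (sym (degree≡sum (lookup v i)))) (bound (lookup v i)))
            (ℕₚ.≤-reflexive (sum-const (suc s) D)))))

-- At s+1 this is s!·Dˢ; at 0 it is 0 because a grown tuple is never empty.
growth : ℕ → ℕ → ℕ
growth D zero          = 0
growth D (suc zero)    = 1
growth D (suc (suc s)) = growth D (suc s) * (suc s * D)

#grown≤ : ∀ G D → (∀ x → degree G x ≤ D) → ∀ s → #grown G s ≤ growth D s * size (str G)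
#grown≤ G D bound zero          = z≤n
#grown≤ G D bound (suc zero)    = ℕₚ.≤-reflexive (trans (sum-const (size (str G)) 1) (ℕₚ.*-comm (size (str G)) 1))
#grown≤ G D bound (suc (suc s)) = ℕₚ.≤-trans (#grown-suc G D bound s)
  (ℕₚ.≤-trans (ℕₚ.*-monoˡ-≤ (suc s * D) (#grown≤ G D bound (suc s)))
    (ℕₚ.≤-reflexive (swap (growth D (suc s)) (size (str G)) (suc s * D))))
  where
  swap : ∀ a b c → a * b * c ≡ a * c * b
  swap = solve-∀

-- Any connected induced subgraph of a host, not necessarily a full component. The growing
-- enumeration is kept because it carries over to every embedded copy, which bounds the number of
-- copies, and because it yields connectedness.
record Component : Set where
  field
    host  : Graph
    order : ℕ
    tuple : Vec (Fin (size (str host))) order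
    grown : Grown (str host) tuple

  shape : Graph
  shape = induced host (lookup tuple)

  net : Net
  net = ⟨ str shape ⟩

  connected : Connected (str shape)
  connected = grown-connected host grown

  nonempty : size (str shape) ≢ 0
  nonempty = grown-nonempty grown
open Component public

#emb≤ : ∀ C G D → (∀ x → degree G x ≤ D) → #emb (str (shape C)) (str G) ≤ growth D (order C) * size (str G)
#emb≤ C G D bound = ℕₚ.≤-trans (sumᵛ-mono (size (str G)) (order C) pointwise) (#grown≤ G D bound (order C))
  where
  pointwise : ∀ v → ⟦ sat (str G) (embFormula (str (shape C))) v ⟧ ≤ ⟦ ⌊ grown? (str G) v ⌋ ⟧
  pointwise v with sat (str G) (embFormula (str (shape C))) v in e
  ... | false = z≤n
  ... | true  = ℕₚ.≤-reflexive (sym (⟦⌊⌋⟧ (grown? (str G) v)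
    (grown-transfer v (emb-adj em) (emb-inj em) (grown C))))
    where em = ⊨-emb⇒ (str (shape C)) (sat✓ e)

-- Isomorphism types of connected subgraphs

record Representatives (xs : List Component) : Set₁ where
  field
    number   : ℕ
    rep      : Fin number → Component
    rep-inj  : ∀ {i j} → net (rep i) ≅ net (rep j) → i ≡ j
    rep-covers : ∀ {X} → Any (λ C → net C ≅ X) xs → ∃ λ i → net (rep i) ≅ X

representatives : ∀ xs → Representatives xs
representatives [] = record { number = 0 ; rep = λ () ; rep-inj = λ { {()} } ; rep-covers = λ () }
representatives (C ∷ xs) with representatives xs
... | rs with Finₚ.any? (λ i → str (shape (Representatives.rep rs i)) ≅? str (shape C))
... | yes (i , f) = record
  { number = number ; rep = rep ; rep-inj = rep-inj
  ; rep-covers = λ { (here g) → i , ≅-trans f g ; (there p) → rep-covers p } }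
  where open Representatives rs
... | no ¬f = record
  { number = suc number ; rep = rep′ ; rep-inj = λ {i} {j} → inj i j
  ; rep-covers = λ { (here g) → zero , g ; (there p) → let (i , f) = rep-covers p in suc i , f } }
  where
  open Representatives rs
  rep′ : Fin (suc number) → Component
  rep′ zero    = C
  rep′ (suc i) = rep i
  inj : ∀ i j → net (rep′ i) ≅ net (rep′ j) → i ≡ j
  inj zero    zero    f = refl
  inj zero    (suc j) f = contradiction (j , ≅-sym f) ¬f
  inj (suc i) zero    f = contradiction (i , f) ¬f
  inj (suc i) (suc j) f = cong suc (rep-inj f)

componentsAt : (G : Graph) {s : ℕ} → Vec (Fin (size (str G))) s → List Component
componentsAt G {s} v with grown? (str G) v
... | yes g = record { host = G ; order = s ; tuple = v ; grown = g } ∷ []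
... | no _  = []

components : Graph → List Component
components G = concatMap (λ s → concatMap (componentsAt G) (tuples (size (str G)) s)) (L.upTo (suc (size (str G))))

any-tuples : ∀ {N p} {P : Vec (Fin N) p → Set} v → P v → Any P (tuples N p)
any-tuples []      h = here h
any-tuples {N} (x ∷ v) h = Anyₚ.concatMap⁺ _ (Any.map (λ { refl → Anyₚ.map⁺ (any-tuples v h) }) (∈-allFin x))

any-components : ∀ G {s} (v : Vec (Fin (size (str G))) s) → Grown (str G) v → ∀ {X} →
  ⟨ str (induced G (lookup v)) ⟩ ≅ X → Any (λ C → net C ≅ X) (components G)
any-components G {s} v g {X} f = Anyₚ.concatMap⁺
  (λ s → concatMap (componentsAt G) (tuples (size (str G)) s)) (Any.map
  (λ { refl → Anyₚ.concatMap⁺ (componentsAt G) (any-tuples v here′) })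
  (∈-upTo⁺ (s≤s (Finₚ.injective⇒≤ (grown-injective g)))))
  where
  here′ : Any (λ C → net C ≅ X) (componentsAt G v)
  here′ with grown? (str G) v
  ... | yes _ = here f
  ... | no ¬g = contradiction g ¬g

-- Splitting off a component

⌊⌋⇒ : ∀ {P : Set} (P? : Dec P) → ⌊ P? ⌋ ≡ true → P
⌊⌋⇒ (yes p) _ = p

⌊⌋⇐ : ∀ {P : Set} (P? : Dec P) → P → ⌊ P? ⌋ ≡ true
⌊⌋⇐ (yes _) _ = refl
⌊⌋⇐ (no ¬p) p = contradiction p ¬p

record Enumeration {N : ℕ} (P : Fin N → Set) : Set where
  field
    total    : ℕ
    nth      : Fin total → Fin N
    nth-inj  : ∀ {x y} → nth x ≡ nth y → x ≡ y
    sound    : ∀ x → P (nth x)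
    complete : ∀ y → P y → ∃ λ x → nth x ≡ y

-- The subset becomes the interpretation of a unary symbol, so that the facts about lists of
-- solutions apply to it.
enumerate : ∀ {N} {P : Fin N → Set} → (∀ x → Dec (P x)) → Enumeration P
enumerate {N} {P} P? = record
  { total    = length (solutions φ M)
  ; nth      = nth
  ; nth-inj  = λ e → solutions-injective φ M (head-injective _ _ e)
  ; sound    = λ i → sound′ (L.lookup (solutions φ M) i) (sat≡true (solutions-sound φ M i))
  ; complete = λ y p → let (i , e) = solutions-complete φ M (y ∷ []) (sat✓ (⌊⌋⇐ (P? y) p)) in i , cong V.head e }
  where
  M : Structure (unarySig ⊤)
  M = record { size = N ; rel = λ _ v → ⌊ P? (V.head v) ⌋ }
  φ : Formula (unarySig ⊤) 1
  φ = R tt (zero ∷ [])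
  nth = λ i → V.head (L.lookup (solutions φ M) i)
  head-injective : ∀ (v w : Vec (Fin N) 1) → V.head v ≡ V.head w → v ≡ w
  head-injective (x ∷ []) (y ∷ []) refl = refl
  sound′ : ∀ v → sat M φ v ≡ true → P (V.head v)
  sound′ (x ∷ []) e = ⌊⌋⇒ (P? x) e

module _ (G : Graph) where

  private
    N = size (str G)
    adjG = adj (str G)

  Closed : ∀ {s} → Vec (Fin N) s → Set
  Closed v = ∀ i x → adjG (lookup v i) x ≡ true → ∃ λ j → x ≡ lookup v j

  record ClosedGrown : Set where
    field
      {card}   : ℕ
      members : Vec (Fin N) card
      isGrown : Grown (str G) members
      closed  : Closed members

  -- The entries of a grown tuple are distinct, so its length never exceeds `N`, and a closed tuple
  -- is reached before the fuel runs out.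
  saturate : ∀ fuel {s} (v : Vec (Fin N) s) → Grown (str G) v → N < s + fuel → ClosedGrown
  saturate zero    {s} v g N<s = contradiction
    (ℕₚ.<-≤-trans (subst (N <_) (ℕₚ.+-identityʳ s) N<s) (Finₚ.injective⇒≤ (grown-injective g))) (ℕₚ.<-irrefl refl)
  saturate (suc fuel) {s} v g N<
    with Finₚ.any? (λ x → Finₚ.any? (λ i → adjG (lookup v i) x 𝔹.≟ true) ×-dec Finₚ.all? (λ j → ¬? (x Fin.≟ lookup v j)))
  ... | yes (x , (i , a) , d) = saturate fuel (x ∷ v) (grow x i g a d) (subst (N <_) (ℕₚ.+-suc s fuel) N<)
  ... | no ¬x = record { members = v ; isGrown = g ; closed = closed }
    where
    closed : Closed v
    closed i x a with Finₚ.any? (λ j → x Fin.≟ lookup v j)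
    ... | yes p = p
    ... | no ¬p = contradiction (x , (i , a) , λ j e → ¬p (j , e)) ¬x

  module _ (W : ClosedGrown) where
    open ClosedGrown W

    outside : Enumeration (λ x → ∀ i → lookup members i ≢ x)
    outside = enumerate λ x → Finₚ.all? λ i → ¬? (lookup members i Fin.≟ x)

    open Enumeration outside

    rest : Graph
    rest = induced G nth

    splitOff : ⟨ str G ⟩ ≅ ⟨ str (induced G (lookup members)) ⟩ ⊎ᴺ ⟨ str rest ⟩
    splitOff = ≅-sym (bijective⇒≅ h inj surj edges)
      where
      h : Fin card ⊎ Fin total → Fin N
      h = [ lookup members , nth ]
      inj : ∀ {x y} → h x ≡ h y → x ≡ y
      inj {inj₁ i} {inj₁ j} e = cong inj₁ (grown-injective isGrown e)
      inj {inj₂ x} {inj₂ y} e = cong inj₂ (nth-inj e)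
      inj {inj₁ i} {inj₂ y} e = contradiction e (sound y i)
      inj {inj₂ x} {inj₁ j} e = contradiction (sym e) (sound x j)
      surj : ∀ y → ∃ λ x → h x ≡ y
      surj y with Finₚ.any? (λ i → lookup members i Fin.≟ y)
      ... | yes (i , e) = inj₁ i , e
      ... | no ¬p with x , e ← complete y (λ i e → ¬p (i , e)) = inj₂ x , e
      apart : ∀ i y → false ≡ adjG (lookup members i) (nth y)
      apart i y = sym (𝔹.¬-not λ a → let (j , e) = closed i (nth y) a in sound y j (sym e))
      edges : ∀ x y → edge⊎ ⟨ str (induced G (lookup members)) ⟩ ⟨ str rest ⟩ x y ≡ adjG (h x) (h y)
      edges (inj₁ i) (inj₁ j) = refl
      edges (inj₂ x) (inj₂ y) = refl
      edges (inj₁ i) (inj₂ y) = apart i y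
      edges (inj₂ x) (inj₁ j) = trans (apart j x) (symm G (lookup members j) (nth x))

    rest-smaller : total < N
    rest-smaller = shrink members (grown-nonempty isGrown) sound
      where
      shrink : ∀ {s} (v : Vec (Fin N) s) → s ≢ 0 → (∀ x i → lookup v i ≢ nth x) → total < N
      shrink []      ≢0 out = contradiction refl ≢0
      shrink (w ∷ v) ≢0 out = Finₚ.injective⇒≤ {f = f} inj
        where
        f : Fin (suc total) → Fin N
        f zero    = w
        f (suc x) = nth x
        inj : ∀ {x y} → f x ≡ f y → x ≡ y
        inj {zero}  {zero}  e = refl
        inj {zero}  {suc y} e = contradiction e (out y zero)
        inj {suc x} {zero}  e = contradiction (sym e) (out x zero)
        inj {suc x} {suc y} e = cong suc (nth-inj e)

-- Decomposition into components

module _ {k : ℕ} (F : Fin k → Net) where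

  Multi : (Fin k → ℕ) → Net
  Multi c = Σᴺ λ i → Σᴺ {c i} λ _ → F i

  Multi-zero : ∀ {X} → (Vertex X → ⊥) → X ≅ Multi (λ _ → 0)
  Multi-zero none = bijective⇒≅ (λ x → ⊥-elim (none x)) (λ {x} _ → ⊥-elim (none x)) (λ { (_ , () , _) })
    (λ x → ⊥-elim (none x))

bump : ∀ {k} → Fin k → (Fin k → ℕ) → Fin k → ℕ
bump zero    c zero    = suc (c zero)
bump zero    c (suc j) = c (suc j)
bump (suc i) c zero    = c zero
bump (suc i) c (suc j) = bump i (c ∘ suc) j

Multi-bump : ∀ {k} (F : Fin k → Net) i c → F i ⊎ᴺ Multi F c ≅ Multi F (bump i c)
Multi-bump F zero    c = ≅-trans (⊎ᴺ-cong ≅-refl (≅-sym (Σᴺ-suc _)))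
  (≅-trans (⊎ᴺ-assoc _ _ _) (≅-trans (⊎ᴺ-cong (Σᴺ-suc _) ≅-refl) (Σᴺ-suc _)))
Multi-bump F (suc i) c = ≅-trans (⊎ᴺ-cong ≅-refl (≅-sym (Σᴺ-suc _)))
  (≅-trans (⊎ᴺ-assoc _ _ _) (≅-trans (⊎ᴺ-cong (⊎ᴺ-comm _ _) ≅-refl)
    (≅-trans (≅-sym (⊎ᴺ-assoc _ _ _)) (≅-trans (⊎ᴺ-cong ≅-refl (Multi-bump (F ∘ suc) i (c ∘ suc))) (Σᴺ-suc _)))))

module _ {k : ℕ} (F : Fin k → Net) where

  -- Demanding this of all connected induced subgraphs, rather than of the components alone, makes
  -- the property hereditary, as the induction in `decompose` requires.
  Covers : Graph → Set
  Covers G = ∀ {s} (v : Vec (Fin (size (str G))) s) → Grown (str G) v → ∃ λ i → F i ≅ ⟨ str (induced G (lookup v)) ⟩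

  covers-induced : ∀ G {s} (h : Fin s → Fin (size (str G))) → (∀ {x y} → h x ≡ h y → x ≡ y) →
    Covers G → Covers (induced G h)
  covers-induced G h inj cov v g with cov (V.map h v) (grown-transfer (V.map h v) edges
      (λ {i} {j} e → grown-injective g (inj (trans (sym (Vₚ.lookup-map i h v)) (trans e (Vₚ.lookup-map j h v))))) g)
    where
    edges : ∀ i j → adj (str G) (lookup (V.map h v) i) (lookup (V.map h v) j) ≡ adj (str G) (h (lookup v i)) (h (lookup v j))
    edges i j = cong₂ (adj (str G)) (Vₚ.lookup-map i h v) (Vₚ.lookup-map j h v)
  ... | i , f = i , ≅-trans f (bijective⇒≅ id id (λ y → y , refl)
    λ x y → cong₂ (adj (str G)) (Vₚ.lookup-map x h v) (Vₚ.lookup-map y h v))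

  decompose : ∀ fuel G → size (str G) ≤ fuel → Covers G → ∃ λ c → ⟨ str G ⟩ ≅ Multi F c
  decompose fuel G le cov with Finₚ.any? {size (str G)} (λ _ → yes tt)
  decompose fuel G le cov | no none = (λ _ → 0) , Multi-zero F (λ x → none (x , tt))
  decompose zero G le cov | yes (x , _) = contradiction (ℕₚ.≤-trans (Finₚ.toℕ<n x) le) λ ()
  decompose (suc fuel) G le cov | yes (x , _) with saturate G (size (str G)) (x ∷ []) (one x) (ℕₚ.n<1+n _)
  ... | W with cov (ClosedGrown.members W) (ClosedGrown.isGrown W)
             | decompose fuel (rest G W) (ℕₚ.≤-pred (ℕₚ.≤-trans (rest-smaller G W) le))
                 (covers-induced G _ (Enumeration.nth-inj (outside G W)) cov)
  ... | i , f | c , g = bump i c , ≅-trans (splitOff G W) (≅-trans (⊎ᴺ-cong (≅-sym f) g) (Multi-bump F i c))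

poly-summand : ∀ {k} (t : Fin k → ℕ → ℕ) j → Pol (λ n → sum (λ i → t i n)) → (∀ i → i ≢ j → Pol (t i)) → Pol (t j)
poly-summand t zero    P Q = poly-difference (λ n → ℕₚ.+-comm (t zero n) _) P
  (poly-sum (t ∘ suc) (λ i → Q (suc i) λ ()))
poly-summand t (suc j) P Q = poly-summand (t ∘ suc) j (poly-difference (λ n → refl) P (Q zero λ ()))
  λ i i≢j → Q (suc i) (i≢j ∘ Finₚ.suc-injective)

-- Polynomial multiplicities

module StronglyPolynomial⇒2 (A : ℕ → Graph) (D : ℕ) (bound : ∀ n x → degree (A n) x ≤ D)
  (SP : StrongPol (λ n → str (A n))) where

  sizePol : Pol (λ n → size (str (A n)))
  sizePol = poly-cong (λ n → trans (sum-const (size (str (A n))) 1) (ℕₚ.*-identityʳ _)) (SP {1} {tru} tru)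

  -- The length of the coefficient list for |Aₙ| governs the growth of all embedding numbers of
  -- connected graphs at once; therefore A₀,...,Aₘ already exhibit every connected pattern.
  m : ℕ
  m = length (proj₁ (isPolynomial sizePol))

  embPol : ∀ F → Pol (λ n → #emb F (str (A n)))
  embPol F = SP (embFormula-QF F)

  reps : Representatives (concatMap (λ j → components (A j)) (L.upTo (suc m)))
  reps = representatives _

  open Representatives reps renaming (number to k)

  early : ∀ C n → #emb (str (shape C)) (str (A n)) ≢ 0 →
    ∃ λ (j : Fin (suc m)) → #emb (str (shape C)) (str (A (toℕ j))) ≢ 0
  early C n ≢0 with Finₚ.any? {suc m} (λ j → ¬? (#emb (str (shape C)) (str (A (toℕ j))) ℕ.≟ 0))
  ... | yes p = p
  ... | no ¬p = contradiction (bounded-vanishing (embPol (str (shape C))) sizePol (growth D (order C))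
      (λ n → #emb≤ C (A n) D (bound n)) zeros n) ≢0
    where
    zeros : ∀ j → j ≤ m → #emb (str (shape C)) (str (A j)) ≡ 0
    zeros j j≤m with #emb (str (shape C)) (str (A j)) ℕ.≟ 0
    ... | yes z = z
    ... | no ≢0 = contradiction (Fin.fromℕ< (s≤s j≤m) ,
      subst (λ i → #emb (str (shape C)) (str (A i)) ≢ 0) (sym (Finₚ.toℕ-fromℕ< (s≤s j≤m))) ≢0) ¬p

  covered : ∀ n → Covers (net ∘ rep) (A n)
  covered n {s} v g
    with j , ≢0 ← early record { host = A n ; order = s ; tuple = v ; grown = g } n
                    (#emb-nonzero _ (str (A n)) v (emb-induced (A n) g))
    with w , em ← #emb-positive (str (induced (A n) (lookup v))) (str (A (toℕ j))) ≢0 =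
    -- The image `w` of the pattern in an early graph is again grown and induces an isomorphic
    -- graph, so it appears in the list from which `reps` was formed.
    rep-covers (Anyₚ.concatMap⁺ (λ j → components (A j)) (Any.map
      (λ { refl → any-components (A (toℕ j)) w (grown-transfer w (emb-adj em) (emb-inj em) g)
           (bijective⇒≅ id id (λ y → y , refl) (emb-adj em)) })
      (∈-upTo⁺ (Finₚ.toℕ<n j))))

  decomposition : ∀ n → ∃ λ c → ⟨ str (A n) ⟩ ≅ Multi (net ∘ rep) c
  decomposition n = decompose (net ∘ rep) (size (str (A n))) (A n) ℕₚ.≤-refl (covered n)

  -- The decompositions are chosen for each `n` separately, with no uniformity in `n`; polynomiality
  -- is recovered afterwards from the equations `expand`.
  c : Fin k → ℕ → ℕ
  c i n = proj₁ (decomposition n) i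

  F : Fin k → Graph
  F = shape ∘ rep

  iso : ∀ n → ⟨ str (A n) ⟩ ≅ ⟨ str (bigUnion k (λ i → copies (c i n) (F i))) ⟩
  iso n = ≅-trans (proj₂ (decomposition n)) (≅-sym (bigUnion≅Σ k _ _ (λ i → copies≅Σ (c i n) (F i))))

  e : Fin k → Fin k → ℕ
  e j i = #emb (str (F j)) (str (F i))

  expand : ∀ j n → #emb (str (F j)) (str (A n)) ≡ sum (λ i → c i n * e j i)
  expand j n = trans (#emb-≅ (str (F j)) _ _ (iso n)) (trans
    (#emb-bigUnion (str (F j)) (connected (rep j)) (nonempty (rep j)) k _)
    (sum-cong-≗ {k} λ i → #emb-copies (str (F j)) (connected (rep j)) (nonempty (rep j)) (c i n) (F i)))

  -- An embedding between representatives of equal size would be an isomorphism, and distinct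
  -- representatives are not isomorphic.
  triangular : ∀ j i → i ≢ j → e j i ≡ 0 ⊎ size (str (F j)) < size (str (F i))
  triangular j i i≢j with e j i ℕ.≟ 0
  ... | yes z = inj₁ z
  ... | no ≢0 with v , em ← #emb-positive (str (F j)) (str (F i)) ≢0 =
    inj₂ (ℕₚ.≤∧≢⇒< (emb⇒size≤ (str (F j)) (str (F i)) em)
      λ s≡ → i≢j (sym (rep-inj (emb⇒≅ (str (F j)) (str (F i)) em s≡))))

  maxSize : ℕ
  maxSize = sum (λ i → size (str (F i)))

  -- Downward induction on the size of F j: only components larger than F j interfere.
  cPol : ∀ b j → maxSize < size (str (F j)) + b → Pol (c j)
  cPol zero    j lt = contradiction (ℕₚ.<-≤-trans (subst (maxSize <_) (ℕₚ.+-identityʳ _) lt)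
    (term≤sum (λ i → size (str (F i))) j)) (ℕₚ.<-irrefl refl)
  cPol (suc b) j lt = cancel (e j j) (#emb-self (str (F j)))
    (poly-summand (λ i n → c i n * e j i) j (poly-cong (expand j) (embPol (str (F j)))) others)
    where
    cancel : ∀ d → d ≢ 0 → Pol (λ n → c j n * d) → Pol (c j)
    cancel zero    d≢0 P = contradiction refl d≢0
    cancel (suc d) _   P = poly-÷ d (poly-cong (λ n → ℕₚ.*-comm (c j n) (suc d)) P)
    others : ∀ i → i ≢ j → Pol (λ n → c i n * e j i)
    others i i≢j with triangular j i i≢j
    ... | inj₁ z  = poly-cong (λ n → sym (trans (cong (c i n *_) z) (ℕₚ.*-zeroʳ (c i n)))) (poly-const 0)
    ... | inj₂ s< = poly-* (cPol b i (ℕₚ.<-≤-trans (subst (maxSize <_) (ℕₚ.+-suc _ b) lt)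
      (ℕₚ.+-monoˡ-≤ b s<))) (poly-const (e j i))

  condition2 : Condition2 A
  -- With `b` equal to `suc maxSize`, the bound in `cPol` holds whatever the size of the
  -- representative.
  condition2 = k , F , c , (λ i → isPolynomial (cPol (suc maxSize) i (ℕₚ.m≤n+m (suc maxSize) _))) ,
    λ n → ≅⇒Iso (str (A n)) (str (bigUnion k (λ i → copies (c i n) (F i)))) (iso n)

stronglyPolynomial⇒condition2 : ∀ A → BoundedDegree A → StronglyPolynomial (λ n → str (A n)) → Condition2 A
stronglyPolynomial⇒condition2 A (D , bound) SP =
  StronglyPolynomial⇒2.condition2 A D bound (toStrongPol SP)

theorem5p3 : (A : ℕ → Graph) → BoundedDegree A →
    ((StronglyPolynomial (λ n → str (A n)) ⇔ Condition2 A) ×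
    (StronglyPolynomial (λ n → str (A n)) ⇔ Condition3 A))
theorem5p3 A bd =
  mk⇔ (stronglyPolynomial⇒condition2 A bd) (condition3⇒stronglyPolynomial A ∘ condition2⇒condition3 A) ,
  mk⇔ (condition2⇒condition3 A ∘ stronglyPolynomial⇒condition2 A bd) (condition3⇒stronglyPolynomial A)
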